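{- For every $n\ge1$, $[\mathrm{VAL}_n]=[\mathrm{SAT}_n]\cap[\overline{\mathrm{SAT}}_n]$.
   Context: $\Sigma=\{0,1\}$, $\Sigma^*$ the finite nonempty binary strings; for $x\in\Sigma^m$, $\pi_1(x)=x_1$. $\mathbb{P}_+\Sigma=\{\{0\},\{1\},\Sigma\}$. A promise problem is $\phi:\Sigma^*\to\mathbb{P}_+\Sigma$; a problem $\psi:\Sigma^*\to\Sigma$ is identified with $x\mapsto\{\psi(x)\}$. $\phi_1\propto\phi_2$ means there is a polynomial-time computable $\mu:\Sigma^*\to\Sigma^*$ with $\phi_1(x)\supseteq\phi_2(\mu(x))$ for all $x$; $[\phi]=\{\phi_1:\phi_1\propto\phi\}$. Level-$n$ problems: the input encodes (e.g. dimensions in binary plus a Boolean formula) $f:\Sigma^{m_1}\times\dots\times\Sigma^{m_n}\to\Sigma$, written $f(x,y^{(1)},\dots,y^{(n-1)})$ with $x\in\Sigma^{m_1}$; $f_x$ is $f$ with $x$ fixed. For a constant $c$, $\mathrm{SAT}_0(c)=\overline{\mathrm{SAT}}_0(c)=c$; for $n\ge1$, $\mathrm{SAT}_n(f)=1\iff\exists x:\overline{\mathrm{SAT}}_{n-1}(f_x)=1$, $\overline{\mathrm{SAT}}_n(f)=1\iff\forall x,\ \mathrm{SAT}_{n-1}(f_x)=1$, and $\mathrm{VAL}_n(f)=\{\pi_1x:\overline{\mathrm{SAT}}_{n-1}(f_x)=1\}$ if $\mathrm{SAT}_n(f)=1$, and $\Sigma$ otherwise. -}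

module Defs where

open import Data.Bool.Base using (Bool; true; false; T; not; _∧_; _∨_; if_then_else_)
open import Data.Bool.Properties using (_≟_)
open import Data.Digit using (toDigits; fromDigits; Bit)
open import Data.Fin.Base as Fin using (Fin; zero; suc)
open import Data.Fin.Properties using (2↔Bool)
open import Data.Fin.Subset.Properties using (anySubset?)
open import Data.List.Base as List using (List; []; _∷_; _++_; length; reverse; concatMap; foldl)
open import Data.List.NonEmpty.Base as List⁺ using (List⁺; _∷_)
open import Data.List.Properties using (++-assoc; ++-identityʳ; reverse-foldl)
open import Data.Maybe.Base as Maybe using (Maybe; just; nothing; fromMaybe; _>>=_)
open import Data.Nat.Base using (ℕ; zero; suc; _+_; _*_; _^_; NonZero)
open import Data.Product.Base using (∃; ∃-syntax; _×_; _,_; proj₁; proj₂)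
open import Data.Unit.Base using (tt)
open import Data.Vec.Base as Vec using (Vec; []; _∷_)
open import Data.Vec.Membership.Propositional.Properties using (∈-lookup)
open import Data.Vec.Relation.Unary.All as All using (All; []; _∷_)
open import Function.Base using (_∘_)
open import Function.Bundles using (module Inverse)
open import Level using (0ℓ)
open import Relation.Binary.PropositionalEquality
  using (_≡_; refl; sym; trans; cong)
open import Relation.Nullary.Decidable
  using (Dec; yes; no; does; ¬?; _×-dec_; map′; decidable-stable)
open import Relation.Unary using (Pred; Decidable; _⊇_)

------------------------------------------------------------------------
-- Deterministic multi-tape Turing machines

data Symbol (marks : ℕ) : Set where
  blank : Symbol marks
  bit   : Bool → Symbol marks
  mark  : Fin marks → Symbol marks

data Move : Set where
  left stay right : Move

-- A two-way infinite tape.  Both sides are listed starting from the cell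
-- next to the head, and all cells that are not listed are blank.
record Tape (marks : ℕ) : Set where
  constructor tape
  field
    before : List (Symbol marks)
    scan   : Symbol marks
    after  : List (Symbol marks)

write : ∀ {g} → Symbol g → Tape g → Tape g
write a (tape ls _ rs) = tape ls a rs

move : ∀ {g} → Move → Tape g → Tape g
move left  (tape []       a rs) = tape [] blank (a ∷ rs)
move left  (tape (l ∷ ls) a rs) = tape ls l (a ∷ rs)
move stay  t                    = t
move right (tape ls a [])       = tape (a ∷ ls) blank []
move right (tape ls a (r ∷ rs)) = tape (a ∷ ls) r rs

-- The machine halts when δ returns nothing.
record Machine : Set where
  field
    states marks extraTapes : ℕ

  tapes : ℕ
  tapes = suc extraTapes

  field
    start : Fin states
    δ     : Fin states → Vec (Symbol marks) tapes →
            Maybe (Fin states × Vec (Symbol marks × Move) tapes)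

module _ (M : Machine) where
  open Machine M

  Config : Set
  Config = Fin states × Vec (Tape marks) tapes

  step : Config → Maybe Config
  step (q , ts) = Maybe.map
    (λ (q′ , as) → q′ , Vec.zipWith (λ (a , d) t → move d (write a t)) as ts)
    (δ q (Vec.map Tape.scan ts))

  data HaltsWithin : ℕ → Config → Config → Set where
    halt : ∀ {t c} → step c ≡ nothing → HaltsWithin t c c
    next : ∀ {t c c′ d} → step c ≡ just c′ → HaltsWithin t c′ d →
           HaltsWithin (suc t) c d

  -- The input is on the first tape, with the head on its first bit.
  initial : List⁺ Bool → Config
  initial (b ∷ bs) =
    start , tape [] (bit b) (List.map bit bs) ∷ Vec.replicate _ (tape [] blank [])

-- The bits from the head rightwards, up to the first symbol that is not a bit.
leadingBits : ∀ {g} → List (Symbol g) → List Bool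
leadingBits (bit b ∷ as) = b ∷ leadingBits as
leadingBits _            = []

contents : ∀ {g} → Tape g → List Bool
contents (tape _ a rs) = leadingBits (a ∷ rs)

output : (M : Machine) → Config M → List Bool
output _ (_ , t ∷ _) = contents t

-- Inputs have length at least 1, so the bounds c * n ^ k majorise all
-- polynomials.
PolyTime : (List⁺ Bool → List⁺ Bool) → Set
PolyTime μ =
  ∃[ M ] ∃[ c ] ∃[ k ] ∀ w →
    ∃[ d ] HaltsWithin M (c * List⁺.length w ^ k) (initial M w) d
         × output M d ≡ List⁺.toList (μ w)

------------------------------------------------------------------------
-- Promise problems

record ℙ₊Σ : Set where
  field
    member   : Bool → Bool
    nonempty : ∃[ b ] T (member b)

⟦_⟧ : ℙ₊Σ → Pred Bool 0ℓ
⟦ S ⟧ b = T (ℙ₊Σ.member S b)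

T-does : ∀ {A : Set} (a? : Dec A) → A → T (does a?)
T-does (yes _) _ = tt
T-does (no ¬a) a = ¬a a

singleton : Bool → ℙ₊Σ
singleton a = record
  { member   = λ b → does (a ≟ b)
  ; nonempty = a , T-does (a ≟ a) refl
  }

PromiseProblem : Set
PromiseProblem = List⁺ Bool → ℙ₊Σ

problem : (List⁺ Bool → Bool) → PromiseProblem
problem ψ x = singleton (ψ x)

infix 4 _∝_

_∝_ : PromiseProblem → PromiseProblem → Set
φ₁ ∝ φ₂ = ∃[ μ ] PolyTime μ × (∀ x → ⟦ φ₁ x ⟧ ⊇ ⟦ φ₂ (μ x) ⟧)

[_] : PromiseProblem → Pred PromiseProblem 0ℓ
[ φ ] φ₁ = φ₁ ∝ φ

------------------------------------------------------------------------
-- Quantified evaluation of a Boolean function of n blocks of variables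

-- Blocks are nonempty: ms lists the predecessors of the dimensions.
Block : ℕ → Set
Block m = Vec Bool (suc m)

π₁ : ∀ {m} → Block m → Bool
π₁ = Vec.head

Fun : ∀ {n} → Vec ℕ n → Set
Fun ms = All Block ms → Bool

fix : ∀ {n m} {ms : Vec ℕ n} → Fun (m ∷ ms) → Block m → Fun ms
fix f x ys = f (x ∷ ys)

-- The library's Subset n is Vec Bool n.
any? : ∀ {m} {P : Pred (Block m) 0ℓ} → Decidable P → Dec (∃[ x ] P x)
any? = anySubset?

all? : ∀ {m} {P : Pred (Block m) 0ℓ} → Decidable P → Dec (∀ x → P x)
all? P? = map′
  (λ ¬∃¬ x → decidable-stable (P? x) (λ ¬p → ¬∃¬ (x , ¬p)))
  (λ ∀p (x , ¬p) → ¬p (∀p x))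
  (¬? (any? (¬? ∘ P?)))

sat sat‾ : ∀ {n} (ms : Vec ℕ n) → Fun ms → Bool

sat []       f = f []
sat (m ∷ ms) f = does (any? λ x → sat‾ ms (fix f x) ≟ true)

sat‾ []       f = f []
sat‾ (m ∷ ms) f = does (all? λ x → sat ms (fix f x) ≟ true)

T-if : ∀ {A : Set} (a? : Dec A) (S : Bool → Bool) → (A → ∃[ b ] T (S b)) →
       ∃[ b ] T (if does a? then S b else true)
T-if (yes a) _ ne = ne a
T-if (no _)  _ _  = true , tt

val : ∀ {n} (ms : Vec ℕ (suc n)) → Fun ms → ℙ₊Σ
val (m ∷ ms) f = record
  { member   = λ b → if sat (m ∷ ms) f then firstBits b else true
  ; nonempty = T-if (any? λ x → sat‾ ms (fix f x) ≟ true) firstBits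
                 λ (x , p) → π₁ x , T-does (firstBit? (π₁ x)) (x , p , refl)
  }
  where
  firstBit? : ∀ b → Dec (∃[ x ] sat‾ ms (fix f x) ≡ true × π₁ x ≡ b)
  firstBit? b = any? λ x → (sat‾ ms (fix f x) ≟ true) ×-dec (π₁ x ≟ b)

  firstBits : Bool → Bool
  firstBits b = does (firstBit? b)

------------------------------------------------------------------------
-- Boolean formulas

-- var i j is the j-th coordinate of the i-th block.
data Formula {n} (ms : Vec ℕ n) : Set where
  const     : Bool → Formula ms
  var       : (i : Fin n) → Fin (suc (Vec.lookup ms i)) → Formula ms
  neg       : Formula ms → Formula ms
  conj disj : Formula ms → Formula ms → Formula ms

eval : ∀ {n} {ms : Vec ℕ n} → Formula ms → Fun ms
eval (const b)  ρ = b
eval (var i j)  ρ = Vec.lookup (All.lookup ρ (∈-lookup i _)) j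
eval (neg φ)    ρ = not (eval φ ρ)
eval (conj φ ψ) ρ = eval φ ρ ∧ eval ψ ρ
eval (disj φ ψ) ρ = eval φ ρ ∨ eval ψ ρ

Instance : ℕ → Set
Instance n = ∃[ ms ] Formula {n} ms

------------------------------------------------------------------------
-- Binary encoding of instances: the predecessors of the dimensions,
-- followed by the formula in reverse Polish notation

data Token : Set where
  NUM              : ℕ → Token
  CONST            : Bool → Token
  VAR NEG AND OR   : Token

pattern 𝟎 = false
pattern 𝟏 = true

digits : ℕ → List Bit
digits n = reverse (proj₁ (toDigits 2 n))

-- Binary digits, most significant first, each preceded by 𝟏; 𝟎 terminates.
codeDigits : List Bit → List Bool
codeDigits []       = 𝟎 ∷ []
codeDigits (d ∷ ds) = 𝟏 ∷ Inverse.to 2↔Bool d ∷ codeDigits ds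

code : Token → List Bool
code (CONST b) = 𝟎 ∷ 𝟎 ∷ 𝟎 ∷ b ∷ []
code NEG       = 𝟎 ∷ 𝟎 ∷ 𝟏 ∷ 𝟎 ∷ []
code VAR       = 𝟎 ∷ 𝟎 ∷ 𝟏 ∷ 𝟏 ∷ []
code AND       = 𝟎 ∷ 𝟏 ∷ 𝟎 ∷ []
code OR        = 𝟎 ∷ 𝟏 ∷ 𝟏 ∷ []
code (NUM n)   = 𝟏 ∷ codeDigits (digits n)

rpn : ∀ {n} {ms : Vec ℕ n} → Formula ms → List Token
rpn (const b)  = CONST b ∷ []
rpn (var i j)  = VAR ∷ NUM (Fin.toℕ i) ∷ NUM (Fin.toℕ j) ∷ []
rpn (neg φ)    = rpn φ ++ NEG ∷ []
rpn (conj φ ψ) = rpn φ ++ rpn ψ ++ AND ∷ []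
rpn (disj φ ψ) = rpn φ ++ rpn ψ ++ OR ∷ []

encode : ∀ {n} → Instance n → List Bool
encode (ms , φ) = concatMap code (List.map NUM (Vec.toList ms) ++ rpn φ)

lex    : List Bool → Maybe (List Token)
lexNum : ℕ → List Bool → Maybe (List Token)

lex []                = just []
lex (𝟎 ∷ 𝟎 ∷ 𝟎 ∷ b ∷ w) = Maybe.map (CONST b ∷_) (lex w)
lex (𝟎 ∷ 𝟎 ∷ 𝟏 ∷ 𝟎 ∷ w) = Maybe.map (NEG ∷_) (lex w)
lex (𝟎 ∷ 𝟎 ∷ 𝟏 ∷ 𝟏 ∷ w) = Maybe.map (VAR ∷_) (lex w)
lex (𝟎 ∷ 𝟏 ∷ 𝟎 ∷ w)     = Maybe.map (AND ∷_) (lex w)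
lex (𝟎 ∷ 𝟏 ∷ 𝟏 ∷ w)     = Maybe.map (OR ∷_) (lex w)
lex (𝟏 ∷ w)           = lexNum 0 w
lex _                 = nothing

lexNum a (𝟎 ∷ w)     = Maybe.map (NUM a ∷_) (lex w)
lexNum a (𝟏 ∷ b ∷ w) = lexNum ((if b then 1 else 0) + a * 2) w
lexNum a _           = nothing

header : ∀ n → List Token → Maybe (Vec ℕ n × List Token)
header zero    ts           = just ([] , ts)
header (suc n) (NUM m ∷ ts) = Maybe.map (λ (ms , ts′) → m ∷ ms , ts′) (header n ts)
header (suc n) _            = nothing

fin? : ∀ n → ℕ → Maybe (Fin n)
fin? zero    _       = nothing
fin? (suc n) zero    = just zero
fin? (suc n) (suc i) = Maybe.map suc (fin? n i)

var? : ∀ {n} (ms : Vec ℕ n) → ℕ → ℕ → Maybe (Formula ms)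
var? ms i j = do
  i′ ← fin? _ i
  j′ ← fin? _ j
  just (var i′ j′)

-- The second argument is the stack of the formulas read so far.
parse : ∀ {n} {ms : Vec ℕ n} → List Token → List (Formula ms) → Maybe (Formula ms)
parse []                         (φ ∷ [])    = just φ
parse (CONST b ∷ ts)             φs          = parse ts (const b ∷ φs)
parse (VAR ∷ NUM i ∷ NUM j ∷ ts) φs          = var? _ i j >>= λ v → parse ts (v ∷ φs)
parse (NEG ∷ ts)                 (φ ∷ φs)    = parse ts (neg φ ∷ φs)
parse (AND ∷ ts)                 (ψ ∷ φ ∷ φs) = parse ts (conj φ ψ ∷ φs)
parse (OR ∷ ts)                  (ψ ∷ φ ∷ φs) = parse ts (disj φ ψ ∷ φs)
parse _                          _           = nothing

decode : ∀ n → List Bool → Maybe (Instance n)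
decode n w = do
  ts        ← lex w
  (ms , us) ← header n ts
  φ         ← parse us []
  just (ms , φ)

-- A string that does not decode stands for the constant 0, with all
-- dimensions equal to 1.
instanceOf : ∀ n → List⁺ Bool → Instance n
instanceOf n w = fromMaybe (Vec.replicate n 0 , const false) (decode n (List⁺.toList w))

SAT SAT‾ : ℕ → List⁺ Bool → Bool
SAT  n w = let ms , φ = instanceOf n w in sat  ms (eval φ)
SAT‾ n w = let ms , φ = instanceOf n w in sat‾ ms (eval φ)

VAL : ∀ n .{{_ : NonZero n}} → PromiseProblem
VAL (suc n) w = let ms , φ = instanceOf (suc n) w in val ms (eval φ)

------------------------------------------------------------------------
-- Every instance is the decoding of its code

private
  lexNum-code : ∀ ds a w → lexNum a (codeDigits ds ++ w) ≡
    Maybe.map (NUM (foldl (λ x d → Fin.toℕ d + x * 2) a ds) ∷_) (lex w)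
  lexNum-code []              a w = refl
  lexNum-code (zero     ∷ ds) a w = lexNum-code ds _ w
  lexNum-code (suc zero ∷ ds) a w = lexNum-code ds _ w

  fromDigits-foldr : ∀ (ds : List Bit) →
    List.foldr (λ d x → Fin.toℕ d + x * 2) 0 ds ≡ fromDigits ds
  fromDigits-foldr []       = refl
  fromDigits-foldr (d ∷ ds) = cong (λ x → Fin.toℕ d + x * 2) (fromDigits-foldr ds)

  digits-value : ∀ n → foldl (λ x d → Fin.toℕ d + x * 2) 0 (digits n) ≡ n
  digits-value n = let ds , eq = toDigits 2 n in
    trans (reverse-foldl (λ x d → Fin.toℕ d + x * 2) 0 ds) (trans (fromDigits-foldr ds) eq)

  lex-code : ∀ t w → lex (code t ++ w) ≡ Maybe.map (t ∷_) (lex w)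
  lex-code (CONST b) w = refl
  lex-code VAR       w = refl
  lex-code NEG       w = refl
  lex-code AND       w = refl
  lex-code OR        w = refl
  lex-code (NUM n)   w = trans (lexNum-code (digits n) 0 w)
    (cong (λ m → Maybe.map (NUM m ∷_) (lex w)) (digits-value n))

  lex-codes : ∀ ts → lex (concatMap code ts) ≡ just ts
  lex-codes []       = refl
  lex-codes (t ∷ ts) = trans (lex-code t (concatMap code ts))
    (cong (Maybe.map (t ∷_)) (lex-codes ts))

  header-dims : ∀ {n} (ms : Vec ℕ n) us →
    header n (List.map NUM (Vec.toList ms) ++ us) ≡ just (ms , us)
  header-dims []       us = refl
  header-dims (m ∷ ms) us rewrite header-dims ms us = refl

  fin?-toℕ : ∀ {n} (i : Fin n) → fin? n (Fin.toℕ i) ≡ just i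
  fin?-toℕ zero    = refl
  fin?-toℕ (suc i) rewrite fin?-toℕ i = refl

  var?-toℕ : ∀ {n} {ms : Vec ℕ n} i j → var? ms (Fin.toℕ i) (Fin.toℕ j) ≡ just (var i j)
  var?-toℕ i j rewrite fin?-toℕ i | fin?-toℕ j = refl

  parse-rpn : ∀ {n} {ms : Vec ℕ n} (φ : Formula ms) ts φs →
    parse (rpn φ ++ ts) φs ≡ parse ts (φ ∷ φs)
  parse-rpn (const b)  ts φs = refl
  parse-rpn {ms = ms} (var i j) ts φs rewrite var?-toℕ {ms = ms} i j = refl
  parse-rpn (neg φ)    ts φs
    rewrite ++-assoc (rpn φ) (NEG ∷ []) ts = parse-rpn φ (NEG ∷ ts) φs
  parse-rpn (conj φ ψ) ts φs
    rewrite ++-assoc (rpn φ) (rpn ψ ++ AND ∷ []) ts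
          | ++-assoc (rpn ψ) (AND ∷ []) ts
    = trans (parse-rpn φ _ φs) (parse-rpn ψ _ _)
  parse-rpn (disj φ ψ) ts φs
    rewrite ++-assoc (rpn φ) (rpn ψ ++ OR ∷ []) ts
          | ++-assoc (rpn ψ) (OR ∷ []) ts
    = trans (parse-rpn φ _ φs) (parse-rpn ψ _ _)

decode-encode : ∀ {n} (I : Instance n) → decode n (encode I) ≡ just I
decode-encode (ms , φ)
  rewrite lex-codes (List.map NUM (Vec.toList ms) ++ rpn φ)
        | header-dims ms (rpn φ)
        | sym (++-identityʳ (rpn φ))
        | parse-rpn φ [] []
  = refl

{-# OPTIONS --safe #-}
module Submission where

-- VAL reduces to SAT: map f to f ∧ x₁, where x₁ is the first bit of the first
-- block, and to SAT‾: map f to ¬ (f ∧ ¬ x₁).  Both amount to appending a fixed string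
-- to the code of f, and malformed codes need no care since VAL is Σ on them.
--
-- Conversely, if φ(x) contains SAT(f) and SAT‾(g), take a fresh first bit b and let
-- h = (f ∧ b) ∨ (¬ g ∧ ¬ b).  A witness of h starting with 1 shows SAT(f) = 1, one
-- starting with 0 shows SAT‾(g) = 0, and if there is no witness then SAT(f) = 0 and
-- SAT‾(g) = 1; so φ(x) contains VAL(h).  To get the fresh bit, coordinate j becomes
-- 2j + 1 in all blocks, which appends a digit to its code, and all dimensions become
-- 2 ^ L for a sufficiently large L.  Malformed codes stand for the constant 0, so here
-- the reduction has to check its input, including the bounds on the coordinates.
--
-- The machines are obtained from flowcharts over stacks, a stack being the contents of
-- a tape: pushing moves the head left and writes, popping moves it right.

-- The second inclusion shapes the proof. The first bit of a witness must tell which of the two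
-- problems it speaks about, and the first bit of f is not free for that; moreover f and g may have
-- different dimensions, whereas h has a single vector of them. Spreading the coordinates settles
-- both points: bits that no formula reads do not affect the quantified values, and passing from j
-- to 2j + 1 is an edit at the end of its code, whereas j + 1 would need carries. The spread code
-- does not mention the dimensions, so each instance is normalised by itself, and the common
-- exponent L is fixed only when the two codes are merged, as the sum of the two exponents. A
-- malformed string is no licence to answer anything here: it still asserts that the value is 0, so
-- it is replaced by a proper code of the constant 0. On the machine side every reduction is a
-- program run on the outputs of two given machines. One construction, with a quadratic bound on the
-- program, takes the place of closing polynomial time under composition.

open import Defs
open import Data.Bool.Base using (Bool; true; false; T; not; _∧_; _∨_; if_then_else_)
open import Data.Bool.Properties using (_≟_; ∧-identityʳ; ∧-zeroʳ; ∨-identityʳ; not-injective; ¬-not)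
open import Data.Fin.Base using (Fin; zero; suc; toℕ; fromℕ; fromℕ<; inject₁; splitAt; join; _↑ˡ_; _↑ʳ_)
open import Data.Fin.Properties using (toℕ<n; toℕ-fromℕ; toℕ-fromℕ<; toℕ-inject₁; splitAt-join; splitAt-↑ˡ; splitAt-↑ʳ)
  renaming (_≟_ to _≟ᶠ_; suc-injective to Fin-suc-injective)
open import Data.List.Base as List using (List; []; _∷_; _++_; length; _ʳ++_; reverse)
open import Data.List.NonEmpty.Base as List⁺ using (List⁺; _∷_)
open import Data.List.Properties
  using (++-assoc; ++-identityʳ; ++-ʳ++; ʳ++-ʳ++; length-++; length-ʳ++; length-map; length-reverse; reverse-involutive)
open import Data.List.Relation.Unary.All using ([]; _∷_) renaming (All to Allˡ)
open import Data.Maybe.Base as Maybe using (Maybe; just; nothing; _>>=_; maybe′; fromMaybe)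
open import Data.Maybe.Properties using (map-id; map-∘)
open import Data.Nat.Base hiding (compare)
open import Data.Nat.Properties hiding (_≟_)
open import Data.Nat.Tactic.RingSolver using (solve-∀)
open import Data.Product.Base using (Σ; ∃-syntax; _×_; _,_; proj₁; proj₂)
open import Data.Sum.Base as Sum using (_⊎_; inj₁; inj₂; [_,_]′)
open import Data.Unit.Base using (⊤; tt)
open import Data.Vec.Base as Vec using (Vec; []; _∷_; lookup; updateAt; _[_]≔_; tabulate)
open import Data.Vec.Membership.Propositional.Properties using (∈-lookup)
open import Data.Vec.Properties
  using (lookup-map; lookup-zipWith; lookup-replicate; lookup∘tabulate; tabulate∘lookup; tabulate-cong; tabulate-∘;
         lookup∘update; lookup∘update′; lookup∘updateAt; lookup∘updateAt′; map-updateAt; updateAt-updateAt;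
         []≔-idempotent; []≔-lookup)
open import Data.Vec.Relation.Unary.All as All using (All; []; _∷_)
open import Function.Base using (_∘_; id)
open import Relation.Binary.PropositionalEquality hiding ([_])
open import Relation.Nullary using (¬_; Dec; does; yes; no; contradiction; _because_; ofʸ; ofⁿ)
open import Relation.Nullary.Decidable using (dec-true; _×-dec_)
open import Relation.Unary using (_≐_; _∩_)

-- Finite types

-- A retract of `Fin size` rather than a bijection: a machine has to recover a state from its index,
-- and indices outside the image of `index` are merely states that no run enters.
record Finite (A : Set) : Set where
  field
    size    : ℕ
    index   : A → Fin size
    element : Fin size → A
    element-index : ∀ a → element (index a) ≡ a

module _ where

  open Finite

  retract : ∀ {A B : Set} (f : A → B) (g : B → A) → (∀ a → g (f a) ≡ a) → Finite B → Finite A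
  retract f g g∘f B-fin = record
    { size    = size B-fin
    ; index   = index B-fin ∘ f
    ; element = g ∘ element B-fin
    ; element-index = λ a → trans (cong g (element-index B-fin (f a))) (g∘f a)
    }

  Fin-finite : ∀ n → Finite (Fin n)
  Fin-finite n = record { size = n ; index = id ; element = id ; element-index = λ _ → refl }

  ⊤-finite : Finite ⊤
  ⊤-finite = retract (λ _ → zero) (λ _ → tt) (λ _ → refl) (Fin-finite 1)

  ⊎-finite : ∀ {A B : Set} → Finite A → Finite B → Finite (A ⊎ B)
  ⊎-finite A-fin B-fin = record
    { size    = size A-fin + size B-fin
    ; index   = join _ _ ∘ Sum.map (index A-fin) (index B-fin)
    ; element = Sum.map (element A-fin) (element B-fin) ∘ splitAt (size A-fin)
    ; element-index = λ
        { (inj₁ a) →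
            trans (cong (Sum.map _ _) (splitAt-join (size A-fin) (size B-fin) (inj₁ (index A-fin a))))
                           (cong inj₁ (element-index A-fin a))
        ; (inj₂ b) →
            trans (cong (Sum.map _ _) (splitAt-join (size A-fin) (size B-fin) (inj₂ (index B-fin b))))
                           (cong inj₂ (element-index B-fin b)) }
    }

  Bool-finite : Finite Bool
  Bool-finite = retract {B = ⊤ ⊎ ⊤}
    (λ { false → inj₁ tt ; true → inj₂ tt }) (λ { (inj₁ _) → false ; (inj₂ _) → true })
    (λ { false → refl ; true → refl }) (⊎-finite ⊤-finite ⊤-finite)

  Σ-Fin-finite : ∀ n {B : Fin n → Set} → (∀ i → Finite (B i)) → Finite (Σ (Fin n) B)
  Σ-Fin-finite zero    B-fin = retract proj₁ (λ ()) (λ { (() , _) }) (Fin-finite 0)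
  Σ-Fin-finite (suc n) B-fin = retract
    (λ { (zero , b) → inj₁ b ; (suc i , b) → inj₂ (i , b) })
    (λ { (inj₁ b) → zero , b ; (inj₂ (i , b)) → suc i , b })
    (λ { (zero , b) → refl ; (suc i , b) → refl })
    (⊎-finite (B-fin zero) (Σ-Fin-finite n (B-fin ∘ suc)))

  Σ-finite : ∀ {A : Set} {B : A → Set} → Finite A → (∀ a → Finite (B a)) → Finite (Σ A B)
  Σ-finite {A} {B} A-fin B-fin = retract
    (λ (a , b) → index A-fin a , subst B (sym (element-index A-fin a)) b)
    (λ (i , b) → element A-fin i , b)
    (λ (a , b) → transported (element-index A-fin a))
    (Σ-Fin-finite (size A-fin) (B-fin ∘ element A-fin))
    where
    transported : ∀ {a a′} (eq : a′ ≡ a) {b : B a} → (a′ , subst B (sym eq) b) ≡ (a , b)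
    transported refl = refl

-- Programs over stacks

-- The third argument of pop says how to continue after popping a bit, the second
-- one what to do with an empty stack.
data Code (k : ℕ) (L : Set) : Set where
  halt : Code k L
  goto : L → Code k L
  push : Fin k → Bool → Code k L → Code k L
  pop  : Fin k → Code k L → (Bool → Code k L) → Code k L

pushes : ∀ {k L} → Fin k → List Bool → Code k L → Code k L
pushes s []       c = c
pushes s (b ∷ bs) c = push s b (pushes s bs c)

record Flowchart (k : ℕ) : Set₁ where
  field
    Label        : Set
    Label-finite : Finite Label
    block        : Label → Code k Label
    entry        : Label

Stacks : ℕ → Set
Stacks k = Vec (List Bool) k

module Run {k} (F : Flowchart k) where
  open Flowchart F

  Conf : Set
  Conf = Code k Label × Stacks k

  popped : Fin k → Code k Label → (Bool → Code k Label) → Stacks k → List Bool → Conf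
  popped s e f σ []      = e , σ
  popped s e f σ (b ∷ l) = f b , σ [ s ]≔ l

  advance : Conf → Conf
  advance (halt      , σ) = halt , σ
  advance (goto q    , σ) = block q , σ
  advance (push s b c , σ) = c , updateAt σ s (b ∷_)
  advance (pop s e f , σ) = popped s e f σ (lookup σ s)

  advances : ℕ → Conf → Conf
  advances zero    c = c
  advances (suc t) c = advances t (advance c)

  advances-+ : ∀ t {t′} c → advances (t + t′) c ≡ advances t′ (advances t c)
  advances-+ zero    c = refl
  advances-+ (suc t) c = advances-+ t (advance c)

  infix 4 _⇒⟨_⟩_
  _⇒⟨_⟩_ : Conf → ℕ → Conf → Set
  c ⇒⟨ T ⟩ d = ∃[ t ] t ≤ T × advances t c ≡ d

  -- Execution by evaluation: the configuration reached is found by computing `t` steps. The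
  -- numerals in the runs below are therefore instruction counts.
  by : ∀ t {c} → c ⇒⟨ t ⟩ advances t c
  by t = t , ≤-refl , refl

  infixr 5 _▸_
  _▸_ : ∀ {T U c d e} → c ⇒⟨ T ⟩ d → d ⇒⟨ U ⟩ e → c ⇒⟨ T + U ⟩ e
  _▸_ {c = c} (t , t≤T , refl) (u , u≤U , refl) = t + u , +-mono-≤ t≤T u≤U , advances-+ t c

  within : ∀ {T U c d} → T ≤ U → c ⇒⟨ T ⟩ d → c ⇒⟨ U ⟩ d
  within T≤U (t , t≤T , eq) = t , ≤-trans t≤T T≤U , eq

  -- For stacks whose contents are known only through an equation, where `advance` does not compute.
  pop-empty : ∀ s {e f} σ → lookup σ s ≡ [] → (pop s e f , σ) ⇒⟨ 1 ⟩ (e , σ)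
  pop-empty s σ eq = 1 , ≤-refl , cong (popped s _ _ σ) eq

  pop-bit : ∀ s {e f} σ {b l} → lookup σ s ≡ b ∷ l → (pop s e f , σ) ⇒⟨ 1 ⟩ (f b , σ [ s ]≔ l)
  pop-bit s σ eq = 1 , ≤-refl , cong (popped s _ _ σ) eq


-- Stacks are realised on tapes as the bits from the head rightwards.
module TapeRun {k} (F : Flowchart k) (g : ℕ) where
  open Flowchart F
  open Run F

  TapeConf : Set
  TapeConf = Code k Label × Vec (Tape g) k

  poppedᵗ : Fin k → Code k Label → (Bool → Code k Label) → Vec (Tape g) k → Symbol g → TapeConf
  poppedᵗ s e f ts blank    = e , ts
  poppedᵗ s e f ts (mark _) = e , ts
  poppedᵗ s e f ts (bit b)  = f b , updateAt ts s (move right)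

  pushᵗ : Bool → Tape g → Tape g
  pushᵗ b t = write (bit b) (move left t)

  advanceᵗ : TapeConf → TapeConf
  advanceᵗ (halt      , ts) = halt , ts
  advanceᵗ (goto q    , ts) = block q , ts
  advanceᵗ (push s b c , ts) = c , updateAt ts s (pushᵗ b)
  advanceᵗ (pop s e f , ts) = poppedᵗ s e f ts (Tape.scan (lookup ts s))

  advancesᵗ : ℕ → TapeConf → TapeConf
  advancesᵗ zero    c = c
  advancesᵗ (suc t) c = advancesᵗ t (advanceᵗ c)

  advancesᵗ-+ : ∀ t {t′} c → advancesᵗ (t + t′) c ≡ advancesᵗ t′ (advancesᵗ t c)
  advancesᵗ-+ zero    c = refl
  advancesᵗ-+ (suc t) c = advancesᵗ-+ t (advanceᵗ c)

  stacks : TapeConf → Conf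
  stacks (c , ts) = c , Vec.map contents ts

  -- Holds whatever lies to the left of the head. Popping does not erase, so old bits remain there,
  -- and a push overwrites the nearest of them.
  contents-pushᵗ : ∀ b t → contents (pushᵗ b t) ≡ b ∷ contents t
  contents-pushᵗ b (tape []      a rs) = refl
  contents-pushᵗ b (tape (_ ∷ _) a rs) = refl

  contents-right : ∀ (ls : List (Symbol g)) a rs → contents (move right (tape ls a rs)) ≡ leadingBits rs
  contents-right ls a []      = refl
  contents-right ls a (_ ∷ _) = refl

  advance-stacks : ∀ c → advance (stacks c) ≡ stacks (advanceᵗ c)
  advance-stacks (halt , ts) = refl
  advance-stacks (goto q , ts) = refl
  advance-stacks (push s b c , ts) = cong (c ,_)
      (sym (map-updateAt ts s (contents-pushᵗ b (lookup ts s))))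
  advance-stacks (pop s e f , ts)
    with lookup ts s in eq | lookup-map s contents ts
  ... | tape ls blank    rs | top = cong (popped s e f _) top
  ... | tape ls (mark _) rs | top = cong (popped s e f _) top
  ... | tape ls (bit b)  rs | top = trans (cong (popped s e f _) top)
    (cong (f b ,_)
        (sym (map-updateAt ts s (trans (cong (contents ∘ move right) eq) (contents-right ls _ rs)))))

  advances-stacks : ∀ t c → advances t (stacks c) ≡ stacks (advancesᵗ t c)
  advances-stacks zero    c = refl
  advances-stacks (suc t) c = trans (cong (advances t) (advance-stacks c))
      (advances-stacks t (advanceᵗ c))

-- The program points of a code tree, which become machine states. A machine writes before it moves,
-- but a push has to move left before it writes; it takes two steps, and `middle` is the point
-- between them.
data Pos {k L} : Code k L → Set where
  root   : ∀ {c} → Pos c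
  middle : ∀ {s b c} → Pos (push s b c)
  after  : ∀ {s b c} → Pos c → Pos (push s b c)
  empty  : ∀ {s e f} → Pos e → Pos (pop s e f)
  popped : ∀ {s e f} b → Pos (f b) → Pos (pop s e f)

Pos-finite : ∀ {k L} (c : Code k L) → Finite (Pos c)
Pos-finite halt = retract (λ _ → tt) (λ _ → root) (λ { root → refl }) ⊤-finite
Pos-finite (goto q) = retract (λ _ → tt) (λ _ → root) (λ { root → refl }) ⊤-finite
Pos-finite (push s b c) = retract {B = (⊤ ⊎ ⊤) ⊎ Pos c}
  (λ { root → inj₁ (inj₁ tt) ; middle → inj₁ (inj₂ tt) ; (after p) → inj₂ p })
  (λ { (inj₁ (inj₁ _)) → root ; (inj₁ (inj₂ _)) → middle ; (inj₂ p) → after p })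
  (λ { root → refl ; middle → refl ; (after p) → refl })
  (⊎-finite (⊎-finite ⊤-finite ⊤-finite) (Pos-finite c))
Pos-finite (pop s e f) = retract {B = (⊤ ⊎ Pos e) ⊎ Σ Bool (Pos ∘ f)}
  (λ { root → inj₁ (inj₁ tt) ; (empty p) → inj₁ (inj₂ p) ; (popped b p) → inj₂ (b , p) })
  (λ { (inj₁ (inj₁ _)) → root ; (inj₁ (inj₂ p)) → empty p ; (inj₂ (b , p)) → popped b p })
  (λ { root → refl ; (empty p) → refl ; (popped b p) → refl })
  (⊎-finite (⊎-finite ⊤-finite (Pos-finite e)) (Σ-finite Bool-finite (Pos-finite ∘ f)))

-- Turing machines with states and tapes indexed by finite types

Action : ℕ → Set
Action g = Maybe (Symbol g) × Move

idle : ∀ {g} → Action g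
idle = nothing , stay

idles : ∀ {g} {Addr : Set} → Addr → Action g
idles _ = idle

perform : ∀ {g} → Action g → Symbol g → Symbol g × Move
perform (w , d) a = Maybe.fromMaybe a w , d

act : ∀ {g} → Action g → Tape g → Tape g
act α t = let a , d = perform α (Tape.scan t) in move d (write a t)

halts-mono : ∀ {M t u c d} → t ≤ u → HaltsWithin M t c d → HaltsWithin M u c d
halts-mono _         (halt eq)   = halt eq
halts-mono (s≤s t≤u) (next eq h) = next eq (halts-mono t≤u h)

record Device (g : ℕ) : Set₁ where
  field
    State Addr   : Set
    State-finite : Finite State
    extra        : ℕ
    Addr-index   : Addr → Fin (suc extra)
    Addr-element : Fin (suc extra) → Addr
    Addr-element-index : ∀ a → Addr-element (Addr-index a) ≡ a
    first        : State
    transition   : State → (Addr → Symbol g) → Maybe (State × (Addr → Action g))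

module Realise {g} (D : Device g) where
  open Device D
  open Finite State-finite

  performAll : Vec (Symbol g) (suc extra) → (Addr → Action g) → Vec (Symbol g × Move) (suc extra)
  performAll as α = tabulate λ i → perform (α (Addr-element i)) (lookup as i)

  machine : Machine
  machine = record
    { states = size
    ; marks  = g
    ; extraTapes = extra
    ; start  = index first
    ; δ      = λ q as → Maybe.map (λ (q′ , α) → index q′ , performAll as α)
                 (transition (element q) (lookup as ∘ Addr-index))
    }

  Tapes : Set
  Tapes = Vec (Tape g) (suc extra)

  infixl 9 _‼_
  _‼_ : Tapes → Addr → Tape g
  ts ‼ a = lookup ts (Addr-index a)

  scans : Tapes → Addr → Symbol g
  scans ts = lookup (Vec.map Tape.scan ts) ∘ Addr-index

  scans-‼ : ∀ ts a → scans ts a ≡ Tape.scan (ts ‼ a)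
  scans-‼ ts a = lookup-map (Addr-index a) Tape.scan ts

  acted : Tapes → (Addr → Action g) → Tapes
  acted ts α = Vec.zipWith (λ (a , d) t → move d (write a t)) (performAll (Vec.map Tape.scan ts) α) ts

  acted-‼ : ∀ ts α a → acted ts α ‼ a ≡ act (α a) (ts ‼ a)
  acted-‼ ts α a
    rewrite lookup-zipWith (λ (a , d) t → move d (write a t)) (Addr-index a)
              (performAll (Vec.map Tape.scan ts) α) ts
          | lookup∘tabulate (λ i → perform (α (Addr-element i)) (lookup (Vec.map Tape.scan ts) i))
              (Addr-index a)
          | Addr-element-index a
          | lookup-map (Addr-index a) Tape.scan ts = refl

  step-just : ∀ q ts {q′ α} → transition q (scans ts) ≡ just (q′ , α) →
              step machine (index q , ts) ≡ just (index q′ , acted ts α)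
  step-just q ts eq rewrite element-index q | eq = refl

  step-nothing : ∀ q ts → transition q (scans ts) ≡ nothing → step machine (index q , ts) ≡ nothing
  step-nothing q ts eq rewrite element-index q | eq = refl

  -- `HaltsWithin` describes complete runs only. An initial segment of a run is therefore
  -- represented by its effect on the halting runs that continue it, and segments compose as
  -- functions.
  record Leads (t : ℕ) (c c′ : State × Tapes) : Set where
    constructor leads
    field
      extend : ∀ {u d} → HaltsWithin machine u (index (proj₁ c′) , proj₂ c′) d →
               HaltsWithin machine (t + u) (index (proj₁ c) , proj₂ c) d

  open Leads public

  leads-refl : ∀ t {c} → Leads t c c
  leads-refl t = leads (halts-mono (m≤n+m _ t))

  leads-step : ∀ q ts {q′ α} → transition q (scans ts) ≡ just (q′ , α) → Leads 1 (q , ts)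
      (q′ , acted ts α)
  leads-step q ts eq = leads (next (step-just q ts eq))

  leads-trans : ∀ {t u c d e} → Leads t c d → Leads u d e → Leads (t + u) c e
  leads-trans {t} {u} {c} l l′ = leads λ {v} {d} h →
    subst (λ m → HaltsWithin machine m (index (proj₁ c) , proj₂ c) d) (sym (+-assoc t u v))
        (extend l (extend l′ h))

  leads-mono : ∀ {t u c d} → t ≤ u → Leads t c d → Leads u c d
  leads-mono t≤u l = leads λ h → halts-mono (+-monoˡ-≤ _ t≤u) (extend l h)

-- The compiler from code to transitions. `owner` names the stack that a tape carries, if any; all
-- other tapes idle. `exit` is the state entered at `halt`, the start of a next phase, or `nothing`
-- if the machine is to stop there.
module Flow {k g : ℕ} {L State Addr : Set} (stack : Fin k → Addr) (owner : Addr → Maybe (Fin k))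
            (target : L → State) (exit : Maybe State) where

  on : Fin k → Action g → Addr → Action g
  on s α a = maybe′ (λ s′ → if does (s′ ≟ᶠ s) then α else idle) idle (owner a)

  flow : (c : Code k L) → (Pos c → State) → Pos c → (Addr → Symbol g) → Maybe (State × (Addr → Action g))
  flow halt         ι root         as = Maybe.map (_, idles) exit
  flow (goto q)     ι root         as = just (target q , idles)
  flow (push s b c) ι root         as = just (ι middle , on s (nothing , left))
  flow (push s b c) ι middle       as = just (ι (after root) , on s (just (bit b) , stay))
  flow (push s b c) ι (after p)    as = flow c (ι ∘ after) p as
  flow (pop s e f)  ι (empty p)    as = flow e (ι ∘ empty) p as
  flow (pop s e f)  ι (popped b p) as = flow (f b) (ι ∘ popped b) p as
  flow (pop s e f)  ι root         as = just (branch (as (stack s)))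
    where
    branch : Symbol g → State × (Addr → Action g)
    branch (bit b) = ι (popped b root) , on s (nothing , right)
    branch _       = ι (empty root) , idles

module Simulation {k g} (F : Flowchart k) (D : Device g)
  (stack : Fin k → Device.Addr D) (owner : Device.Addr D → Maybe (Fin k))
  (owner-stack : ∀ s → owner (stack s) ≡ just s)
  (target : Flowchart.Label F → Device.State D) (exit : Maybe (Device.State D))
  where

  open Flowchart F
  open TapeRun F g
  open Device D
  open Realise D
  open Flow {g = g} stack owner target exit

  -- A subtree of a block sits in the device through an embedding `ι` of its program points.
  -- Descending into the code composes `ι` with a constructor of `Pos`, so the property persists
  -- from one instruction to the next.
  Located : Code k Label → State → Set
  Located c q = ∃[ ι ] q ≡ ι root × (∀ p as → transition (ι p) as ≡ flow c ι p as)

  Holds : Tapes → Vec (Tape g) k → Set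
  Holds ts ps = ∀ s → ts ‼ stack s ≡ lookup ps s

  Untouched : Tapes → Tapes → Set
  Untouched ts ts′ = ∀ a → owner a ≡ nothing → ts′ ‼ a ≡ ts ‼ a

  acted-idle : ∀ ts a → acted ts idles ‼ a ≡ ts ‼ a
  acted-idle ts a = acted-‼ ts idles a

  on-untouched : ∀ s α ts → Untouched ts (acted ts (on s α))
  on-untouched s α ts a none = trans (acted-‼ ts (on s α) a)
      (cong (λ β → act β (ts ‼ a)) {y = idle} (on-idle none))
    where
    on-idle : owner a ≡ nothing → on s α a ≡ idle
    on-idle none rewrite none = refl

  on-holds : ∀ s α {f} ts ps → (∀ t → act α t ≡ f t) → Holds ts ps →
             Holds (acted ts (on s α)) (updateAt ps s f)
  on-holds s α {f} ts ps α≗f h s′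
    rewrite acted-‼ ts (on s α) (stack s′) | owner-stack s′ | h s′ with s′ ≟ᶠ s
  ... | yes refl = trans (α≗f _) (sym (lookup∘updateAt s ps))
  ... | no s′≢s  = sym (lookup∘updateAt′ s′ s s′≢s ps)

  Reaches : ℕ → State × Tapes → TapeConf → Set
  Reaches t (q , ts) (c , ps) = ∃[ q′ ] ∃[ ts′ ]
    Located c q′ × Holds ts′ ps × Untouched ts ts′ × Leads t (q , ts) (q′ , ts′)

  module _ (located-target : ∀ q → Located (block q) (target q)) where

    simulate-step : ∀ c ps q ts → Located c q → Holds ts ps → Reaches 2 (q , ts) (advanceᵗ (c , ps))
    simulate-step halt ps q ts l h =
      q , ts , l , h , (λ _ _ → refl) , leads-refl 2
    simulate-step (goto q′) ps q ts (ι , refl , l) h =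
      target q′ , _ , located-target q′ , (λ s → trans (acted-idle ts (stack s)) (h s)) ,
          (λ a _ → acted-idle ts a) ,
      leads-mono (s≤s z≤n) (leads-step q ts (l root (scans ts)))
    simulate-step (push s b c) ps q ts (ι , refl , l) h =
      let ts₁ = acted ts (on s (nothing , left))
          ts₂ = acted ts₁ (on s (just (bit b) , stay))
      in ι (after root) , ts₂ , (ι ∘ after , refl , λ p → l (after p)) ,
         subst (Holds ts₂) (updateAt-updateAt s {write (bit b)} {move left} ps)
           (on-holds s _ {write (bit b)} ts₁ (updateAt ps s (move left)) (λ _ → refl)
             (on-holds s _ {move left} ts ps (λ _ → refl) h)) ,
         (λ a none → trans (on-untouched s _ ts₁ a none) (on-untouched s _ ts a none)) ,
         leads-trans
           (leads-step (ι root) ts (l root (scans ts)))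
               (leads-step (ι middle) ts₁ (l middle (scans ts₁)))
    simulate-step (pop s e f) ps q ts (ι , refl , l) h
      with Tape.scan (lookup ps s) | trans (scans-‼ ts (stack s)) (cong Tape.scan (h s)) | l root
          (scans ts)
    ... | bit b | eq | l′ rewrite eq =
      ι (popped b root) , _ , (ι ∘ popped b , refl , λ p → l (popped b p)) ,
      on-holds s _ ts ps (λ _ → refl) h , on-untouched s _ ts ,
      leads-mono (s≤s z≤n) (leads-step q ts l′)
    ... | blank | eq | l′ rewrite eq =
      ι (empty root) , _ , (ι ∘ empty , refl , λ p → l (empty p)) ,
      (λ s → trans (acted-idle ts (stack s)) (h s)) , (λ a _ → acted-idle ts a) ,
      leads-mono (s≤s z≤n) (leads-step q ts l′)
    ... | mark _ | eq | l′ rewrite eq =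
      ι (empty root) , _ , (ι ∘ empty , refl , λ p → l (empty p)) ,
      (λ s → trans (acted-idle ts (stack s)) (h s)) , (λ a _ → acted-idle ts a) ,
      leads-mono (s≤s z≤n) (leads-step q ts l′)

    simulate : ∀ t c ps q ts → Located c q → Holds ts ps → Reaches (t * 2) (q , ts)
        (advancesᵗ t (c , ps))
    simulate zero    c ps q ts l h = q , ts , l , h , (λ _ _ → refl) , leads-refl 0
    simulate (suc t) c ps q ts l h =
      let q₁ , ts₁ , l₁ , h₁ , u₁ , r₁ = simulate-step c ps q ts l h
          q₂ , ts₂ , l₂ , h₂ , u₂ , r₂ = simulate t _ _ q₁ ts₁ l₁ h₁
      in q₂ , ts₂ , l₂ , h₂ , (λ a none → trans (u₂ a none) (u₁ a none)) ,
         leads-trans r₁ r₂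

-- Tapes up to blanks at their ends

rename : ∀ {m g} → (Fin m → Fin g) → Symbol m → Symbol g
rename f blank    = blank
rename f (bit b)  = bit b
rename f (mark i) = mark (f i)

write-move : ∀ {g} → Symbol g × Move → Tape g → Tape g
write-move (a , d) t = move d (write a t)

-- The second tape is the first one with its marks renamed, up to blanks that
-- are listed at the ends.
data PadL {m g} (f : Fin m → Fin g) : List (Symbol m) → List (Symbol g) → Set where
  []  : ∀ {bs} → Allˡ (_≡ blank) bs → PadL f [] bs
  _∷_ : ∀ a {as bs} → PadL f as bs → PadL f (a ∷ as) (rename f a ∷ bs)

data Pad {m g} (f : Fin m → Fin g) : Tape m → Tape g → Set where
  pad : ∀ {ls rs ls′ rs′} a → PadL f ls ls′ → PadL f rs rs′ → Pad f (tape ls a rs)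
      (tape ls′ (rename f a) rs′)

fresh : ∀ {m} → List Bool → Tape m
fresh []       = tape [] blank []
fresh (b ∷ bs) = tape [] (bit b) (List.map bit bs)

module _ {m g} {f : Fin m → Fin g} where

  pad-scan : ∀ {t t′} → Pad f t t′ → Tape.scan t′ ≡ rename f (Tape.scan t)
  pad-scan (pad _ _ _) = refl

  pad-write-move : ∀ a d {t t′} → Pad f t t′ → Pad f (write-move (a , d) t)
      (write-move (rename f a , d) t′)
  pad-write-move a left  (pad _ ([] [])          rs)             = pad blank ([] []) (a ∷ rs)
  pad-write-move a left  (pad _ ([] (refl ∷ bs)) rs)             = pad blank ([] bs) (a ∷ rs)
  pad-write-move a left  (pad _ (l ∷ ls)         rs)             = pad l ls (a ∷ rs)
  pad-write-move a stay  (pad _ ls               rs)             = pad a ls rs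
  pad-write-move a right (pad _ ls               ([] []))        = pad blank (a ∷ ls) ([] [])
  pad-write-move a right (pad _ ls               ([] (refl ∷ bs))) = pad blank (a ∷ ls) ([] bs)
  pad-write-move a right (pad _ ls               (r ∷ rs))       = pad r (a ∷ ls) rs

  leadingBits-pad : ∀ {as bs} → PadL f as bs → leadingBits bs ≡ leadingBits as
  leadingBits-pad ([] [])           = refl
  leadingBits-pad ([] (refl ∷ _))   = refl
  leadingBits-pad (blank ∷ p)       = refl
  leadingBits-pad (bit b ∷ p)       = cong (b ∷_) (leadingBits-pad p)
  leadingBits-pad (mark _ ∷ p)      = refl

  contents-pad : ∀ {t t′} → Pad f t t′ → contents t′ ≡ contents t
  contents-pad (pad a _ rs) = leadingBits-pad (a ∷ rs)

  -- The first push onto an empty tape leaves the blank that was under the head listed to the right.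
  -- A loaded input is thus not literally an initial tape, which is the reason for working up to
  -- padding.
  push-fresh : ∀ b w {t} → Pad f (fresh w) t → Pad f (fresh (b ∷ w)) (write (bit b) (move left t))
  push-fresh b []      (pad _ ([] [])          ([] rs)) = pad (bit b) ([] []) ([] (refl ∷ rs))
  push-fresh b []      (pad _ ([] (refl ∷ bs)) ([] rs)) = pad (bit b) ([] bs) ([] (refl ∷ rs))
  push-fresh b (c ∷ w) (pad _ ([] [])          rs)      = pad (bit b) ([] []) (bit c ∷ rs)
  push-fresh b (c ∷ w) (pad _ ([] (refl ∷ bs)) rs)      = pad (bit b) ([] bs) (bit c ∷ rs)

  pad-blank : Pad f (fresh []) (tape [] blank [])
  pad-blank = pad blank ([] []) ([] [])

room : ∀ {g} → Tape g → ℕ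
room t = suc (length (Tape.after t))

contents≤room : ∀ {g} (t : Tape g) → length (contents t) ≤ room t
contents≤room (tape _ a rs) = go (a ∷ rs)
  where
  go : ∀ as → length (leadingBits as) ≤ length as
  go []            = z≤n
  go (blank ∷ as)  = z≤n
  go (bit b ∷ as)  = s≤s (go as)
  go (mark _ ∷ as) = z≤n

room-write-move : ∀ {g} (α : Symbol g × Move) t → room (write-move α t) ≤ suc (room t)
room-write-move (a , left)  (tape []       _ rs)       = ≤-refl
room-write-move (a , left)  (tape (_ ∷ _)  _ rs)       = ≤-refl
room-write-move (a , stay)  t                          = n≤1+n _
room-write-move (a , right) (tape ls _ [])             = n≤1+n _
room-write-move (a , right) (tape ls _ (_ ∷ _))        = ≤-trans (n≤1+n _) (n≤1+n _)

-- A step lengthens the listed part of the tape from the head rightwards by at most one cell, when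
-- it moves left. Outputs of polynomial-time machines are thus polynomially long, which bounds the
-- input of the program that runs after them.
output-length : ∀ M {t q ts d} → HaltsWithin M t (q , ts) d → length (output M d) ≤ room
    (Vec.head ts) + t
output-length M {t} {ts = t₀ ∷ _} (halt _) = ≤-trans (contents≤room t₀) (m≤m+n _ t)
output-length M {suc t} {q} {t₀ ∷ ts} (next eq h)
  with Machine.δ M q (Tape.scan t₀ ∷ Vec.map Tape.scan ts)
output-length M {suc t} {q} {t₀ ∷ ts} (next refl h) | just (q′ , α ∷ αs) =
  ≤-trans (output-length M h)
    (≤-trans (+-monoˡ-≤ t (room-write-move α t₀)) (≤-reflexive (sym (+-suc (room t₀) t))))

-- A program applied to the outputs of two machines

-- The input is reversed onto stack 3 and popped from there onto stacks 1 and 2, which restores its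
-- order on both. Being pushed, the copies end with the head on their first bit, as an initial
-- configuration requires.
distributor : ∀ k → Flowchart (4 + k)
distributor k = record
  { Label        = Bool
  ; Label-finite = Bool-finite
  ; block        = λ
      { false → pop zero (goto true) λ b → push (suc (suc (suc zero))) b (goto false)
      ; true  → pop (suc (suc (suc zero))) halt λ b → push (suc zero) b
          (push (suc (suc zero)) b (goto true)) }
  ; entry        = false
  }

-- The argument is about tapes and not about stacks: the machines that run next can see a whole
-- tape, also the cells left of the head, of which `contents` says nothing.
module Distributor {k g m₁ m₂} (f₁ : Fin m₁ → Fin g) (f₂ : Fin m₂ → Fin g) (rest : Vec (Tape g) k) where
  open Flowchart (distributor k)
  open TapeRun (distributor k) g

  unload : ∀ w t₀ t₁ t₂ t₃ → contents t₀ ≡ w → ∃[ t₀′ ] ∃[ t₃′ ]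
    contents t₀′ ≡ [] × contents t₃′ ≡ w ʳ++ contents t₃ ×
    advancesᵗ (length w * 3 + 2) (block false , t₀ ∷ t₁ ∷ t₂ ∷ t₃ ∷ rest) ≡
      (block true , t₀′ ∷ t₁ ∷ t₂ ∷ t₃′ ∷ rest)
  unload []      t₀@(tape _ blank    _)  t₁ t₂ t₃ eq = t₀ , t₃ , refl , refl , refl
  unload []      t₀@(tape _ (mark _) _)  t₁ t₂ t₃ eq = t₀ , t₃ , refl , refl , refl
  unload (b ∷ w) (tape ls (bit .b) rs) t₁ t₂ t₃ refl =
    let t₀′ , t₃′ , eq₀ , eq₃ , eq = unload w _ t₁ t₂ (pushᵗ b t₃) (contents-right ls (bit b) rs)
    in t₀′ , t₃′ , eq₀ , trans eq₃ (cong (w ʳ++_) (contents-pushᵗ b t₃)) , eq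

  load : ∀ w v t₀ t₁ t₂ t₃ → contents t₃ ≡ w → Pad f₁ (fresh v) t₁ → Pad f₂ (fresh v) t₂ →
    ∃[ t₁′ ] ∃[ t₂′ ] ∃[ t₃′ ]
    Pad f₁ (fresh (w ʳ++ v)) t₁′ × Pad f₂ (fresh (w ʳ++ v)) t₂′ × contents t₃′ ≡ [] ×
    advancesᵗ (length w * 4 + 1) (block true , t₀ ∷ t₁ ∷ t₂ ∷ t₃ ∷ rest) ≡
      (halt , t₀ ∷ t₁′ ∷ t₂′ ∷ t₃′ ∷ rest)
  load []      v t₀ t₁ t₂ t₃@(tape _ blank    _) eq p₁ p₂ = t₁ , t₂ , t₃ , p₁ , p₂ , refl , refl
  load []      v t₀ t₁ t₂ t₃@(tape _ (mark _) _) eq p₁ p₂ = t₁ , t₂ , t₃ , p₁ , p₂ , refl , refl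
  load (b ∷ w) v t₀ t₁ t₂ (tape ls (bit .b) rs) refl p₁ p₂ =
    load w (b ∷ v) t₀ (pushᵗ b t₁) (pushᵗ b t₂) _ (contents-right ls (bit b) rs)
      (push-fresh b v p₁) (push-fresh b v p₂)

  distributing-time : List Bool → ℕ
  distributing-time x = (length x * 3 + 2) + (length x * 4 + 1)

  distribute : ∀ x → ∃[ t₀ ] ∃[ t₁ ] ∃[ t₂ ] ∃[ t₃ ]
    contents t₀ ≡ [] × Pad f₁ (fresh x) t₁ × Pad f₂ (fresh x) t₂ × contents t₃ ≡ [] ×
    advancesᵗ (distributing-time x)
      (block false , fresh x ∷ tape [] blank [] ∷ tape [] blank [] ∷ tape [] blank [] ∷ rest) ≡
    (halt , t₀ ∷ t₁ ∷ t₂ ∷ t₃ ∷ rest)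
  distribute x =
    let t₀ , t₃ , c₀ , c₃ , eq = unload x (fresh x) (tape [] blank []) (tape [] blank [])
            (tape [] blank []) (contents-fresh x)
        t₁ , t₂ , t₃′ , p₁ , p₂ , c₃′ , eq′ = load (x ʳ++ []) [] t₀ (tape [] blank []) (tape [] blank [])
            t₃ c₃ pad-blank pad-blank
    in t₀ , t₁ , t₂ , t₃′ , c₀ , subst (λ v → Pad f₁ (fresh v) t₁) restored p₁ ,
       subst (λ v → Pad f₂ (fresh v) t₂) restored p₂ , c₃′ ,
       trans (advancesᵗ-+ (length x * 3 + 2) _)
         (trans (cong₂ (λ m c → advancesᵗ (m * 4 + 1) c) (sym (trans (length-ʳ++ x) (+-identityʳ _))) eq)
             eq′)
    where
    restored : (x ʳ++ []) ʳ++ [] ≡ x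
    restored = trans (ʳ++-ʳ++ x) (++-identityʳ x)

    leadingBits-map : ∀ w → leadingBits (List.map (bit {g}) w) ≡ w
    leadingBits-map []      = refl
    leadingBits-map (c ∷ w) = cong (c ∷_) (leadingBits-map w)

    contents-fresh : ∀ x → contents (fresh {g} x) ≡ x
    contents-fresh []       = refl
    contents-fresh (b ∷ bs) = cong (b ∷_) (leadingBits-map bs)

module Combination (M : Bool → Machine) {k} (F : Flowchart (4 + k)) where

  module D where
    open Flowchart (distributor k) public
    open TapeRun (distributor k) (Machine.marks (M false) + Machine.marks (M true)) public

  module F where
    open Flowchart F public
    open Run F public
    open TapeRun F (Machine.marks (M false) + Machine.marks (M true)) public

  module M j = Machine (M j)

  g : ℕ
  g = M.marks false + M.marks true

  raise : ∀ j → Fin (M.marks j) → Fin g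
  raise false i = i ↑ˡ _
  raise true  i = _ ↑ʳ i

  -- The marks of the two machines form a disjoint union. By `Padded`, a tape on which machine `j`
  -- runs carries only marks of `j`, so `blank` is an arbitrary default.
  lower : ∀ j → Fin g → Symbol (M.marks j)
  lower false i = [ mark , (λ _ → blank) ]′ (splitAt _ i)
  lower true  i = [ (λ _ → blank) , mark ]′ (splitAt (M.marks false) i)

  lower-raise : ∀ j i → lower j (raise j i) ≡ mark i
  lower-raise false i = cong [ mark , _ ]′ (splitAt-↑ˡ _ i _)
  lower-raise true  i = cong [ (λ _ → blank) , mark ]′ (splitAt-↑ʳ (M.marks false) _ i)

  restrict : ∀ j → Symbol g → Symbol (M.marks j)
  restrict j blank    = blank
  restrict j (bit b)  = bit b
  restrict j (mark i) = lower j i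

  restrict-rename : ∀ j a → restrict j (rename (raise j) a) ≡ a
  restrict-rename j blank    = refl
  restrict-rename j (bit b)  = refl
  restrict-rename j (mark i) = lower-raise j i

  Addr : Set
  Addr = Fin (4 + k) ⊎ Σ Bool (Fin ∘ M.extraTapes)

  abstract
    Extra-finite : Finite (Σ Bool (Fin ∘ M.extraTapes))
    Extra-finite = Σ-finite Bool-finite (Fin-finite ∘ M.extraTapes)

  Addr-finite : Finite Addr
  Addr-finite = ⊎-finite (Fin-finite (4 + k)) Extra-finite

  owner : Addr → Maybe (Fin (4 + k))
  owner (inj₁ s) = just s
  owner (inj₂ _) = nothing

  -- The input and output of M false is stack 1, that of M true is stack 2.
  port : Bool → Fin (4 + k)
  port false = suc zero
  port true  = suc (suc zero)

  tapeOf : ∀ j → Fin (M.tapes j) → Addr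
  tapeOf j zero    = inj₁ (port j)
  tapeOf j (suc i) = inj₂ (j , i)

  ownTape : ∀ j → Addr → Maybe (Fin (M.tapes j))
  ownTape j     (inj₁ s)           = if does (port j ≟ᶠ s) then just zero else nothing
  ownTape false (inj₂ (false , i)) = just (suc i)
  ownTape true  (inj₂ (true , i))  = just (suc i)
  ownTape false (inj₂ (true , i))  = nothing
  ownTape true  (inj₂ (false , i)) = nothing

  ownTape-tapeOf : ∀ j i → ownTape j (tapeOf j i) ≡ just i
  ownTape-tapeOf false zero    = refl
  ownTape-tapeOf true  zero    = refl
  ownTape-tapeOf false (suc i) = refl
  ownTape-tapeOf true  (suc i) = refl

  State : Set
  State = Σ D.Label (Pos ∘ D.block) ⊎ Σ Bool (Fin ∘ M.states) ⊎ Σ F.Label (Pos ∘ F.block)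

  pattern distributing q = inj₁ q
  pattern running j q    = inj₂ (inj₁ (j , q))
  pattern combining q    = inj₂ (inj₂ q)

  finished : Bool → State
  finished false = running true (M.start true)
  finished true  = combining (F.entry , root)

  respond : ∀ j → Maybe (Fin (M.states j) × Vec (Symbol (M.marks j) × Move) (M.tapes j)) →
            State × (Addr → Action g)
  respond j nothing         = finished j , idles
  respond j (just (q , αs)) = running j q , λ a →
    maybe′ (λ i → let b , d = lookup αs i in just (rename (raise j) b) , d) idle (ownTape j a)

  stack : Fin (4 + k) → Addr
  stack = inj₁

  module D-Flow = Flow {g = g} {L = D.Label} {State = State} stack owner (λ q → distributing (q , root))
      (just (running false (M.start false)))
  module F-Flow = Flow {g = g} {L = F.Label} {State = State} stack owner (λ q → combining (q , root))
      nothing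

  transition : State → (Addr → Symbol g) → Maybe (State × (Addr → Action g))
  transition (distributing (q , p)) as =
    D-Flow.flow (D.block q) (λ p → distributing (q , p)) p as
  transition (running j q)          as =
    just (respond j (M.δ j q (tabulate λ i → restrict j (as (tapeOf j i)))))
  transition (combining (q , p))    as =
    F-Flow.flow (F.block q) (λ p → combining (q , p)) p as

  abstract
    State-finite : Finite State
    State-finite = ⊎-finite (Σ-finite D.Label-finite (Pos-finite ∘ D.block))
      (⊎-finite (Σ-finite Bool-finite (Fin-finite ∘ M.states))
          (Σ-finite F.Label-finite (Pos-finite ∘ F.block)))

  device : Device g
  device = record
    { State = State
    ; Addr  = Addr
    ; State-finite = State-finite
    ; Addr-index   = Finite.index Addr-finite
    ; Addr-element = Finite.element Addr-finite
    ; Addr-element-index = Finite.element-index Addr-finite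
    ; first        = distributing (D.entry , root)
    ; transition   = transition
    }

  open Realise device

  Padded : ∀ j → Vec (Tape (M.marks j)) (M.tapes j) → Tapes → Set
  Padded j us ts = ∀ i → Pad (raise j) (lookup us i) (ts ‼ tapeOf j i)

  Foreign : Bool → Tapes → Tapes → Set
  Foreign j ts ts′ = ∀ a → ownTape j a ≡ nothing → ts′ ‼ a ≡ ts ‼ a

  restricted-scans : ∀ j us ts → Padded j us ts →
    (tabulate λ i → restrict j (scans ts (tapeOf j i))) ≡ Vec.map Tape.scan us
  restricted-scans j us ts p = trans (tabulate-cong eq) (tabulate∘lookup _)
    where
    eq : ∀ i → restrict j (scans ts (tapeOf j i)) ≡ lookup (Vec.map Tape.scan us) i
    eq i = trans (cong (restrict j) (trans (scans-‼ ts (tapeOf j i)) (pad-scan (p i))))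
             (trans (restrict-rename j _) (sym (lookup-map i Tape.scan us)))

  padded-step : ∀ j αs us ts {q} → Padded j us ts →
    Padded j (Vec.zipWith (λ (a , d) t → move d (write a t)) αs us)
             (acted ts (proj₂ (respond j (just (q , αs)))))
  padded-step j αs us ts {q} p i
    rewrite acted-‼ ts (proj₂ (respond j (just (q , αs)))) (tapeOf j i) | ownTape-tapeOf j i
          | lookup-zipWith (λ (a , d) t → move d (write a t)) i αs us
    = pad-write-move _ _ (p i)

  foreign-step : ∀ j αs ts {q} → Foreign j ts (acted ts (proj₂ (respond j (just (q , αs)))))
  foreign-step j αs ts {q} a none
    rewrite acted-‼ ts (proj₂ (respond j (just (q , αs)))) a | none = refl

  -- The additional step replaces the halting of machine `j`: where `δ` returns `nothing`, the
  -- combined machine passes to the next phase.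
  run : ∀ j {t q us q′ us′} ts → HaltsWithin (M j) t (q , us) (q′ , us′) → Padded j us ts →
    ∃[ ts′ ] Padded j us′ ts′ × Foreign j ts ts′ × Leads (suc t) (running j q , ts) (finished j , ts′)
  run j {t} {q} {us} ts (halt eq) p
    with M.δ j q (Vec.map Tape.scan us) in eqδ
  run j {t} {q} {us} ts (halt eq) p | nothing =
    acted ts idles , (λ i → subst (Pad _ _) (sym (acted-‼ ts idles (tapeOf j i))) (p i)) ,
    (λ a _ → acted-‼ ts idles a) ,
    leads-mono (s≤s z≤n) (leads-step (running j q) ts
      (cong (just ∘ respond j) (trans (cong (M.δ j q) (restricted-scans j us ts p)) eqδ)))
  run j {suc t} {q} {us} ts (next eq h) p
    with M.δ j q (Vec.map Tape.scan us) in eqδ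
  run j {suc t} {q} {us} ts (next refl h) p | just (q₁ , αs) =
    let ts₁ = acted ts (proj₂ (respond j (just (q₁ , αs))))
        ts₂ , p₂ , f₂ , l₂ = run j ts₁ h (padded-step j αs us ts {q₁} p)
    in ts₂ , p₂ , (λ a none → trans (f₂ a none) (foreign-step j αs ts {q₁} a none)) ,
       leads-trans
         (leads-step (running j q) ts
           (cong (just ∘ respond j) (trans (cong (M.δ j q) (restricted-scans j us ts p)) eqδ))) l₂

  module D-Sim = Simulation (distributor k) device stack owner (λ _ → refl)
    (λ q → distributing (q , root)) (just (running false (M.start false)))
  module F-Sim = Simulation F device stack owner (λ _ → refl) (λ q → combining (q , root)) nothing

  distributed-halt : ∀ {q} ts → D-Sim.Located halt q →
    Leads 1 (q , ts) (running false (M.start false) , acted ts idles)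
  distributed-halt ts (ι , refl , located) = leads-step (ι root) ts (located root (scans ts))

  combined-halt : ∀ {q} ts → F-Sim.Located halt q →
    step machine (Finite.index State-finite q , ts) ≡ nothing
  combined-halt ts (ι , refl , located) = step-nothing (ι root) ts (located root (scans ts))

  module Combined (b : Bool) (bs : List Bool) (times : Bool → ℕ) (d : ∀ j → Config (M j))
    (halts : ∀ j → HaltsWithin (M j) (times j) (initial (M j) (b ∷ bs)) (d j)) where

    x : List Bool
    x = b ∷ bs

    blankTape : ∀ {m} → Tape m
    blankTape = tape [] blank []

    ts₀ : Tapes
    ts₀ = fresh x ∷ Vec.replicate _ blankTape

    ts₀-blank : ∀ a → a ≢ inj₁ zero → ts₀ ‼ a ≡ blankTape
    ts₀-blank (inj₁ zero)    ≢zero = contradiction refl ≢zero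
    ts₀-blank (inj₁ (suc s)) _     = lookup-replicate (s ↑ˡ Finite.size Extra-finite) blankTape
    ts₀-blank (inj₂ e)       _     = lookup-replicate ((3 + k) ↑ʳ Finite.index Extra-finite e) blankTape

    ps₀ : Vec (Tape g) (4 + k)
    ps₀ = fresh x ∷ Vec.replicate _ blankTape

    holds₀ : D-Sim.Holds ts₀ ps₀
    holds₀ zero    = refl
    holds₀ (suc s) = trans (ts₀-blank (inj₁ (suc s)) λ ()) (sym (lookup-replicate s blankTape))

    open Distributor (raise false) (raise true) (Vec.replicate k blankTape)

    tD : ℕ
    tD = distributing-time x

    abstract
      distributed : ∃[ t₀ ] ∃[ t₁ ] ∃[ t₂ ] ∃[ t₃ ]
        contents t₀ ≡ [] × Pad (raise false) (fresh x) t₁ × Pad (raise true) (fresh x) t₂ × contents t₃ ≡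
            [] ×
        D.advancesᵗ tD (D.block false , ps₀) ≡ (halt , t₀ ∷ t₁ ∷ t₂ ∷ t₃ ∷ Vec.replicate k blankTape)
      distributed = distribute x

    ps₁ : Vec (Tape g) (4 + k)
    ps₁ = let t₀ , t₁ , t₂ , t₃ , _ = distributed in t₀ ∷ t₁ ∷ t₂ ∷ t₃ ∷ Vec.replicate k blankTape

    reach₁ : D-Sim.Reaches (tD * 2) (distributing (false , root) , ts₀) (halt , ps₁)
    reach₁ = subst (D-Sim.Reaches _ _) (let _ , _ , _ , _ , _ , _ , _ , _ , eq = distributed in eq)
      (D-Sim.simulate (λ q → (λ p → distributing (q , p)) , refl , λ _ _ → refl) tD _ ps₀ _ ts₀
        ((λ p → distributing (false , p)) , refl , λ _ _ → refl) holds₀)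

    ts₁ : Tapes
    ts₁ = proj₁ (proj₂ reach₁)

    holds₁ : D-Sim.Holds ts₁ ps₁
    holds₁ = proj₁ (proj₂ (proj₂ (proj₂ reach₁)))

    l₁ : Leads (tD * 2) (distributing (false , root) , ts₀) (proj₁ reach₁ , ts₁)
    l₁ = proj₂ (proj₂ (proj₂ (proj₂ (proj₂ reach₁))))

    ts₂ : Tapes
    ts₂ = acted ts₁ idles

    l₂ : Leads 1 (proj₁ reach₁ , ts₁) (running false (M.start false) , ts₂)
    l₂ = distributed-halt ts₁ (proj₁ (proj₂ (proj₂ reach₁)))

    stack₂ : ∀ s → ts₂ ‼ stack s ≡ lookup ps₁ s
    stack₂ s = trans (acted-‼ ts₁ idles (stack s)) (holds₁ s)

    extra₂ : ∀ e → ts₂ ‼ inj₂ e ≡ blankTape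
    extra₂ e = trans (acted-‼ ts₁ idles (inj₂ e))
      (trans (proj₁ (proj₂ (proj₂ (proj₂ (proj₂ reach₁)))) (inj₂ e) refl) (ts₀-blank (inj₂ e) λ ()))

    padded₀ : ∀ j ts → Pad (raise j) (fresh x) (ts ‼ stack (port j)) →
        (∀ i → ts ‼ inj₂ (j , i) ≡ blankTape) →
      Padded j (proj₂ (initial (M j) (b ∷ bs))) ts
    padded₀ j ts p e zero    = p
    padded₀ j ts p e (suc i) = subst₂ (Pad (raise j)) (sym (lookup-replicate i blankTape))
        (sym (e i)) pad-blank

    run₁ : ∃[ ts ] Padded false (proj₂ (d false)) ts × Foreign false ts₂ ts ×
      Leads (suc (times false)) (running false (M.start false) , ts₂) (finished false , ts)
    run₁ = run false ts₂ (halts false)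
        (padded₀ false ts₂
        (subst (Pad _ _) (sym (stack₂ (port false))) (let _ , _ , _ , _ , _ , p , _ = distributed in p))
        (λ i → extra₂ (false , i)))

    ts₃ : Tapes
    ts₃ = proj₁ run₁

    foreign₃ : Foreign false ts₂ ts₃
    foreign₃ = proj₁ (proj₂ (proj₂ run₁))

    l₃ : Leads (suc (times false)) (running false (M.start false) , ts₂) (finished false , ts₃)
    l₃ = proj₂ (proj₂ (proj₂ run₁))

    run₂ : ∃[ ts ] Padded true (proj₂ (d true)) ts × Foreign true ts₃ ts ×
      Leads (suc (times true)) (running true (M.start true) , ts₃) (finished true , ts)
    run₂ = run true ts₃ (halts true)
      (padded₀ true ts₃
          (subst (Pad _ _) (sym (trans (foreign₃ (stack (port true)) refl) (stack₂ (port true))))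
          (let _ , _ , _ , _ , _ , _ , p , _ = distributed in p))
        (λ i → trans (foreign₃ (inj₂ (true , i)) refl) (extra₂ (true , i))))

    ts₄ : Tapes
    ts₄ = proj₁ run₂

    foreign₄ : Foreign true ts₃ ts₄
    foreign₄ = proj₁ (proj₂ (proj₂ run₂))

    l₄ : Leads (suc (times true)) (finished false , ts₃) (finished true , ts₄)
    l₄ = proj₂ (proj₂ (proj₂ run₂))

    ps₄ : Vec (Tape g) (4 + k)
    ps₄ = tabulate (λ s → ts₄ ‼ stack s)

    output-contents : ∀ j (d : Config (M j)) ts → Padded j (proj₂ d) ts →
      contents (ts ‼ stack (port j)) ≡ output (M j) d
    output-contents j (_ , _ ∷ _) ts p = contents-pad (p zero)

    through : ∀ a → ownTape true a ≡ nothing → ownTape false a ≡ nothing → ts₄ ‼ a ≡ ts₂ ‼ a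
    through a f₄ f₃ = trans (foreign₄ a f₄) (foreign₃ a f₃)

    contents₄ : ∀ s → contents (ts₄ ‼ stack s) ≡
      lookup ([] ∷ output (M false) (d false) ∷ output (M true) (d true) ∷ Vec.replicate _ []) s
    contents₄ zero = trans (cong contents (trans (through (stack zero) refl refl) (stack₂ zero)))
        (let _ , _ , _ , _ , c , _ = distributed in c)
    contents₄ (suc zero) = trans (cong contents (foreign₄ (stack (port false)) refl))
      (output-contents false (d false) ts₃ (proj₁ (proj₂ run₁)))
    contents₄ (suc (suc zero)) = output-contents true (d true) ts₄ (proj₁ (proj₂ run₂))
    contents₄ (suc (suc (suc s))) =
      trans (cong contents
          (trans (through (stack (suc (suc (suc s)))) refl refl) (stack₂ (suc (suc (suc s))))))
        (trans (clean s) (sym (lookup-replicate s [])))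
      where
      clean : ∀ s → contents (lookup ps₁ (suc (suc (suc s)))) ≡ []
      clean zero    = let _ , _ , _ , _ , _ , _ , _ , c , _ = distributed in c
      clean (suc s) = cong contents (lookup-replicate s blankTape)

    stacks₄ : Vec.map contents ps₄ ≡ [] ∷ output (M false) (d false) ∷ output (M true)
        (d true) ∷ Vec.replicate _ []
    stacks₄ = trans (sym (tabulate-∘ contents (λ s → ts₄ ‼ stack s)))
        (trans (tabulate-cong contents₄) (tabulate∘lookup _))

    module _ (t : ℕ) {σ : Stacks (4 + k)}
      (eq : F.advances t (F.block F.entry , [] ∷ output (M false) (d false) ∷ output (M true) (d true) ∷
                             Vec.replicate _ []) ≡ (halt , σ)) where

      end : F.TapeConf
      end = F.advancesᵗ t (F.block F.entry , ps₄)

      stacks-end : F.stacks end ≡ (halt , σ)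
      stacks-end = trans (sym (F.advances-stacks t _))
        (trans (cong (λ v → F.advances t (F.block F.entry , v)) stacks₄) eq)

      reach₅ : F-Sim.Reaches (t * 2) (finished true , ts₄) end
      reach₅ = F-Sim.simulate (λ q → (λ p → combining (q , p)) , refl , λ _ _ → refl) t _ ps₄ _ ts₄
        ((λ p → combining (F.entry , p)) , refl , λ _ _ → refl)
            (λ s → sym (lookup∘tabulate (λ s → ts₄ ‼ stack s) s))

      ts₅ : Tapes
      ts₅ = proj₁ (proj₂ reach₅)

      l₅ : Leads (t * 2) (finished true , ts₄) (proj₁ reach₅ , ts₅)
      l₅ = proj₂ (proj₂ (proj₂ (proj₂ (proj₂ reach₅))))

      halted : step machine (Finite.index State-finite (proj₁ reach₅) , ts₅) ≡ nothing
      halted = combined-halt ts₅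
        (subst (λ c → F-Sim.Located c (proj₁ reach₅)) (cong proj₁ stacks-end)
            (proj₁ (proj₂ (proj₂ reach₅))))

      final-output : ∀ ts → ts ≡ ts₅ → output machine (Finite.index State-finite (proj₁ reach₅) , ts) ≡
          Vec.head σ
      final-output (t′ ∷ _) eq′ = trans
          (cong contents (trans (cong Vec.head eq′) (head₅ ts₅ {proj₂ end} (holds₅ zero))))
        (trans (sym (head-map (proj₂ end))) (cong (Vec.head ∘ proj₂) stacks-end))
        where
        holds₅ : F-Sim.Holds ts₅ (proj₂ end)
        holds₅ = proj₁ (proj₂ (proj₂ (proj₂ reach₅)))
        head₅ : ∀ (ts : Tapes) {ps : Vec (Tape g) (4 + k)} → lookup ts zero ≡ lookup ps zero →
            Vec.head ts ≡ Vec.head ps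
        head₅ (_ ∷ _) {_ ∷ _} h = h
        head-map : ∀ {n} (ps : Vec (Tape g) (suc n)) → Vec.head (Vec.map contents ps) ≡
            contents (Vec.head ps)
        head-map (_ ∷ _) = refl

      time : ℕ
      -- Distribution at two machine steps per instruction, its exit, the two machines with their
      -- exits, the final program at two steps per instruction, and 0 for the halted configuration.
      time = tD * 2 + (1 + (suc (times false) + (suc (times true) + t * 2))) + 0

      conclusion : ∃[ d′ ] HaltsWithin machine time (initial machine (b ∷ bs)) d′ × output machine d′ ≡
          Vec.head σ
      conclusion = (_ , ts₅) ,
        extend (leads-trans l₁ (leads-trans l₂ (leads-trans l₃ (leads-trans l₄ l₅)))) (halt halted) ,
        final-output ts₅ refl

-- Polynomial bounds

-- The variable is the length of the tail of the input, so the base `suc n` is the length of the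
-- whole input and is positive, as monotonicity in the exponent requires.
Polynomial : (ℕ → ℕ) → Set
Polynomial p = ∃[ c ] ∃[ k ] ∀ n → p n ≤ c * suc n ^ k

poly-monomial : ∀ c k → Polynomial (λ n → c * suc n ^ k)
poly-monomial c k = c , k , λ _ → ≤-refl

poly-const : ∀ c → Polynomial (λ _ → c)
poly-const c = c , 0 , λ _ → ≤-reflexive (sym (*-identityʳ c))

poly-suc : Polynomial suc
poly-suc = 1 , 1 , λ n → ≤-reflexive (sym (trans (*-identityˡ _) (^-identityʳ (suc n))))

-- The sum of the exponents majorises both, which avoids a maximum.
poly-+ : ∀ {p q} → Polynomial p → Polynomial q → Polynomial (λ n → p n + q n)
poly-+ (c , k , p≤) (d , l , q≤) = c + d , k + l , λ n → ≤-trans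
  (+-mono-≤ (≤-trans (p≤ n) (*-monoʳ-≤ c (^-monoʳ-≤ (suc n) (m≤m+n k l))))
            (≤-trans (q≤ n) (*-monoʳ-≤ d (^-monoʳ-≤ (suc n) (m≤n+m l k)))))
  (≤-reflexive (sym (*-distribʳ-+ (suc n ^ (k + l)) c d)))

poly-* : ∀ {p q} → Polynomial p → Polynomial q → Polynomial (λ n → p n * q n)
poly-* (c , k , p≤) (d , l , q≤) = c * d , k + l , λ n → ≤-trans
  (*-mono-≤ (p≤ n) (q≤ n))
  (≤-reflexive (trans ([m*n]*[o*p]≡[m*o]*[n*p] c (suc n ^ k) d (suc n ^ l))
                      (cong (c * d *_) (sym (^-distribˡ-+-* (suc n) k l)))))

-- A quadratic bound in the joint length of the two words suffices for all the programs below. The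
-- word `w` is collected on the first stack, the one that becomes the output tape.
Runs : ∀ {k} (F : Flowchart (4 + k)) → ℕ → List Bool → List Bool → List Bool → Set
Runs F C u v w = ∃[ σ ] (block entry , [] ∷ u ∷ v ∷ Vec.replicate _ []) ⇒⟨ C * (suc N * suc N) ⟩
    (halt , w ∷ σ)
  where
  open Flowchart F
  open Run F
  N = length u + length v

-- All the reductions are built by this lemma. The outputs of the two machines are polynomially
-- long, so a quadratic program on them stays polynomial. The result is specified by a relation,
-- since what matters of it is its meaning as an instance; excluding `[]` makes it a nonempty word.
polyTime-combine : ∀ {μ₁ μ₂ k} → PolyTime μ₁ → PolyTime μ₂ → (F : Flowchart (4 + k)) → ∀ C →
  (R : List⁺ Bool → List Bool → Set) → (∀ x → ¬ R x []) →
  (∀ x → ∃[ w ] Runs F C (List⁺.toList (μ₁ x)) (List⁺.toList (μ₂ x)) w × R x w) →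
  ∃[ μ ] PolyTime μ × (∀ x → R x (List⁺.toList (μ x)))
polyTime-combine {μ₁} {μ₂} {k} (M₁ , c₁ , k₁ , run₁) (M₂ , c₂ , k₂ , run₂) F C R nonempty runs =
  μ , (machine , proj₁ time-poly , proj₁ (proj₂ time-poly) , machine-computes) ,
  λ x → subst (R x) (sym (toList-μ x)) (proj₂ (proj₂ (runs x)))
  where
  M : Bool → Machine
  M false = M₁
  M true  = M₂

  open Combination M F
  open Realise device

  μ-of : ∀ x w → R x w → List⁺ Bool
  μ-of x []      r = contradiction r (nonempty x)
  μ-of x (b ∷ w) r = b ∷ w

  toList-μ-of : ∀ x w r → List⁺.toList (μ-of x w r) ≡ w
  toList-μ-of x []      r = contradiction r (nonempty x)
  toList-μ-of x (b ∷ w) r = refl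

  μ : List⁺ Bool → List⁺ Bool
  μ x = let w , _ , r = runs x in μ-of x w r

  toList-μ : ∀ x → List⁺.toList (μ x) ≡ proj₁ (runs x)
  toList-μ x = let w , _ , r = runs x in toList-μ-of x w r

  time₁ time₂ lengths time : ℕ → ℕ
  time₁ n = c₁ * suc n ^ k₁
  time₂ n = c₂ * suc n ^ k₂
  lengths n = (suc n + time₁ n) + (suc n + time₂ n)
  time n = ((suc n * 3 + 2) + (suc n * 4 + 1)) * 2 +
    (1 + (suc (time₁ n) + (suc (time₂ n) + C * (suc (lengths n) * suc (lengths n)) * 2))) + 0

  time-poly : Polynomial time
  time-poly = poly-+ (poly-+
      (poly-* (poly-+ (poly-+ (poly-* poly-suc (poly-const 3)) (poly-const 2))
                      (poly-+ (poly-* poly-suc (poly-const 4)) (poly-const 1))) (poly-const 2))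
      (poly-+ (poly-const 1) (poly-+ (poly-+ (poly-const 1) t₁) (poly-+ (poly-+ (poly-const 1) t₂)
        (poly-* (poly-* (poly-const C) (poly-* suc-lengths suc-lengths)) (poly-const 2))))))
    (poly-const 0)
    where
    t₁ : Polynomial time₁
    t₁ = poly-monomial c₁ k₁
    t₂ : Polynomial time₂
    t₂ = poly-monomial c₂ k₂
    suc-lengths : Polynomial (λ n → suc (lengths n))
    suc-lengths = poly-+ (poly-const 1) (poly-+ (poly-+ poly-suc t₁) (poly-+ poly-suc t₂))

  machine-computes : ∀ x → ∃[ d ] HaltsWithin machine
      (proj₁ time-poly * List⁺.length x ^ proj₁ (proj₂ time-poly)) (initial machine x) d ×
    output machine d ≡ List⁺.toList (μ x)
  machine-computes x@(b ∷ bs) =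
    let w , (σ , t , t≤ , eq) , _ = runs x
        d′ , halts′ , out = conclusion t {w ∷ σ}
            (subst₂ (λ u v → Run.advances F t (_ , [] ∷ u ∷ v ∷ _) ≡ _)
          (sym (proj₂ (proj₂ (run₁ x)))) (sym (proj₂ (proj₂ (run₂ x)))) eq)
    in d′ , halts-mono (≤-trans (time-bound t t≤) (proj₂ (proj₂ time-poly) n)) halts′ , trans out
        (sym (toList-μ x))
    where
    n : ℕ
    n = length bs

    times : Bool → ℕ
    times false = time₁ n
    times true  = time₂ n

    d : ∀ j → Config (M j)
    d false = proj₁ (run₁ x)
    d true  = proj₁ (run₂ x)

    halts : ∀ j → HaltsWithin (M j) (times j) (initial (M j) x) (d j)
    halts false = proj₁ (proj₂ (run₁ x))
    halts true  = proj₁ (proj₂ (run₂ x))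

    open Combined b bs times d halts using (conclusion)

    input-length : ∀ j → length (output (M j) (d j)) ≤ suc n + times j
    input-length j = ≤-trans (output-length (M j) (halts j))
      (≤-reflexive (cong (λ l → suc l + times j) (length-map bit bs)))

    N : ℕ
    N = length (List⁺.toList (μ₁ x)) + length (List⁺.toList (μ₂ x))

    N≤lengths : N ≤ lengths n
    N≤lengths = +-mono-≤
      (subst (λ u → length u ≤ suc n + time₁ n) (proj₂ (proj₂ (run₁ x))) (input-length false))
      (subst (λ u → length u ≤ suc n + time₂ n) (proj₂ (proj₂ (run₂ x))) (input-length true))

    time-bound : ∀ t → t ≤ C * (suc N * suc N) →
      ((suc n * 3 + 2) + (suc n * 4 + 1)) * 2 + (1 + (suc (time₁ n) + (suc (time₂ n) + t * 2))) + 0 ≤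
          time n
    time-bound t t≤ = +-monoˡ-≤ 0 (+-monoʳ-≤ (((suc n * 3 + 2) + (suc n * 4 + 1)) * 2)
      (s≤s (+-monoʳ-≤ (suc (time₁ n)) (+-monoʳ-≤ (suc (time₂ n)) (*-monoˡ-≤ 2
        (≤-trans t≤ (*-monoʳ-≤ C (*-mono-≤ (s≤s N≤lengths) (s≤s N≤lengths)))))))))

-- Semantics of the reductions

true-ext : ∀ {a b} → (a ≡ true → b ≡ true) → (b ≡ true → a ≡ true) → a ≡ b
true-ext {false} {false} f g = refl
true-ext {false} {true}  f g = g refl
true-ext {true}  {b}     f g = sym (f refl)

true-or-false : ∀ b → b ≡ true ⊎ b ≡ false
true-or-false false = inj₂ refl
true-or-false true  = inj₁ refl

does-elim : ∀ {A : Set} (a? : Dec A) → does a? ≡ true → A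
does-elim (true because ofʸ a) _ = a

module _ {n m} {ms : Vec ℕ n} (f : Fun (m ∷ ms)) where

  sat-intro : ∀ x → sat‾ ms (fix f x) ≡ true → sat (m ∷ ms) f ≡ true
  sat-intro x eq = dec-true (any? λ x → sat‾ ms (fix f x) ≟ true) (x , eq)

  sat-elim : sat (m ∷ ms) f ≡ true → ∃[ x ] sat‾ ms (fix f x) ≡ true
  sat-elim = does-elim (any? λ x → sat‾ ms (fix f x) ≟ true)

  sat‾-intro : (∀ x → sat ms (fix f x) ≡ true) → sat‾ (m ∷ ms) f ≡ true
  sat‾-intro = dec-true (all? λ x → sat ms (fix f x) ≟ true)

  sat‾-elim : sat‾ (m ∷ ms) f ≡ true → ∀ x → sat ms (fix f x) ≡ true
  sat‾-elim = does-elim (all? λ x → sat ms (fix f x) ≟ true)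

  sat‾-elim-false : sat‾ (m ∷ ms) f ≡ false → ∃[ x ] sat ms (fix f x) ≡ false
  sat‾-elim-false eq with any? (λ x → sat ms (fix f x) ≟ false)
  ... | true  because ofʸ p  = p
  ... | false because ofⁿ ¬p = contradiction
    (trans (sym eq) (sat‾-intro λ x → ¬-not λ p → ¬p (x , p))) λ ()

-- Rewriting a formula gives functions that agree only pointwise, so the quantifiers have to be
-- shown to respect this.
sat-cong  : ∀ {n} (ms : Vec ℕ n) {f g : Fun ms} → f ≗ g → sat ms f ≡ sat ms g
sat‾-cong : ∀ {n} (ms : Vec ℕ n) {f g : Fun ms} → f ≗ g → sat‾ ms f ≡ sat‾ ms g

sat-cong []       eq = eq []
sat-cong (m ∷ ms) {f} {g} eq = true-ext
  (λ p → let x , q = sat-elim f p in sat-intro g x (trans (sym (sat‾-cong ms (λ ys → eq (x ∷ ys)))) q))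
  (λ p → let x , q = sat-elim g p in sat-intro f x (trans (sat‾-cong ms (λ ys → eq (x ∷ ys))) q))

sat‾-cong []       eq = eq []
sat‾-cong (m ∷ ms) {f} {g} eq = true-ext
  (λ p → sat‾-intro g λ x → trans (sym (sat-cong ms (λ ys → eq (x ∷ ys)))) (sat‾-elim f p x))
  (λ p → sat‾-intro f λ x → trans (sat-cong ms (λ ys → eq (x ∷ ys))) (sat‾-elim g p x))

sat-not  : ∀ {n} (ms : Vec ℕ n) (f : Fun ms) → sat ms (not ∘ f) ≡ not (sat‾ ms f)
sat‾-not : ∀ {n} (ms : Vec ℕ n) (f : Fun ms) → sat‾ ms (not ∘ f) ≡ not (sat ms f)

sat-not []       f = refl
sat-not (m ∷ ms) f = true-ext
  (λ p → let x , q = sat-elim (not ∘ f) p in ¬-not λ r →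
     contradiction
         (trans (sym q) (trans (sat‾-not ms (fix f x)) (cong not (sat‾-elim f (not-injective r) x))))
         λ ())
  (λ p → let x , q = sat‾-elim-false f (not-injective p) in
     sat-intro (not ∘ f) x (trans (sat‾-not ms (fix f x)) (cong not q)))

sat‾-not []       f = refl
sat‾-not (m ∷ ms) f = true-ext
  (λ p → ¬-not λ r → let x , q = sat-elim f (not-injective r) in
     contradiction (trans (sym (sat‾-elim (not ∘ f) p x)) (trans (sat-not ms (fix f x)) (cong not q)))
         λ ())
  (λ p → sat‾-intro (not ∘ f) λ x → trans (sat-not ms (fix f x)) (cong not (¬-not λ r →
     contradiction (trans (sym p) (cong not (sat-intro f x r))) λ ())))

-- Enlarging the blocks: coordinate j of a block becomes coordinate 2j + 1,
-- so that the first bit of the enlarged block is a new variable.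
data Fits : ∀ {n} → Vec ℕ n → Vec ℕ n → Set where
  []  : Fits [] []
  _∷_ : ∀ {n m m′} {ms ms′ : Vec ℕ n} → suc (2 * m) ≤ m′ → Fits ms ms′ → Fits (m ∷ ms) (m′ ∷ ms′)

fits : ∀ {n} (ms ms′ : Vec ℕ n) → (∀ i → suc (2 * lookup ms i) ≤ lookup ms′ i) → Fits ms ms′
fits []       []         _  = []
fits (m ∷ ms) (m′ ∷ ms′) le = le zero ∷ fits ms ms′ (le ∘ suc)

-- `m` and `m′` are predecessors of dimensions: the last coordinate is `m`, it goes to 2m + 1, and
-- the last coordinate available is `m′`.
odd< : ∀ {m m′} → suc (2 * m) ≤ m′ → (j : Fin (suc m)) → suc (2 * toℕ j) < suc m′
odd< le j = s≤s (≤-trans (s≤s (*-monoʳ-≤ 2 (s≤s⁻¹ (toℕ<n j)))) le)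

odd : ∀ {m m′} → suc (2 * m) ≤ m′ → Fin (suc m) → Fin (suc m′)
odd le j = fromℕ< (odd< le j)

odd-at : ∀ {n} {ms ms′ : Vec ℕ n} → Fits ms ms′ → ∀ i → Fin (suc (lookup ms i)) →
    Fin (suc (lookup ms′ i))
odd-at (le ∷ _)  zero    j = odd le j
odd-at (_ ∷ fit) (suc i) j = odd-at fit i j

toℕ-odd-at : ∀ {n} {ms ms′ : Vec ℕ n} (fit : Fits ms ms′) i j → toℕ (odd-at fit i j) ≡ suc (2 * toℕ j)
toℕ-odd-at (le ∷ _)  zero    j = toℕ-fromℕ< (odd< le j)
toℕ-odd-at (_ ∷ fit) (suc i) j = toℕ-odd-at fit i j

spread : ∀ {n} {ms ms′ : Vec ℕ n} → Fits ms ms′ → Formula ms → Formula ms′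
spread fit (const b)  = const b
spread fit (var i j)  = var i (odd-at fit i j)
spread fit (neg φ)    = neg (spread fit φ)
spread fit (conj φ ψ) = conj (spread fit φ) (spread fit ψ)
spread fit (disj φ ψ) = disj (spread fit φ) (spread fit ψ)

shrinkBlock : ∀ {m m′} → suc (2 * m) ≤ m′ → Block m′ → Block m
shrinkBlock le y = tabulate (lookup y ∘ odd le)

shrink : ∀ {n} {ms ms′ : Vec ℕ n} → Fits ms ms′ → All Block ms′ → All Block ms
shrink []         []       = []
shrink (le ∷ fit) (y ∷ ys) = shrinkBlock le y ∷ shrink fit ys

eval-spread : ∀ {n} {ms ms′ : Vec ℕ n} (fit : Fits ms ms′) φ ρ → eval (spread fit φ) ρ ≡
    eval φ (shrink fit ρ)
eval-spread fit (const b)  ρ = refl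
eval-spread fit (var i j)  ρ = coordinate fit ρ i j
  where
  coordinate : ∀ {n} {ms ms′ : Vec ℕ n} (fit : Fits ms ms′) ρ i (j : Fin (suc (lookup ms i))) →
    lookup (All.lookup ρ (∈-lookup i ms′)) (odd-at fit i j) ≡
        lookup (All.lookup (shrink fit ρ) (∈-lookup i ms)) j
  coordinate (le ∷ fit) (y ∷ ys) zero    j = sym (lookup∘tabulate (lookup y ∘ odd le) j)
  coordinate (le ∷ fit) (y ∷ ys) (suc i) j = coordinate fit ys i j
eval-spread fit (neg φ)    ρ = cong not (eval-spread fit φ ρ)
eval-spread fit (conj φ ψ) ρ = cong₂ _∧_ (eval-spread fit φ ρ) (eval-spread fit ψ ρ)
eval-spread fit (disj φ ψ) ρ = cong₂ _∨_ (eval-spread fit φ ρ) (eval-spread fit ψ ρ)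

-- Coordinate 0 is even, hence never read by `shrinkBlock`, and can be chosen at will. This is what
-- makes it a fresh variable.
shrinkBlock-surjective : ∀ {m m′} (le : suc (2 * m) ≤ m′) b (x : Block m) →
  ∃[ y ] π₁ y ≡ b × shrinkBlock le y ≡ x
shrinkBlock-surjective {m} {suc m′} le b x =
  -- Position 2j + 1 of the block is position 2j of its tail, where halving gives back j. The
  -- remaining positions receive whatever the formula yields, `false` beyond the end of `x`.
  b ∷ tabulate (λ p → nth x ⌊ toℕ p /2⌋) , refl ,
  trans (tabulate-cong coordinate) (tabulate∘lookup x)
  where
  nth : ∀ {k} → Vec Bool k → ℕ → Bool
  nth []      _       = false
  nth (c ∷ _) zero    = c
  nth (_ ∷ v) (suc i) = nth v i

  nth-toℕ : ∀ {k} (v : Vec Bool k) i → nth v (toℕ i) ≡ lookup v i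
  nth-toℕ (_ ∷ _) zero    = refl
  nth-toℕ (_ ∷ v) (suc i) = nth-toℕ v i

  coordinate : ∀ j → lookup (b ∷ tabulate (λ p → nth x ⌊ toℕ p /2⌋)) (odd le j) ≡ lookup x j
  coordinate j = trans (lookup∘tabulate (λ p → nth x ⌊ toℕ p /2⌋) (fromℕ< (s≤s⁻¹ (odd< le j))))
    (trans (cong (nth x) (trans (cong ⌊_/2⌋ (toℕ-fromℕ< (s≤s⁻¹ (odd< le j))))
             (trans (cong (λ d → ⌊ toℕ j + d /2⌋) (+-identityʳ (toℕ j))) (⌊n+n/2⌋ (toℕ j)))))
           (nth-toℕ x j))
    where
    ⌊n+n/2⌋ : ∀ n → ⌊ n + n /2⌋ ≡ n
    ⌊n+n/2⌋ n = sym (n≡⌊n+n/2⌋ n)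

-- As `shrinkBlock` is onto, `y` ranging over the large blocks makes `shrinkBlock le y` range over
-- all small ones, under either quantifier.
sat-shrink  : ∀ {n} {ms ms′ : Vec ℕ n} (fit : Fits ms ms′) (f : Fun ms) → sat ms′ (f ∘ shrink fit) ≡
    sat ms f
sat‾-shrink : ∀ {n} {ms ms′ : Vec ℕ n} (fit : Fits ms ms′) (f : Fun ms) → sat‾ ms′ (f ∘ shrink fit) ≡
    sat‾ ms f

sat-shrink []         f = refl
sat-shrink (le ∷ fit) f = true-ext
  (λ p → let y , q = sat-elim (f ∘ shrink (le ∷ fit)) p in
     sat-intro f (shrinkBlock le y) (trans (sym (sat‾-shrink fit _)) q))
  (λ p → let x , q = sat-elim f p
             y , _ , eq = shrinkBlock-surjective le false x
         in sat-intro (f ∘ shrink (le ∷ fit)) y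
              (trans (sat‾-shrink fit _) (trans (cong (λ x → sat‾ _ (fix f x)) eq) q)))

sat‾-shrink []         f = refl
sat‾-shrink (le ∷ fit) f = true-ext
  (λ p → sat‾-intro f λ x → let y , _ , eq = shrinkBlock-surjective le false x in
     trans (cong (λ x → sat _ (fix f x)) (sym eq))
       (trans (sym (sat-shrink fit _)) (sat‾-elim (f ∘ shrink (le ∷ fit)) p y)))
  (λ p → sat‾-intro (f ∘ shrink (le ∷ fit)) λ y → trans (sat-shrink fit _)
      (sat‾-elim f p (shrinkBlock le y)))

T-true : ∀ {b} → T b → b ≡ true
T-true {true} _ = refl

true-T : ∀ {b} → b ≡ true → T b
true-T refl = tt

module _ {n m} {ms : Vec ℕ n} (f : Fun (m ∷ ms)) where

  firstBit? : ∀ b → Dec (∃[ x ] sat‾ ms (fix f x) ≡ true × π₁ x ≡ b)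
  firstBit? b = any? λ x → (sat‾ ms (fix f x) ≟ true) ×-dec (π₁ x ≟ b)

  val-elim : ∀ {b} → ⟦ val (m ∷ ms) f ⟧ b →
    (∃[ x ] sat‾ ms (fix f x) ≡ true × π₁ x ≡ b) ⊎ sat (m ∷ ms) f ≡ false
  val-elim {b} t with sat (m ∷ ms) f | T-true t
  ... | true  | eq = inj₁ (does-elim (firstBit? b) eq)
  ... | false | _  = inj₂ refl

  val-intro : ∀ x → sat‾ ms (fix f x) ≡ true → ⟦ val (m ∷ ms) f ⟧ (π₁ x)
  val-intro x eq = true-T (trans
    (cong (λ s → if s then does (firstBit? (π₁ x)) else true) (sat-intro f x eq))
    (dec-true (firstBit? (π₁ x)) (x , eq , refl)))

  val-unsat : ∀ {b} → sat (m ∷ ms) f ≡ false → ⟦ val (m ∷ ms) f ⟧ b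
  val-unsat {b} eq = true-T (cong (λ s → if s then does (firstBit? b) else true) eq)

firstVar : ∀ {n m} {ms : Vec ℕ n} → Formula (m ∷ ms)
firstVar = var zero zero

-- The witnesses of the choice formula starting with 1 are those of φ, and the
-- ones starting with 0 are counterexamples to ψ.
choice : ∀ {n} {ms : Vec ℕ (suc n)} → Formula ms → Formula ms → Formula ms
choice {ms = _ ∷ _} φ ψ = disj (conj φ firstVar) (conj (neg ψ) (neg firstVar))

val-choice : ∀ {n} {ms₁ ms₂ ms : Vec ℕ (suc n)} (fit₁ : Fits ms₁ ms) (fit₂ : Fits ms₂ ms) φ ψ (S : ℙ₊Σ) →
  ⟦ S ⟧ (sat ms₁ (eval φ)) → ⟦ S ⟧ (sat‾ ms₂ (eval ψ)) →
  ∀ {b} → ⟦ val ms (eval (choice (spread fit₁ φ) (spread fit₂ ψ))) ⟧ b → ⟦ S ⟧ b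
val-choice {ms = m ∷ ms} fit₁@(le₁ ∷ fit₁′) fit₂@(le₂ ∷ fit₂′) φ ψ S s₁ s₂ {b} t =
  conclude (val-elim h t)
  where
  h : Fun (m ∷ ms)
  h = eval (choice (spread fit₁ φ) (spread fit₂ ψ))

  h-true : ∀ x → π₁ x ≡ true → fix h x ≗ fix (eval φ) (shrinkBlock le₁ x) ∘ shrink fit₁′
  h-true x@(true ∷ _) refl ρ
    rewrite ∧-identityʳ (eval (spread fit₁ φ) (x ∷ ρ)) | ∧-zeroʳ (not (eval (spread fit₂ ψ) (x ∷ ρ)))
    = trans (∨-identityʳ _) (eval-spread fit₁ φ (x ∷ ρ))

  h-false : ∀ x → π₁ x ≡ false → fix h x ≗ not ∘ fix (eval ψ) (shrinkBlock le₂ x) ∘ shrink fit₂′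
  h-false x@(false ∷ _) refl ρ
    rewrite ∧-zeroʳ (eval (spread fit₁ φ) (x ∷ ρ)) | ∧-identityʳ (not (eval (spread fit₂ ψ) (x ∷ ρ)))
    = cong not (eval-spread fit₂ ψ (x ∷ ρ))

  sat‾-h-true : ∀ x → π₁ x ≡ true → sat‾ ms (fix h x) ≡ sat‾ _ (fix (eval φ) (shrinkBlock le₁ x))
  sat‾-h-true x eq = trans (sat‾-cong ms (h-true x eq)) (sat‾-shrink fit₁′ _)

  sat‾-h-false : ∀ x → π₁ x ≡ false → sat‾ ms (fix h x) ≡ not (sat _ (fix (eval ψ) (shrinkBlock le₂ x)))
  sat‾-h-false x eq = trans (sat‾-cong ms (h-false x eq))
      (trans (sat‾-not ms _) (cong not (sat-shrink fit₂′ _)))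

  witness-true : ∀ x → sat‾ ms (fix h x) ≡ true → π₁ x ≡ true → sat _ (eval φ) ≡ true
  witness-true x p eq = sat-intro (eval φ) _ (trans (sym (sat‾-h-true x eq)) p)

  witness-false : ∀ x → sat‾ ms (fix h x) ≡ true → π₁ x ≡ false → sat‾ _ (eval ψ) ≡ false
  witness-false x p eq = ¬-not λ q → contradiction
    (trans (sym p) (trans (sat‾-h-false x eq) (cong not (sat‾-elim (eval ψ) q _)))) λ ()

  no-witness : ∀ {x} → sat (m ∷ ms) h ≡ false → sat‾ ms (fix h x) ≢ true
  no-witness {x} eq p = contradiction (trans (sym (sat-intro h x p)) eq) λ ()

  -- A witness of `φ` would lift to a witness of `h`, because its preimage may be taken to start
  -- with `true`.
  unsat-true : sat (m ∷ ms) h ≡ false → sat _ (eval φ) ≡ false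
  unsat-true eq = ¬-not λ p →
    let x , q = sat-elim (eval φ) p
        y , π₁y , shrink-y = shrinkBlock-surjective le₁ true x
    in no-witness eq
        (trans (sat‾-h-true y π₁y) (trans (cong (λ x → sat‾ _ (fix (eval φ) x)) shrink-y) q))

  unsat-false : sat (m ∷ ms) h ≡ false → sat‾ _ (eval ψ) ≡ true
  unsat-false eq = ¬-not λ p →
    let x , q = sat‾-elim-false (eval ψ) p
        y , π₁y , shrink-y = shrinkBlock-surjective le₂ false x
    in no-witness eq (trans (sat‾-h-false y π₁y)
         (cong not (trans (cong (λ x → sat _ (fix (eval ψ) x)) shrink-y) q)))

  conclude : (∃[ x ] sat‾ ms (fix h x) ≡ true × π₁ x ≡ b) ⊎ sat (m ∷ ms) h ≡ false → ⟦ S ⟧ b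
  conclude (inj₁ (x , p , refl)) with true-or-false (π₁ x)
  ... | inj₁ eq = subst ⟦ S ⟧ (trans (witness-true x p eq) (sym eq)) s₁
  ... | inj₂ eq = subst ⟦ S ⟧ (trans (witness-false x p eq) (sym eq)) s₂
  conclude (inj₂ eq) with true-or-false b
  ... | inj₁ b≡true  = subst ⟦ S ⟧ (trans (unsat-false eq) (sym b≡true)) s₂
  ... | inj₂ b≡false = subst ⟦ S ⟧ (trans (unsat-true eq) (sym b≡false)) s₁

-- Conjunction with a literal of the first bit

sat-const  : ∀ {n} (ms : Vec ℕ n) b → sat ms (λ _ → b) ≡ b
sat‾-const : ∀ {n} (ms : Vec ℕ n) b → sat‾ ms (λ _ → b) ≡ b

sat-const []       b = refl
sat-const (m ∷ ms) b = true-ext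
  (λ p → let _ , q = sat-elim {ms = ms} (λ (_ : All Block (m ∷ ms)) → b) p in trans
      (sym (sat‾-const ms b)) q)
  -- Any block would do: the point is that there is one, so the quantifiers are not vacuous.
  (λ p → sat-intro {ms = ms} (λ (_ : All Block (m ∷ ms)) → b) (Vec.replicate _ false)
      (trans (sat‾-const ms b) p))

sat‾-const []       b = refl
sat‾-const (m ∷ ms) b = true-ext
  (λ p → trans (sym (sat-const ms b))
      (sat‾-elim {ms = ms} (λ (_ : All Block (m ∷ ms)) → b) p (Vec.replicate _ false)))
  (λ p → sat‾-intro {ms = ms} (λ (_ : All Block (m ∷ ms)) → b) λ _ → trans (sat-const ms b) p)

firstLiteral : ∀ {n m} {ms : Vec ℕ n} → Bool → Formula (m ∷ ms)
firstLiteral true  = firstVar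
firstLiteral false = neg firstVar

literal-agrees : ∀ {n m} {ms : Vec ℕ n} b (x : Block m) → π₁ x ≡ b → ∀ (ρ : All Block ms) →
    eval (firstLiteral b) (x ∷ ρ) ≡ true
literal-agrees true  (true  ∷ _) _ ρ = refl
literal-agrees false (false ∷ _) _ ρ = refl

literal-differs : ∀ {n m} {ms : Vec ℕ n} b (x : Block m) → π₁ x ≡ not b → ∀ (ρ : All Block ms) →
    eval (firstLiteral b) (x ∷ ρ) ≡ false
literal-differs true  (false ∷ _) _ ρ = refl
literal-differs false (true  ∷ _) _ ρ = refl

-- One argument for both reductions: `b = true` serves SAT, and `b = false` serves SAT‾ after a
-- negation. A witness of `h` is a witness of `φ` with first bit `b`. If there is none, then either
-- `φ` has no witness and every value is allowed, or some witness of `φ` starts with `not b`.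
module FirstLiteral {n m} {ms : Vec ℕ n} (φ : Formula (m ∷ ms)) (b : Bool) where

  h : Fun (m ∷ ms)
  h = eval (conj φ (firstLiteral b))

  agreeing : ∀ x → π₁ x ≡ b → fix h x ≗ fix (eval φ) x
  agreeing x eq ρ = trans (cong (eval φ (x ∷ ρ) ∧_) (literal-agrees b x eq ρ)) (∧-identityʳ _)

  differing : ∀ x → π₁ x ≡ not b → fix h x ≗ λ _ → false
  differing x eq ρ = trans (cong (eval φ (x ∷ ρ) ∧_) (literal-differs b x eq ρ)) (∧-zeroʳ _)

  val-literal-sat : sat (m ∷ ms) h ≡ true → ⟦ val (m ∷ ms) (eval φ) ⟧ b
  val-literal-sat p with sat-elim h p
  ... | x , q with π₁ x ≟ b
  ...   | true  because ofʸ refl = val-intro (eval φ) x (trans (sym (sat‾-cong ms (agreeing x refl))) q)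
  ...   | false because ofⁿ ne   = contradiction
    (trans (sym q) (trans (sat‾-cong ms (differing x (¬-not ne))) (sat‾-const ms false))) λ ()

  val-literal-unsat : sat (m ∷ ms) h ≡ false → ⟦ val (m ∷ ms) (eval φ) ⟧ (not b)
  val-literal-unsat p with true-or-false (sat (m ∷ ms) (eval φ))
  ... | inj₂ unsat = val-unsat (eval φ) unsat
  ... | inj₁ satisfiable with sat-elim (eval φ) satisfiable
  ...   | x , q with π₁ x ≟ b
  ...     | true  because ofʸ eq = contradiction
    (trans (sym (sat-intro h x (trans (sat‾-cong ms (agreeing x eq)) q))) p) λ ()
  ...     | false because ofⁿ ne = subst ⟦ val (m ∷ ms) (eval φ) ⟧ (¬-not ne) (val-intro (eval φ) x q)

val-sat : ∀ {n} {ms : Vec ℕ n} m (φ : Formula (m ∷ ms)) →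
  ⟦ val (m ∷ ms) (eval φ) ⟧ (sat (m ∷ ms) (eval (conj φ (firstLiteral true))))
val-sat {ms = ms} m φ with sat (m ∷ ms) (eval (conj φ (firstLiteral true))) in eq
... | true  = FirstLiteral.val-literal-sat φ true eq
... | false = FirstLiteral.val-literal-unsat φ true eq

val-sat‾ : ∀ {n} {ms : Vec ℕ n} m (φ : Formula (m ∷ ms)) →
  ⟦ val (m ∷ ms) (eval φ) ⟧ (sat‾ (m ∷ ms) (eval (neg (conj φ (firstLiteral false)))))
val-sat‾ {ms = ms} m φ rewrite sat‾-not (m ∷ ms) (eval (conj φ (firstLiteral false)))
  with sat (m ∷ ms) (eval (conj φ (firstLiteral false))) in eq
... | true  = FirstLiteral.val-literal-sat φ false eq
... | false = FirstLiteral.val-literal-unsat φ false eq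

-- Lexing and parsing

bit→ℕ : Bool → ℕ
bit→ℕ b = if b then 1 else 0

-- the notation of codeDigits, in front of a string
infixr 5 _then_
_then_ : List Bool → List Bool → List Bool
[]       then w = false ∷ w
(b ∷ ds) then w = true ∷ b ∷ (ds then w)

horner : ℕ → List Bool → ℕ
horner a []       = a
horner a (b ∷ ds) = horner (bit→ℕ b + a * 2) ds

data Malformed : List Bool → Set where
  []     : Malformed []
  single : Malformed (true ∷ [])
  _∷_    : ∀ b {w} → Malformed w → Malformed (true ∷ b ∷ w)

data Number : List Bool → Set where
  good : ∀ ds w → Number (ds then w)
  bad  : ∀ {w} → Malformed w → Number w

number : ∀ w → Number w
number []             = bad []
number (false ∷ w)    = good [] w
number (true ∷ [])    = bad single
number (true ∷ b ∷ w) with number w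
... | good ds w′ = good (b ∷ ds) w′
... | bad m      = bad (b ∷ m)

length-then : ∀ ds w → length (ds then w) ≡ suc (length ds * 2 + length w)
length-then []       w = refl
length-then (b ∷ ds) w = cong (λ l → suc (suc l)) (length-then ds w)

-- `decode` lexes the whole string before it parses, whereas the machine checks while reading. With
-- a continuation for what follows the number, the decoder can be restated in the order of the
-- machine.
numberFrom : ∀ {X : Set} → ℕ → List Bool → (ℕ → List Bool → Maybe X) → Maybe X
numberFrom a (false ∷ w)    k = k a w
numberFrom a (true ∷ b ∷ w) k = numberFrom (bit→ℕ b + a * 2) w k
numberFrom a _              k = nothing

expectNumber : ∀ {X : Set} → List Bool → (ℕ → List Bool → Maybe X) → Maybe X
expectNumber (true ∷ w) k = numberFrom 0 w k
expectNumber _          k = nothing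

numberFrom-good : ∀ {X : Set} a ds w (k : ℕ → List Bool → Maybe X) →
  numberFrom a (ds then w) k ≡ k (horner a ds) w
numberFrom-good a []       w k = refl
numberFrom-good a (b ∷ ds) w k = numberFrom-good _ ds w k

numberFrom-bad : ∀ {X : Set} a {w} → Malformed w → (k : ℕ → List Bool → Maybe X) → numberFrom a w k ≡
    nothing
numberFrom-bad a []      k = refl
numberFrom-bad a single  k = refl
numberFrom-bad a (b ∷ m) k = numberFrom-bad _ m k

numberFrom-nothing : ∀ {X : Set} a w (k : ℕ → List Bool → Maybe X) → (∀ i w → k i w ≡ nothing) →
  numberFrom a w k ≡ nothing
numberFrom-nothing a w k none with number w
... | good ds w′ = trans (numberFrom-good a ds w′ k) (none _ w′)
... | bad m      = numberFrom-bad a m k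

expectNumber-nothing : ∀ {X : Set} w (k : ℕ → List Bool → Maybe X) → (∀ i w → k i w ≡ nothing) →
  expectNumber w k ≡ nothing
expectNumber-nothing []          k none = refl
expectNumber-nothing (false ∷ w) k none = refl
expectNumber-nothing (true ∷ w)  k none = numberFrom-nothing 0 w k none

map->>= : ∀ {A B C : Set} (m : Maybe A) (f : A → B) (k : B → Maybe C) → (Maybe.map f m >>= k) ≡
    (m >>= λ a → k (f a))
map->>= (just _) f k = refl
map->>= nothing  f k = refl

>>=-just : ∀ {A B : Set} {f : A → B} (m : Maybe A) → (m >>= λ a → just (f a)) ≡ Maybe.map f m
>>=-just (just _) = refl
>>=-just nothing  = refl

>>=-nothing : ∀ {A B : Set} (m : Maybe A) {k : A → Maybe B} → (∀ a → k a ≡ nothing) → (m >>= k) ≡ nothing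
>>=-nothing (just a) none = none a
>>=-nothing nothing  none = refl

lexNum->>= : ∀ {X : Set} a w (K : List Token → Maybe X) →
  (lexNum a w >>= K) ≡ numberFrom a w (λ i w′ → lex w′ >>= λ ts → K (NUM i ∷ ts))
lexNum->>= a []             K = refl
lexNum->>= a (false ∷ w)    K = map->>= (lex w) _ K
lexNum->>= a (true ∷ [])    K = refl
lexNum->>= a (true ∷ b ∷ w) K = lexNum->>= _ w K

lex-number : ∀ {X : Set} w (K : List Token → Maybe X) → K [] ≡ nothing →
    (∀ t ts → (∀ n → t ≢ NUM n) → K (t ∷ ts) ≡ nothing) →
  (lex w >>= K) ≡ expectNumber w (λ i w′ → lex w′ >>= λ ts → K (NUM i ∷ ts))
lex-number [] K none other = none
lex-number (true ∷ w) K none other = lexNum->>= 0 w K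
lex-number (false ∷ []) K none other = refl
lex-number (false ∷ true ∷ []) K none other = refl
lex-number (false ∷ true ∷ false ∷ w) K none other =
  trans (map->>= (lex w) _ K) (>>=-nothing (lex w) λ ts → other AND ts λ _ ())
lex-number (false ∷ true ∷ true ∷ w) K none other =
  trans (map->>= (lex w) _ K) (>>=-nothing (lex w) λ ts → other OR ts λ _ ())
lex-number (false ∷ false ∷ []) K none other = refl
lex-number (false ∷ false ∷ false ∷ []) K none other = refl
lex-number (false ∷ false ∷ false ∷ b ∷ w) K none other =
  trans (map->>= (lex w) _ K) (>>=-nothing (lex w) λ ts → other (CONST b) ts λ _ ())
lex-number (false ∷ false ∷ true ∷ []) K none other = refl
lex-number (false ∷ false ∷ true ∷ false ∷ w) K none other =
  trans (map->>= (lex w) _ K) (>>=-nothing (lex w) λ ts → other NEG ts λ _ ())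
lex-number (false ∷ false ∷ true ∷ true ∷ w) K none other =
  trans (map->>= (lex w) _ K) (>>=-nothing (lex w) λ ts → other VAR ts λ _ ())

-- Lexing and parsing in one. Both fail with `nothing`, so it does not matter which failure is met
-- first, and the parser can be unfolded on bits one token at a time.
parseBits : ∀ {n} (ms : Vec ℕ n) → List Bool → List (Formula ms) → Maybe (Formula ms)
parseBits ms w φs = lex w >>= λ ts → parse ts φs

module _ {n} (ms : Vec ℕ n) (w : List Bool) where

  parseBits-const : ∀ b φs → parseBits ms (false ∷ false ∷ false ∷ b ∷ w) φs ≡
      parseBits ms w (const b ∷ φs)
  parseBits-const b φs = map->>= (lex w) _ _

  parseBits-neg : ∀ φ φs → parseBits ms (false ∷ false ∷ true ∷ false ∷ w) (φ ∷ φs) ≡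
      parseBits ms w (neg φ ∷ φs)
  parseBits-neg φ φs = map->>= (lex w) _ _

  parseBits-and : ∀ φ ψ φs → parseBits ms (false ∷ true ∷ false ∷ w) (ψ ∷ φ ∷ φs) ≡
      parseBits ms w (conj φ ψ ∷ φs)
  parseBits-and φ ψ φs = map->>= (lex w) _ _

  parseBits-or : ∀ φ ψ φs → parseBits ms (false ∷ true ∷ true ∷ w) (ψ ∷ φ ∷ φs) ≡
      parseBits ms w (disj φ ψ ∷ φs)
  parseBits-or φ ψ φs = map->>= (lex w) _ _

  parseBits-neg-[] : parseBits ms (false ∷ false ∷ true ∷ false ∷ w) [] ≡ nothing
  parseBits-neg-[] = trans (map->>= (lex w) _ _) (>>=-nothing (lex w) λ _ → refl)

  parseBits-binary-[] : ∀ b → parseBits ms (false ∷ true ∷ b ∷ w) [] ≡ nothing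
  parseBits-binary-[] false = trans (map->>= (lex w) _ _) (>>=-nothing (lex w) λ _ → refl)
  parseBits-binary-[] true  = trans (map->>= (lex w) _ _) (>>=-nothing (lex w) λ _ → refl)

  parseBits-binary-single : ∀ b φ → parseBits ms (false ∷ true ∷ b ∷ w) (φ ∷ []) ≡ nothing
  parseBits-binary-single false φ = trans (map->>= (lex w) _ _) (>>=-nothing (lex w) λ _ → refl)
  parseBits-binary-single true  φ = trans (map->>= (lex w) _ _) (>>=-nothing (lex w) λ _ → refl)

  parseBits-num : ∀ φs → parseBits ms (true ∷ w) φs ≡ nothing
  parseBits-num φs = trans (lexNum->>= 0 w (λ ts → parse ts φs))
    (numberFrom-nothing 0 w _ λ i w′ → >>=-nothing (lex w′) λ _ → refl)

  parseBits-var : ∀ φs → parseBits ms (false ∷ false ∷ true ∷ true ∷ w) φs ≡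
    expectNumber w λ i w′ → expectNumber w′ λ j w″ → var? ms i j >>= λ v → parseBits ms w″ (v ∷ φs)
  parseBits-var φs = trans (map->>= (lex w) _ _)
    (trans (lex-number w (λ ts → parse (VAR ∷ ts) φs) refl
             λ { (CONST _) _ _ → refl ; VAR _ _ → refl ; NEG _ _ → refl ; AND _ _ → refl ; OR _ _ → refl
               ; (NUM n) _ ne → contradiction refl (ne n) })
      (expectNumber-cong w λ i w′ → trans
        (lex-number w′ (λ ts → parse (VAR ∷ NUM i ∷ ts) φs) refl
          λ { (CONST _) _ _ → refl ; VAR _ _ → refl ; NEG _ _ → refl ; AND _ _ → refl ; OR _ _ → refl
            ; (NUM n) _ ne → contradiction refl (ne n) })
        (expectNumber-cong w′ λ j w″ → lookup-first i j (lex w″))))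
    where
    numberFrom-cong : ∀ {X : Set} a w {k k′ : ℕ → List Bool → Maybe X} → (∀ i w → k i w ≡ k′ i w) →
      numberFrom a w k ≡ numberFrom a w k′
    numberFrom-cong a []             eq = refl
    numberFrom-cong a (false ∷ w)    eq = eq a w
    numberFrom-cong a (true ∷ [])    eq = refl
    numberFrom-cong a (true ∷ b ∷ w) eq = numberFrom-cong _ w eq

    expectNumber-cong : ∀ {X : Set} w {k k′ : ℕ → List Bool → Maybe X} → (∀ i w → k i w ≡ k′ i w) →
      expectNumber w k ≡ expectNumber w k′
    expectNumber-cong []          eq = refl
    expectNumber-cong (false ∷ w) eq = refl
    expectNumber-cong (true ∷ w)  eq = numberFrom-cong 0 w eq

    lookup-first : ∀ i j (m : Maybe (List Token)) →
      (m >>= λ ts → var? ms i j >>= λ v → parse ts (v ∷ φs)) ≡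
          (var? ms i j >>= λ v → m >>= λ ts → parse ts (v ∷ φs))
    lookup-first i j (just ts) = refl
    lookup-first i j nothing   = sym (>>=-nothing (var? ms i j) λ _ → refl)

fin?-toℕ : ∀ {n} (i : Fin n) → fin? n (toℕ i) ≡ just i
fin?-toℕ zero    = refl
fin?-toℕ (suc i) rewrite fin?-toℕ i = refl

fin?-just : ∀ n {i j} → fin? n i ≡ just j → toℕ j ≡ i
fin?-just (suc n) {zero}  refl = refl
fin?-just (suc n) {suc i} eq with fin? n i in eq′
fin?-just (suc n) {suc i} refl | just j = cong suc (fin?-just n eq′)

fin?-≥ : ∀ n {i} → n ≤ i → fin? n i ≡ nothing
fin?-≥ zero    _         = refl
fin?-≥ (suc n) (s≤s n≤i) rewrite fin?-≥ n n≤i = refl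

fin?-< : ∀ n {i} → i < n → ∃[ j ] fin? n i ≡ just j
fin?-< (suc n) {zero}  _         = zero , refl
fin?-< (suc n) {suc i} (s≤s i<n) with fin?-< n i<n
... | j , eq rewrite eq = suc j , refl

-- Validation of an instance

-- least significant digit first
value : List Bool → ℕ
value []       = 0
value (b ∷ bs) = bit→ℕ b + value bs * 2

value-ʳ++ : ∀ ds acc → value (ds ʳ++ acc) ≡ horner (value acc) ds
value-ʳ++ []       acc = refl
value-ʳ++ (b ∷ ds) acc = value-ʳ++ ds (b ∷ acc)

value<2^ : ∀ ds → suc (value ds) ≤ 2 ^ length ds
value<2^ []       = ≤-refl
value<2^ (b ∷ ds) = ≤-trans (doubled b)
    (≤-trans (*-monoˡ-≤ 2 (value<2^ ds)) (≤-reflexive (*-comm (2 ^ length ds) 2)))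
  where
  doubled : ∀ b → suc (bit→ℕ b + value ds * 2) ≤ suc (value ds) * 2
  doubled false = n≤1+n _
  doubled true  = ≤-refl

update-order : Bool → Bool → Bool → Bool
update-order le false false = le
update-order le true  true  = le
update-order le false true  = true
update-order le true  false = false

-- compares from the least significant digits on; the first argument is the
-- answer for the digits read so far
compare-digits : Bool → List Bool → List Bool → Bool
compare-digits le []       []       = le
compare-digits le []       (b ∷ ds) = compare-digits (update-order le false b) [] ds
compare-digits le (c ∷ js) []       = compare-digits (update-order le c false) js []
compare-digits le (c ∷ js) (b ∷ ds) = compare-digits (update-order le c b) js ds

double-< : ∀ {x y} → x < y → 2 + x * 2 ≤ y * 2
double-< x<y = *-monoˡ-≤ 2 x<y

halve-< : ∀ {x y} → x * 2 < y * 2 → x < y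
halve-< {x} {y} = *-cancelʳ-< 2 x y

halve-≤ : ∀ {x y} → x * 2 ≤ suc (y * 2) → x ≤ y
halve-≤ le = ≮⇒≥ λ y<x → <⇒≱ (double-< y<x) le

module _ {x y : ℕ} where

  order-double : ∀ le c b → x < bit→ℕ (update-order le c b) + y →
      bit→ℕ c + x * 2 < bit→ℕ le + (bit→ℕ b + y * 2)
  order-double false false false lt = ≤-trans (n≤1+n _) (double-< lt)
  order-double true  false false lt = s≤s (*-monoˡ-≤ 2 (s≤s⁻¹ lt))
  order-double false true  true  lt = m≤n⇒m≤1+n (double-< lt)
  order-double true  true  true  lt = s≤s (s≤s (*-monoˡ-≤ 2 (s≤s⁻¹ lt)))
  order-double false false true  lt = s≤s (*-monoˡ-≤ 2 (s≤s⁻¹ lt))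
  order-double true  false true  lt = s≤s (m≤n⇒m≤1+n (*-monoˡ-≤ 2 (s≤s⁻¹ lt)))
  order-double false true  false lt = double-< lt
  order-double true  true  false lt = m≤n⇒m≤1+n (double-< lt)

  order-halve : ∀ le c b → bit→ℕ c + x * 2 < bit→ℕ le + (bit→ℕ b + y * 2) →
      x < bit→ℕ (update-order le c b) + y
  order-halve false false false lt = halve-< lt
  order-halve true  false false lt = s≤s (halve-≤ (m≤n⇒m≤1+n (s≤s⁻¹ lt)))
  order-halve false true  true  lt = halve-< (s≤s⁻¹ lt)
  order-halve true  true  true  lt = s≤s (halve-≤ (m≤n⇒m≤1+n (s≤s⁻¹ (s≤s⁻¹ lt))))
  order-halve false false true  lt = s≤s (halve-≤ (m≤n⇒m≤1+n (s≤s⁻¹ lt)))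
  order-halve true  false true  lt = s≤s (halve-≤ (s≤s⁻¹ lt))
  order-halve false true  false lt = halve-< (≤-trans (n≤1+n _) lt)
  order-halve true  true  false lt = halve-< (s≤s⁻¹ lt)

-- The flag turns a strict comparison into a weak one: adding `bit→ℕ le` on the right means ≤ for
-- `true` and < for `false`. If the remaining, higher digits agree, the lower ones already read
-- decide, and `le` is their verdict.
compare-sound : ∀ le js ds → compare-digits le js ds ≡ true → value js < bit→ℕ le + value ds
compare-sound true []       []       eq = ≤-refl
compare-sound le   []       (b ∷ ds) eq = order-double le false b
    (compare-sound (update-order le false b) [] ds eq)
compare-sound le   (c ∷ js) []       eq = order-double le c false
    (compare-sound (update-order le c false) js [] eq)
compare-sound le   (c ∷ js) (b ∷ ds) eq = order-double le c b
    (compare-sound (update-order le c b) js ds eq)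

compare-complete : ∀ le js ds → compare-digits le js ds ≡ false → ¬ (value js < bit→ℕ le + value ds)
compare-complete false []       []       eq ()
compare-complete le    []       (b ∷ ds) eq lt = compare-complete (update-order le false b) [] ds eq
    (order-halve le false b lt)
compare-complete le    (c ∷ js) []       eq lt = compare-complete (update-order le c false) js [] eq
    (order-halve le c false lt)
compare-complete le    (c ∷ js) (b ∷ ds) eq lt = compare-complete (update-order le c b) js ds eq
    (order-halve le c b lt)

cap : ∀ n → ℕ → Fin (suc n)
cap n m = fromℕ< (s≤s (m⊓n≤n m n))

toℕ-cap : ∀ n m → toℕ (cap n m) ≡ m ⊓ n
toℕ-cap n m = toℕ-fromℕ< (s≤s (m⊓n≤n m n))

-- Saturation at n keeps the index of a block in the finite control.
append : ∀ {n} → Fin (suc n) → Bool → Fin (suc n)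
append {n} a b = cap n (bit→ℕ b + toℕ a * 2)

-- A value that has reached `n` stays at least `n` when a digit is appended, so nothing is lost by
-- truncating early.
toℕ-append : ∀ {n} (a : Fin (suc n)) b {m} → toℕ a ≡ m ⊓ n → toℕ (append a b) ≡ (bit→ℕ b + m * 2) ⊓ n
toℕ-append {n} a b {m} eq = trans (toℕ-cap n _)
    (trans (cong (λ k → (bit→ℕ b + k * 2) ⊓ n) eq) (saturate (≤-total m n)))
  where
  saturate : m ≤ n ⊎ n ≤ m → (bit→ℕ b + (m ⊓ n) * 2) ⊓ n ≡ (bit→ℕ b + m * 2) ⊓ n
  saturate (inj₁ m≤n) rewrite m≤n⇒m⊓n≡m m≤n = refl
  saturate (inj₂ n≤m) rewrite m≥n⇒m⊓n≡n n≤m = trans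
    (m≥n⇒m⊓n≡n (≤-trans (m≤m*n n 2) (m≤n+m _ _)))
    (sym (m≥n⇒m⊓n≡n (≤-trans n≤m (≤-trans (m≤m*n m 2) (m≤n+m _ _)))))

-- The cap `n` is itself out of range, so one state stands for all indices that are too large.
fin?-⊓ : ∀ n m → fin? n (m ⊓ n) ≡ fin? n m
fin?-⊓ n m with ≤-total m n
... | inj₁ m≤n rewrite m≤n⇒m⊓n≡m m≤n = refl
... | inj₂ n≤m rewrite m≥n⇒m⊓n≡n n≤m = trans (fin?-≥ n ≤-refl) (sym (fin?-≥ n n≤m))

fin-next : ∀ {n} → Fin n → Maybe (Fin n)
fin-next {suc zero}    zero    = nothing
fin-next {suc (suc n)} zero    = just (suc zero)
fin-next {suc n}       (suc i) = Maybe.map suc (fin-next i)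

-- Digits arrive most significant first, so on a stack the least significant one is on top, where
-- `compare` begins. The comparison moves the digits of the dimension to `scratchₛ`, and `restore`
-- moves them back for the next variable of the same block.
data Label (n : ℕ) : Set where
  dim dimDigits coord restore : Fin n → Label n
  index   : Fin (suc n) → Label n
  compare : Fin n → Bool → Label n
  token finish count fail : Label n

Label-finite : ∀ n → Finite (Label n)
Label-finite n = retract to from from-to
  (⊎-finite (Σ-finite (Fin-finite 4) λ _ → Fin-finite n)
    (⊎-finite (Fin-finite (suc n))
        (⊎-finite (Σ-finite (Fin-finite n) λ _ → Bool-finite) (Fin-finite 4))))
  where
  to : Label n → Σ (Fin 4) (λ _ → Fin n) ⊎ Fin (suc n) ⊎ Σ (Fin n) (λ _ → Bool) ⊎ Fin 4
  to (dim i)        = inj₁ (zero , i)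
  to (dimDigits i)  = inj₁ (suc zero , i)
  to (coord i)      = inj₁ (suc (suc zero) , i)
  to (restore i)    = inj₁ (suc (suc (suc zero)) , i)
  to (index a)      = inj₂ (inj₁ a)
  to (compare i le) = inj₂ (inj₂ (inj₁ (i , le)))
  to token          = inj₂ (inj₂ (inj₂ zero))
  to finish         = inj₂ (inj₂ (inj₂ (suc zero)))
  to count          = inj₂ (inj₂ (inj₂ (suc (suc zero))))
  to fail           = inj₂ (inj₂ (inj₂ (suc (suc (suc zero)))))

  from : Σ (Fin 4) (λ _ → Fin n) ⊎ Fin (suc n) ⊎ Σ (Fin n) (λ _ → Bool) ⊎ Fin 4 → Label n
  from (inj₁ (zero , i))                             = dim i
  from (inj₁ (suc zero , i))                         = dimDigits i
  from (inj₁ (suc (suc zero) , i))                   = coord i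
  from (inj₁ (suc (suc (suc zero)) , i))             = restore i
  from (inj₂ (inj₁ a))                               = index a
  from (inj₂ (inj₂ (inj₁ (i , le))))                 = compare i le
  from (inj₂ (inj₂ (inj₂ zero)))                     = token
  from (inj₂ (inj₂ (inj₂ (suc zero))))               = finish
  from (inj₂ (inj₂ (inj₂ (suc (suc zero)))))         = count
  from (inj₂ (inj₂ (inj₂ (suc (suc (suc zero))))))   = fail

  from-to : ∀ l → from (to l) ≡ l
  from-to (dim i)        = refl
  from-to (dimDigits i)  = refl
  from-to (coord i)      = refl
  from-to (restore i)    = refl
  from-to (index a)      = refl
  from-to (compare i le) = refl
  from-to token          = refl
  from-to finish         = refl
  from-to count          = refl
  from-to fail           = refl

pattern outₛ      = zero
pattern inₛ       = suc zero
pattern bodyₛ     = suc (suc (suc zero))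
pattern heightₛ   = suc (suc (suc (suc zero)))
pattern coordₛ    = suc (suc (suc (suc (suc zero))))
pattern scratchₛ  = suc (suc (suc (suc (suc (suc zero)))))
pattern sizeₛ     = suc (suc (suc (suc (suc (suc (suc zero))))))
pattern dimₛ i    = suc (suc (suc (suc (suc (suc (suc (suc i)))))))

-- The height stack has one bit for each formula that the parser would have on its
-- stack.  The digit 1 appended to a coordinate j turns it into 2j + 1.  Stack 2 is
-- not used.
normaliser : ∀ n → Fin n → Flowchart (4 + (4 + n))
normaliser n start = record
  { Label        = Label n
  ; Label-finite = Label-finite n
  ; block        = block
  ; entry        = dim start
  }
  where
  C = Code (8 + n) (Label n)

  reject : C
  reject = goto fail

  emit : List Bool → C → C
  emit = pushes bodyₛ

  ifFalse ifTrue : C → Bool → C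
  ifFalse c b = if b then reject else c
  ifTrue  c b = if b then c else reject

  var-code neg-code : C
  var-code = pop inₛ reject (ifTrue (emit (false ∷ false ∷ true ∷ true ∷ true ∷ []) (goto (index zero))))
  neg-code = pop heightₛ reject λ _ → push heightₛ true
      (emit (false ∷ false ∷ true ∷ false ∷ []) (goto token))

  const-code binary-code : Bool → C
  const-code b = emit (false ∷ false ∷ false ∷ b ∷ []) (push heightₛ true (goto token))
  binary-code b = pop heightₛ reject λ _ → pop heightₛ reject λ _ → push heightₛ true
    (emit (false ∷ true ∷ b ∷ []) (goto token))

  token-code : C
  token-code = pop inₛ reject λ b → if b
    then pop inₛ reject binary-code
    else pop inₛ reject λ b → if b
      then pop inₛ reject (λ b → if b then var-code else neg-code)
      else pop inₛ reject const-code

  block : Label n → C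
  block (dim i)        = pop inₛ reject (ifTrue (goto (dimDigits i)))
  block (dimDigits i)  = pop inₛ reject λ b → if b
    then (pop inₛ reject λ b → push sizeₛ true (push (dimₛ i) b (goto (dimDigits i))))
    else goto (maybe′ dim token (fin-next i))
  block token          = pop inₛ
    -- At the end of the input exactly one formula has to be left.
    (pop heightₛ reject λ _ → pop heightₛ (goto finish) λ _ → reject)
    (ifFalse token-code)
  block (index a)      = pop inₛ reject λ b → if b
    then (pop inₛ reject λ b → emit (true ∷ b ∷ []) (goto (index (append a b))))
    else maybe′ (λ i → pop inₛ reject (ifTrue (emit (false ∷ true ∷ []) (goto (coord i))))) reject
        (fin? n (toℕ a))
  block (coord i)      = pop inₛ reject λ b → if b
    then (pop inₛ reject λ b → emit (true ∷ b ∷ []) (push coordₛ b (goto (coord i))))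
    else emit (true ∷ true ∷ false ∷ []) (goto (compare i true))
  block (compare i le) = pop coordₛ
    (pop (dimₛ i) (if le then goto (restore i) else reject)
                  λ b → push scratchₛ b (goto (compare i (update-order le false b))))
    λ c → pop (dimₛ i) (goto (compare i (update-order le c false)))
                       λ b → push scratchₛ b (goto (compare i (update-order le c b)))
  block (restore i)    = pop scratchₛ (push heightₛ true (goto token)) λ b →
      push (dimₛ i) b (goto (restore i))
  block finish         = pop bodyₛ (push outₛ false (goto count)) λ b → push outₛ b (goto finish)
  -- The exponent L in unary: the number of all digits of all dimensions, plus one. A predecessor
  -- `m` with l digits has m + 1 ≤ 2 ^ l, and the doubling of the coordinates accounts for one more
  -- factor 2.
  block count          = pop sizeₛ (push outₛ true halt) λ _ → push outₛ true (goto count)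
  -- From back to front: the code of the constant 0, the separator 0, and the exponent 1 in unary,
  -- which is the normal form of the instance that a malformed string stands for.
  block fail           = pushes outₛ (false ∷ false ∷ false ∷ false ∷ false ∷ true ∷ []) halt

-- Runs of the loops of the normaliser

pairsOnto : List Bool → List Bool → List Bool
pairsOnto []       o = o
pairsOnto (b ∷ ds) o = pairsOnto ds (b ∷ true ∷ o)

then-ʳ++ : ∀ ds w o → (ds then w) ʳ++ o ≡ w ʳ++ (false ∷ pairsOnto ds o)
then-ʳ++ []       w o = refl
then-ʳ++ (b ∷ ds) w o = then-ʳ++ ds w (b ∷ true ∷ o)

pairsOnto-snoc : ∀ ds o → pairsOnto (ds ++ true ∷ []) o ≡ true ∷ true ∷ pairsOnto ds o
pairsOnto-snoc []       o = refl
pairsOnto-snoc (b ∷ ds) o = pairsOnto-snoc ds (b ∷ true ∷ o)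

horner-snoc : ∀ a ds → horner a (ds ++ true ∷ []) ≡ suc (horner a ds * 2)
horner-snoc a []       = refl
horner-snoc a (b ∷ ds) = horner-snoc _ ds

truesOnto : List Bool → List Bool → List Bool
truesOnto []       t = t
truesOnto (_ ∷ ds) t = truesOnto ds (true ∷ t)

length-truesOnto : ∀ ds t → length (truesOnto ds t) ≡ length ds + length t
length-truesOnto []       t = refl
length-truesOnto (_ ∷ ds) t = trans (length-truesOnto ds (true ∷ t)) (+-suc (length ds) (length t))

module Normaliser (n : ℕ) (start : Fin n) (v : List Bool) where

  open Flowchart (normaliser n start) using (block; entry) public
  open Run (normaliser n start) public

  Dims : Set
  Dims = Vec (List Bool) n

  conf : Label n → (w o h j x t : List Bool) → Dims → Conf
  conf l w o h j x t D = block l , [] ∷ w ∷ v ∷ o ∷ h ∷ j ∷ x ∷ t ∷ D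

  Fails : Conf → ℕ → Set
  Fails c T = ∃[ σ ] c ⇒⟨ T ⟩ (goto fail , [] ∷ σ)

  infixr 5 _▸ᶠ_
  _▸ᶠ_ : ∀ {T U c d} → c ⇒⟨ T ⟩ d → Fails d U → Fails c (T + U)
  r ▸ᶠ (σ , s) = σ , r ▸ s

  fails-within : ∀ {T U c} → T ≤ U → Fails c T → Fails c U
  fails-within T≤U (σ , r) = σ , within T≤U r

  pop-dim : ∀ i {e f a₀ a₁ a₂ a₃ a₄ a₅ a₆ a₇ b ds} (D : Dims) →
    (pop (dimₛ i) e f , a₀ ∷ a₁ ∷ a₂ ∷ a₃ ∷ a₄ ∷ a₅ ∷ a₆ ∷ a₇ ∷ D [ i ]≔ (b ∷ ds)) ⇒⟨ 1 ⟩
    (f b , a₀ ∷ a₁ ∷ a₂ ∷ a₃ ∷ a₄ ∷ a₅ ∷ a₆ ∷ a₇ ∷ D [ i ]≔ ds)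
  pop-dim i {e} {f} {a₀} {a₁} {a₂} {a₃} {a₄} {a₅} {a₆} {a₇} {b} {ds} D =
    subst (λ D′ → (pop (dimₛ i) e f , σ (D [ i ]≔ (b ∷ ds))) ⇒⟨ 1 ⟩ (f b , σ D′)) ([]≔-idempotent D i)
      (pop-bit (dimₛ i) (σ (D [ i ]≔ (b ∷ ds))) (lookup∘update i D (b ∷ ds)))
    where
    σ : Dims → Stacks (8 + n)
    σ D′ = a₀ ∷ a₁ ∷ a₂ ∷ a₃ ∷ a₄ ∷ a₅ ∷ a₆ ∷ a₇ ∷ D′

  pop-dim-empty : ∀ i {e f a₀ a₁ a₂ a₃ a₄ a₅ a₆ a₇} (D : Dims) →
    (pop (dimₛ i) e f , a₀ ∷ a₁ ∷ a₂ ∷ a₃ ∷ a₄ ∷ a₅ ∷ a₆ ∷ a₇ ∷ D [ i ]≔ []) ⇒⟨ 1 ⟩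
    (e , a₀ ∷ a₁ ∷ a₂ ∷ a₃ ∷ a₄ ∷ a₅ ∷ a₆ ∷ a₇ ∷ D [ i ]≔ [])
  pop-dim-empty i D = pop-empty (dimₛ i) _ (lookup∘update i D [])

  push-dim : ∀ i {c a₀ a₁ a₂ a₃ a₄ a₅ a₆ a₇ b ds} (D : Dims) →
    (push (dimₛ i) b c , a₀ ∷ a₁ ∷ a₂ ∷ a₃ ∷ a₄ ∷ a₅ ∷ a₆ ∷ a₇ ∷ D [ i ]≔ ds) ⇒⟨ 1 ⟩
    (c , a₀ ∷ a₁ ∷ a₂ ∷ a₃ ∷ a₄ ∷ a₅ ∷ a₆ ∷ a₇ ∷ D [ i ]≔ (b ∷ ds))
  push-dim i {c} {a₀} {a₁} {a₂} {a₃} {a₄} {a₅} {a₆} {a₇} {b} {ds} D =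
    1 , ≤-refl , cong (λ D′ → c , a₀ ∷ a₁ ∷ a₂ ∷ a₃ ∷ a₄ ∷ a₅ ∷ a₆ ∷ a₇ ∷ D′) (updateAt-updateAt i D)

  index-good : ∀ is {w o h j x t D} a {m} → toℕ a ≡ m ⊓ n → ∃[ a′ ] toℕ a′ ≡ horner m is ⊓ n ×
    conf (index a) (is then w) o h j x t D ⇒⟨ length is * 5 ⟩ conf (index a′) (false ∷ w)
        (pairsOnto is o) h j x t D
  index-good []       a eq = a , eq , by 0
  index-good (b ∷ is) a eq =
    let a′ , eq′ , r = index-good is (append a b) (toℕ-append a b eq) in a′ , eq′ , by 5 ▸ r

  index-bad : ∀ {w o h j x t D} a → Malformed w → Fails (conf (index a) w o h j x t D) (length w * 5 + 2)
  index-bad a []      = _ , within (s≤s z≤n) (by 1)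
  index-bad a single  = _ , within (s≤s (s≤s z≤n)) (by 2)
  index-bad a (b ∷ m) = fails-within (+-monoʳ-≤ 5 (m≤n+m _ 5)) (by 5 ▸ᶠ index-bad (append a b) m)

  index-end : ∀ {w o h j x t D} a {i} → fin? n (toℕ a) ≡ just i →
    conf (index a) (false ∷ true ∷ w) o h j x t D ⇒⟨ 5 ⟩ conf (coord i) w (true ∷ false ∷ o) h j x t D
  index-end a eq rewrite eq = by 5

  index-unbounded : ∀ {w o h j x t D} a → fin? n (toℕ a) ≡ nothing →
      Fails (conf (index a) (false ∷ w) o h j x t D) 1
  index-unbounded a eq rewrite eq = _ , by 1

  index-end-bad : ∀ {w o h j x t D} a {i} → fin? n (toℕ a) ≡ just i → (w ≡ [] ⊎ ∃[ w′ ] w ≡ false ∷ w′) →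
    Fails (conf (index a) (false ∷ w) o h j x t D) 2
  index-end-bad a eq (inj₁ refl)       rewrite eq = _ , by 2
  index-end-bad a eq (inj₂ (_ , refl)) rewrite eq = _ , by 2

  coord-good : ∀ i js {w o h j x t D} →
    conf (coord i) (js then w) o h j x t D ⇒⟨ length js * 6 + 5 ⟩
    conf (compare i true) w (false ∷ true ∷ true ∷ pairsOnto js o) h (js ʳ++ j) x t D
  coord-good i []       = by 5
  coord-good i (b ∷ js) = by 6 ▸ coord-good i js

  coord-bad : ∀ i {w o h j x t D} → Malformed w → Fails (conf (coord i) w o h j x t D) (length w * 6 + 2)
  coord-bad i []      = _ , within (s≤s z≤n) (by 1)
  coord-bad i single  = _ , within (s≤s (s≤s z≤n)) (by 2)
  coord-bad i (b ∷ m) = fails-within (+-monoʳ-≤ 6 (m≤n+m _ 6)) (by 6 ▸ᶠ coord-bad i m)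

  compare-accept : ∀ i js ds le {w o h x t D} → compare-digits le js ds ≡ true →
    conf (compare i le) w o h js x t (D [ i ]≔ ds) ⇒⟨ length js * 4 + (length ds * 4 + 3) ⟩
    conf (restore i) w o h [] (ds ʳ++ x) t (D [ i ]≔ [])
  compare-accept i []       []       true {D = D} eq = by 1 ▸ pop-dim-empty i D ▸ by 1
  compare-accept i []       (b ∷ ds) le   {D = D} eq = by 1 ▸ pop-dim i D ▸ by 2 ▸
      compare-accept i [] ds _ eq
  compare-accept i (c ∷ js) []       le   {D = D} eq =
    within (n≤1+n _) (by 1 ▸ pop-dim-empty i D ▸ by 1 ▸ compare-accept i js [] _ eq)
  compare-accept i (c ∷ js) (b ∷ ds) le   {D = D} eq =
    within (+-monoʳ-≤ 4 (+-monoʳ-≤ (length js * 4) (m≤n+m _ 4)))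
      (by 1 ▸ pop-dim i D ▸ by 2 ▸ compare-accept i js ds _ eq)

  compare-reject : ∀ i js ds le {w o h x t D} → compare-digits le js ds ≡ false →
    Fails (conf (compare i le) w o h js x t (D [ i ]≔ ds)) (length js * 4 + (length ds * 4 + 3))
  compare-reject i []       []       false {D = D} eq = _ , within (n≤1+n 2) (by 1 ▸ pop-dim-empty i D)
  compare-reject i []       (b ∷ ds) le   {D = D} eq = by 1 ▸ᶠ pop-dim i D ▸ᶠ by 2
      ▸ᶠ compare-reject i [] ds _ eq
  compare-reject i (c ∷ js) []       le   {D = D} eq =
    fails-within (n≤1+n _) (by 1 ▸ᶠ pop-dim-empty i D ▸ᶠ by 1 ▸ᶠ compare-reject i js [] _ eq)
  compare-reject i (c ∷ js) (b ∷ ds) le   {D = D} eq =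
    fails-within (+-monoʳ-≤ 4 (+-monoʳ-≤ (length js * 4) (m≤n+m _ 4)))
      (by 1 ▸ᶠ pop-dim i D ▸ᶠ by 2 ▸ᶠ compare-reject i js ds _ eq)

  restore-all : ∀ i xs ds {w o h j t D} →
    conf (restore i) w o h j xs t (D [ i ]≔ ds) ⇒⟨ length xs * 3 + 3 ⟩
    conf token w o (true ∷ h) j [] t (D [ i ]≔ (xs ʳ++ ds))
  restore-all i []       ds         = by 3
  restore-all i (b ∷ xs) ds {D = D} = by 1 ▸ push-dim i D ▸ by 1 ▸ restore-all i xs (b ∷ ds)

  finish-all : ∀ bs {o w h j x t} {D : Dims} →
    (block finish , o ∷ w ∷ v ∷ bs ∷ h ∷ j ∷ x ∷ t ∷ D) ⇒⟨ length bs * 3 + 3 ⟩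
    (block count , (false ∷ (bs ʳ++ o)) ∷ w ∷ v ∷ [] ∷ h ∷ j ∷ x ∷ t ∷ D)
  finish-all []       = by 3
  finish-all (b ∷ bs) = by 3 ▸ finish-all bs

  count-all : ∀ t {o w b h j x} {D : Dims} →
    (block count , o ∷ w ∷ v ∷ b ∷ h ∷ j ∷ x ∷ t ∷ D) ⇒⟨ length t * 3 + 2 ⟩
    (halt , (true ∷ truesOnto t o) ∷ w ∷ v ∷ b ∷ h ∷ j ∷ x ∷ [] ∷ D)
  count-all []      = by 2
  count-all (_ ∷ t) = by 3 ▸ count-all t

  dimDigits-good : ∀ i ds {w o h j x t acc D} →
    conf (dimDigits i) (ds then w) o h j x t (D [ i ]≔ acc) ⇒⟨ length ds * 5 + 2 ⟩
    conf (maybe′ dim token (fin-next i)) w o h j x (truesOnto ds t) (D [ i ]≔ (ds ʳ++ acc))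
  dimDigits-good i []               = by 2
  dimDigits-good i (b ∷ ds) {D = D} = by 3 ▸ push-dim i D ▸ by 1 ▸ dimDigits-good i ds

  dimDigits-bad : ∀ i {w o h j x t acc D} → Malformed w →
    Fails (conf (dimDigits i) w o h j x t (D [ i ]≔ acc)) (length w * 5 + 2)
  dimDigits-bad i []      = _ , within (s≤s z≤n) (by 1)
  dimDigits-bad i single  = _ , within (s≤s (s≤s z≤n)) (by 2)
  dimDigits-bad i {D = D} (b ∷ m) =
    fails-within (+-monoʳ-≤ 5 (m≤n+m _ 5)) (by 3 ▸ᶠ push-dim i D ▸ᶠ by 1 ▸ᶠ dimDigits-bad i m)

  bounded : ∀ i js {w o h t D} → compare-digits true js (lookup D i) ≡ true →
    conf (compare i true) w o h js [] t D
        ⇒⟨ (length js * 4 + (length (lookup D i) * 4 + 3)) + (length (lookup D i ʳ++ []) * 3 + 3) ⟩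
    conf token w o (true ∷ h) [] [] t D
  bounded i js {w} {o} {h} {t} {D} eq = subst₂ (λ D₁ D₂ → conf (compare i true) w o h js [] t D₁
      ⇒⟨ cost ⟩ conf token w o (true ∷ h) [] [] t D₂)
    ([]≔-lookup D i)
    (trans (cong (D [ i ]≔_) (trans (ʳ++-ʳ++ (lookup D i)) (++-identityʳ _))) ([]≔-lookup D i))
    (compare-accept i js (lookup D i) true eq ▸ restore-all i (lookup D i ʳ++ []) [])
    where
    cost : ℕ
    cost = (length js * 4 + (length (lookup D i) * 4 + 3)) + (length (lookup D i ʳ++ []) * 3 + 3)

  unbounded : ∀ i js {w o h t D} → compare-digits true js (lookup D i) ≡ false →
    Fails (conf (compare i true) w o h js [] t D) (length js * 4 + (length (lookup D i) * 4 + 3))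
  unbounded i js {w} {o} {h} {t} {D} eq =
    subst (λ D′ → Fails (conf (compare i true) w o h js [] t D′)
        (length js * 4 + (length (lookup D i) * 4 + 3)))
      ([]≔-lookup D i) (compare-reject i js (lookup D i) true eq)

-- The pass over the tokens of the formula

then-++ : ∀ ds w r → (ds then w) ++ r ≡ ds then (w ++ r)
then-++ []       w r = refl
then-++ (b ∷ ds) w r = cong (λ l → true ∷ b ∷ l) (then-++ ds w r)

digits≤then : ∀ ds w → length ds ≤ length (ds then w)
digits≤then ds w rewrite length-then ds w = m≤n⇒m≤1+n (≤-trans (m≤m*n (length ds) 2) (m≤m+n _ _))

rest<then : ∀ ds w → length w < length (ds then w)
rest<then ds w rewrite length-then ds w = s≤s (m≤n+m _ _)

parse-var : ∀ {n} (ms : Vec ℕ n) is js w φs →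
  parseBits ms (false ∷ false ∷ true ∷ true ∷ true ∷ (is then true ∷ (js then w))) φs ≡
  (var? ms (horner 0 is) (horner 0 js) >>= λ v → parseBits ms w (v ∷ φs))
parse-var ms is js w φs = trans (parseBits-var ms (true ∷ (is then true ∷ (js then w))) φs)
  (trans (numberFrom-good 0 is _ _) (numberFrom-good 0 js w _))

var?-just : ∀ {n} (ms : Vec ℕ n) {i j i′ j′} → fin? n i ≡ just i′ → fin? _ j ≡ just j′ → var? ms i j ≡
    just (var i′ j′)
var?-just ms eq eq′ rewrite eq | eq′ = refl

var?-nothing₁ : ∀ {n} (ms : Vec ℕ n) {i} j → fin? n i ≡ nothing → var? ms i j ≡ nothing
var?-nothing₁ ms j eq rewrite eq = refl

var?-nothing₂ : ∀ {n} (ms : Vec ℕ n) {i j i′} → fin? n i ≡ just i′ → fin? (suc (lookup ms i′)) j ≡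
    nothing → var? ms i j ≡ nothing
var?-nothing₂ ms eq eq′ rewrite eq | eq′ = refl

module Budget (N : ℕ) where

  constant : ∀ k → k ≤ k * suc N
  constant k = m≤m*n k (suc N)

  linear : ∀ a b {x} → x ≤ N → x * a + b ≤ (a + b) * suc N
  linear a b {x} x≤N = ≤-trans
    (+-mono-≤ (≤-trans (*-monoˡ-≤ a (m≤n⇒m≤1+n x≤N)) (≤-reflexive (*-comm (suc N) a))) (constant b))
    (≤-reflexive (sym (*-distribʳ-+ (suc N) a b)))

  proportional : ∀ a {x} → x ≤ N → x * a ≤ a * suc N
  proportional a x≤N = ≤-trans (*-monoˡ-≤ a (m≤n⇒m≤1+n x≤N)) (≤-reflexive (*-comm (suc N) a))

  infixr 5 _⊕_
  _⊕_ : ∀ {a b T U} → T ≤ a * suc N → U ≤ b * suc N → T + U ≤ (a + b) * suc N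
  _⊕_ {a} {b} T≤ U≤ = ≤-trans (+-mono-≤ T≤ U≤) (≤-reflexive (sym (*-distribʳ-+ (suc N) a b)))

module Tokens (n : ℕ) (start : Fin n) (v : List Bool) (ms : Vec ℕ n) (D : Vec (List Bool) n)
    (t : List Bool) (N : ℕ)
  (dim-value : ∀ i → value (lookup D i) ≡ lookup ms i) (dim-length : ∀ i → length (lookup D i) ≤ N) where

  open Normaliser n start v
  open Budget N

  -- A bound for the cost of one token. The dearest is a variable, with at most 30 + 28 multiples of
  -- `suc N`: up to its coordinate, and for reading, comparing and restoring digits. A token
  -- consumes at least one bit, so the whole pass is quadratic.
  A : ℕ
  A = 60 * suc N

  at : (w o h : List Bool) → Conf
  at w o h = conf token w o h [] [] t D

  -- The emitted `body` is characterised by how it parses in front of any `rest`, above any further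
  -- stack `χs` and for all dimensions that fit. The merger needs this freedom: it picks the
  -- dimensions later and puts other code around the body.
  data Outcome (w o h : List Bool) (φs : List (Formula ms)) : Set where
    rejected : Fails (at w o h) (A * suc (length w)) → parseBits ms w φs ≡ nothing → Outcome w o h φs
    accepted : ∀ body φ →
      at w o h ⇒⟨ A * suc (length w) ⟩ conf finish [] (body ʳ++ o) [] [] [] t D →
      parseBits ms w φs ≡ just φ →
      length body ≤ 2 * length w →
      (∀ {ns} (fit : Fits ms ns) χs rest →
        parseBits ns (body ++ rest) (List.map (spread fit) φs ++ χs) ≡ parseBits ns rest
            (spread fit φ ∷ χs)) →
      Outcome w o h φs

  reject : ∀ {w o h φs} T a → T ≤ a * suc N → a ≤ 60 → Fails (at w o h) T → parseBits ms w φs ≡ nothing →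
      Outcome w o h φs
  reject T a T≤ a≤60 fails eq = rejected
    (fails-within (≤-trans T≤ (≤-trans (*-monoˡ-≤ (suc N) a≤60) (m≤m*n A _))) fails) eq

  -- The induction step for one token. `prefix` puts the bits that it emits in front of the later
  -- ones. The size condition says that they are at most twice as many as the bits consumed, written
  -- without subtraction.
  proceed : ∀ {w w′ o o′ h h′ φs φs′} T a → T ≤ a * suc N → a ≤ 60 → at w o h ⇒⟨ T ⟩ at w′ o′ h′ →
    length w′ < length w → parseBits ms w φs ≡ parseBits ms w′ φs′ →
    (prefix : List Bool → List Bool) → (∀ r → prefix r ʳ++ o ≡ r ʳ++ o′) →
    (∀ r → length (prefix r) + 2 * length w′ ≤ length r + 2 * length w) →
    (∀ {ns} (fit : Fits ms ns) χs r rest → parseBits ns (prefix r ++ rest)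
        (List.map (spread fit) φs ++ χs) ≡
      parseBits ns (r ++ rest) (List.map (spread fit) φs′ ++ χs)) →
    Outcome w′ o′ h′ φs′ → Outcome w o h φs
  proceed {w} {w′} T a T≤ a≤60 r shorter eq prefix emitted size reparse = λ
    { (rejected fails none) → rejected (fails-within time (r ▸ᶠ fails)) (trans eq none)
    ; (accepted body φ run parsed small correct) → accepted (prefix body) φ
        (within time (r ▸ subst (λ o → _ ⇒⟨ _ ⟩ conf finish [] o [] [] [] t D) (sym (emitted body)) run))
        (trans eq parsed)
        (+-cancelʳ-≤ (2 * length w′) _ _ (≤-trans (size body)
          (≤-trans (+-monoˡ-≤ (2 * length w) small)
              (≤-reflexive (+-comm (2 * length w′) (2 * length w))))))
        (λ fit χs rest → trans (reparse fit χs body rest) (correct fit χs rest)) }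
    where
    time : T + A * suc (length w′) ≤ A * suc (length w)
    time = ≤-trans (+-monoˡ-≤ _ (≤-trans T≤ (*-monoˡ-≤ (suc N) a≤60)))
      (≤-trans (≤-reflexive (sym (*-suc A (suc (length w′))))) (*-monoʳ-≤ A (s≤s shorter)))

  ≤60 : ∀ k → {_ : T (k ≤ᵇ 60)} → k ≤ 60
  ≤60 k {p} = ≤ᵇ⇒≤ k 60 p

  fixed : ∀ {w o h φs} k → {_ : T (k ≤ᵇ 60)} → Fails (at w o h) k → parseBits ms w φs ≡ nothing →
      Outcome w o h φs
  fixed k {p} = reject k k (constant k) (≤60 k {p})

  copied : ∀ {w o h h′ φs φs′} pre (let c = length pre) k → {_ : T (k ≤ᵇ 60)} →
    at (pre ++ w) o h ⇒⟨ k ⟩ at w (pre ʳ++ o) h′ → 0 < c →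
    parseBits ms (pre ++ w) φs ≡ parseBits ms w φs′ →
    (∀ {ns} (fit : Fits ms ns) χs r → parseBits ns (pre ++ r) (List.map (spread fit) φs ++ χs) ≡
      parseBits ns r (List.map (spread fit) φs′ ++ χs)) →
    Outcome w (pre ʳ++ o) h′ φs′ → Outcome (pre ++ w) o h φs
  copied {w} {o} pre k {p} r 0<c eq reparse = proceed k k (constant k) (≤60 k {p}) r
    (≤-trans (+-monoˡ-≤ (length w) 0<c) (≤-reflexive (sym (length-++ pre))))
    eq (pre ++_) (λ r → ++-ʳ++ pre)
    (λ r → ≤-trans (≤-reflexive (cong (_+ 2 * length w) (length-++ pre)))
        (≤-trans (size (length pre) (length r) (length w))
      (≤-reflexive (cong (λ l → length r + 2 * l) (sym (length-++ pre))))))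
    (λ fit χs r rest → trans (cong (λ l → parseBits _ l _) (++-assoc pre r rest))
        (reparse fit χs (r ++ rest)))
    where
    size : ∀ c r w → c + r + 2 * w ≤ r + 2 * (c + w)
    size c r w = ≤-trans (m≤m+n (c + r + 2 * w) c) (≤-reflexive (rearrange c r w))
      where
      rearrange : ∀ c r w → c + r + 2 * w + c ≡ r + 2 * (c + w)
      rearrange = solve-∀

  double-spread : ∀ {ns : Vec ℕ n} (fit : Fits ms ns) {i} js {j} → fin? (suc (lookup ms i)) (horner 0 js)
      ≡ just j →
    fin? (suc (lookup ns i)) (horner 0 (js ++ true ∷ [])) ≡ just (odd-at fit i j)
  double-spread {ns} fit {i} js {j} eq = trans (cong (fin? (suc (lookup ns i))) value-eq)
      (fin?-toℕ (odd-at fit i j))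
    where
    value-eq : horner 0 (js ++ true ∷ []) ≡ toℕ (odd-at fit i j)
    value-eq = trans (horner-snoc 0 js)
        (trans (cong suc (trans (cong (_* 2) (sym (fin?-just _ {horner 0 js} eq))) (*-comm (toℕ j) 2)))
      (sym (toℕ-odd-at fit i j)))

  module Variable (w₀ o h : List Bool) (φs : List (Formula ms)) (w₀≤N : length w₀ ≤ N)
    (continue : ∀ w o′ i j → length w < length w₀ → Outcome w o′ (true ∷ h) (var i j ∷ φs)) where

    o₁ : List Bool → List Bool
    o₁ is = pairsOnto is (true ∷ true ∷ true ∷ false ∷ false ∷ o)

    expanded : List Bool → List Bool → List Bool → List Bool
    expanded is js r = false ∷ false ∷ true ∷ true ∷ true ∷ (is then true ∷ ((js ++ true ∷ []) then r))

    emitted : ∀ is js r → expanded is js r ʳ++ o ≡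
        r ʳ++ (false ∷ true ∷ true ∷ pairsOnto js (true ∷ false ∷ o₁ is))
    emitted is js r = trans
        (then-ʳ++ is (true ∷ ((js ++ true ∷ []) then r)) (true ∷ true ∷ true ∷ false ∷ false ∷ o))
      (trans (then-ʳ++ (js ++ true ∷ []) r _)
        (cong (λ l → r ʳ++ (false ∷ l)) (pairsOnto-snoc js (true ∷ false ∷ o₁ is))))

    -- The digit appended to the coordinate costs two bits, and the token itself is longer than
    -- that.
    size : ∀ is js r w → length (expanded is js r) + 2 * length w ≤
      length r + 2 * length (false ∷ false ∷ true ∷ true ∷ true ∷ (is then true ∷ (js then w)))
    size is js r w
      rewrite length-then is (true ∷ ((js ++ true ∷ []) then r)) | length-then (js ++ true ∷ []) r
            | length-then is (true ∷ (js then w)) | length-then js w | length-++ js {true ∷ []}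
      = ≤-trans (m≤m+n _ (6 + length is * 2 + length js * 2))
          (≤-reflexive (arithmetic (length is) (length js) (length r) (length w)))
      where
      arithmetic : ∀ i j r w → 5 + suc (i * 2 + suc (suc ((j + 1) * 2 + r))) + 2 * w
          + (6 + i * 2 + j * 2) ≡
        r + 2 * (5 + suc (i * 2 + suc (suc (j * 2 + w))))
      arithmetic = solve-∀

    var-coord : ∀ is js w → w₀ ≡ false ∷ false ∷ true ∷ true ∷ true ∷ (is then true ∷ (js then w)) →
      ∀ {i T a} → fin? n (horner 0 is) ≡ just i → T ≤ a * suc N → a ≤ 30 →
      at w₀ o h ⇒⟨ T ⟩ conf (coord i) (js then w) (true ∷ false ∷ o₁ is) h [] [] t D →
      length js ≤ N → length w < length w₀ → Outcome w₀ o h φs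
    var-coord is js w refl {i} {T} {a} eqi T≤ a≤30 r js≤N shorter
      -- Starting from `true` tests j ≤ m, and `m` is the predecessor of the dimension, so this
      -- decides whether the coordinate is in range.
      with compare-digits true (js ʳ++ []) (lookup D i) in eqc
    ... | false = reject _ (a + (11 + (4 + 7)))
      (_⊕_ {a} {22} T≤
          (_⊕_ {11} {11} (linear 6 5 js≤N)
          (_⊕_ {4} {7} (proportional 4 js′≤N) (linear 4 3 (dim-length i)))))
      (+-mono-≤ a≤30 (≤ᵇ⇒≤ 22 30 _))
      (r ▸ᶠ coord-good i js ▸ᶠ unbounded i (js ʳ++ []) eqc)
      (trans (parse-var ms is js w φs)
          (cong (_>>= λ x → parseBits ms w (x ∷ φs))
          (var?-nothing₂ ms {j = horner 0 js} eqi (fin?-≥ _ (≮⇒≥ λ lt →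
        compare-complete true (js ʳ++ []) (lookup D i) eqc
          (subst₂ (λ x y → x < suc y) (sym (value-ʳ++ js [])) (sym (dim-value i)) lt))))))
      where
      js′≤N : length (js ʳ++ []) ≤ N
      js′≤N = ≤-trans (≤-reflexive (trans (length-ʳ++ js) (+-identityʳ _))) js≤N
    ... | true with fin?-< (suc (lookup ms i)) {horner 0 js}
        (subst₂ (λ x y → x < suc y) (value-ʳ++ js []) (dim-value i)
                     (compare-sound true (js ʳ++ []) (lookup D i) eqc))
    ...   | j , eqj = proceed _ (a + (11 + ((4 + 7) + 6)))
      (_⊕_ {a} {28} T≤ (_⊕_ {11} {17} (linear 6 5 js≤N)
        (_⊕_ {11} {6} (_⊕_ {4} {7} (proportional 4 (reversed≤N js js≤N)) (linear 4 3 (dim-length i)))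
          (linear 3 3 (reversed≤N (lookup D i) (dim-length i))))))
      (+-mono-≤ a≤30 (≤ᵇ⇒≤ 28 30 _))
      (r ▸ coord-good i js ▸ bounded i (js ʳ++ []) eqc)
      shorter
      (trans (parse-var ms is js w φs)
          (cong (_>>= λ x → parseBits ms w (x ∷ φs)) (var?-just ms {j = horner 0 js} eqi eqj)))
      (expanded is js) (emitted is js) (λ r → size is js r w)
      (λ {ns} fit χs r rest → trans
        (cong (λ l → parseBits ns (false ∷ false ∷ true ∷ true ∷ true ∷ l)
            (List.map (spread fit) φs ++ χs))
          (trans (then-++ is _ rest) (cong (λ l → is then true ∷ l) (then-++ (js ++ true ∷ []) r rest))))
        (trans (parse-var ns is (js ++ true ∷ []) (r ++ rest) _)
          (cong (_>>= λ x → parseBits ns (r ++ rest) (x ∷ List.map (spread fit) φs ++ χs))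
            (var?-just ns {j = horner 0 (js ++ true ∷ [])} eqi (double-spread fit js eqj)))))
      (continue w _ i j shorter)
      where
      reversed≤N : ∀ l → length l ≤ N → length (l ʳ++ []) ≤ N
      reversed≤N l = ≤-trans (≤-reflexive (trans (length-ʳ++ l) (+-identityʳ _)))

    var-index : ∀ is w → w₀ ≡ false ∷ false ∷ true ∷ true ∷ true ∷ (is then w) → Outcome w₀ o h φs
    var-index is w refl with index-good is {w} {o₁ []} {h} {[]} {[]} {t} {D} zero {0} refl
    ... | a , eqa , r with fin? n (horner 0 is) in eqi
    ...   | nothing = reject (11 + (length is * 5 + 1)) (11 + (5 + 1))
      (_⊕_ {11} {6} (constant 11) (linear 5 1 is≤N)) (≤ᵇ⇒≤ 17 60 _)
      (by 11 ▸ᶠ r ▸ᶠ index-unbounded a (trans (cong (fin? n) eqa) (trans (fin?-⊓ n (horner 0 is)) eqi)))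
      (trans (parseBits-var ms (true ∷ (is then w)) φs) (trans (numberFrom-good 0 is w _)
        (expectNumber-nothing w _ λ j w″ → cong (_>>= λ x → parseBits ms w″ (x ∷ φs))
            (var?-nothing₁ ms j eqi))))
      where
      is≤N : length is ≤ N
      is≤N = ≤-trans (digits≤then is w) (≤-trans (m≤n+m _ 5) w₀≤N)
    ...   | just i = next-number w refl
      where
      is≤N : length is ≤ N
      is≤N = ≤-trans (digits≤then is w) (≤-trans (m≤n+m _ 5) w₀≤N)

      eqa′ : fin? n (toℕ a) ≡ just i
      eqa′ = trans (cong (fin? n) eqa) (trans (fin?-⊓ n (horner 0 is)) eqi)

      parsed : parseBits ms w₀ φs ≡ _
      parsed = trans (parseBits-var ms (true ∷ (is then w)) φs) (numberFrom-good 0 is w _)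

      no-number : (w ≡ [] ⊎ ∃[ w′ ] w ≡ false ∷ w′) → parseBits ms w₀ φs ≡ nothing → Outcome w₀ o h φs
      no-number shape = reject (11 + (length is * 5 + 2)) (11 + (5 + 2))
        (_⊕_ {11} {7} (constant 11) (linear 5 2 is≤N)) (≤ᵇ⇒≤ 18 60 _)
        (by 11 ▸ᶠ r ▸ᶠ index-end-bad a eqa′ shape)

      next-number : ∀ w′ → w ≡ w′ → Outcome w₀ o h φs
      next-number []           refl = no-number (inj₁ refl) parsed
      next-number (false ∷ w′) refl = no-number (inj₂ (w′ , refl)) parsed
      next-number (true ∷ w′)  refl with number w′
      ... | bad m = reject (11 + (length is * 5 + (5 + (length w′ * 6 + 2)))) (11 + (5 + (5 + (6 + 2))))
        (_⊕_ {11} {18} (constant 11)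
            (_⊕_ {5} {13} (proportional 5 is≤N) (_⊕_ {5} {8} (constant 5) (linear 6 2 w′≤N))))
        (≤ᵇ⇒≤ 29 60 _)
        (by 11 ▸ᶠ r ▸ᶠ index-end a eqa′ ▸ᶠ coord-bad i m)
        (trans parsed (numberFrom-bad 0 m _))
        where
        w′≤N : length w′ ≤ N
        w′≤N = ≤-trans (≤-trans (n≤1+n _) (<⇒≤ (rest<then is (true ∷ w′)))) (≤-trans (m≤n+m _ 5) w₀≤N)
      ... | good js w″ = var-coord is js w″ refl {i} {11 + (length is * 5 + 5)} {11 + (5 + 5)} eqi
        (_⊕_ {11} {10} (constant 11) (linear 5 5 is≤N)) (≤ᵇ⇒≤ 21 30 _)
        (by 11 ▸ r ▸ index-end a eqa′)
        (≤-trans (digits≤then js w″) (<⇒≤ (≤-trans tail< w₀≤N)))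
        (<-trans (rest<then js w″) tail<)
        where
        tail< : length (js then w″) < length w₀
        tail< = ≤-trans (n≤1+n _) (≤-trans (rest<then is (true ∷ (js then w″))) (m≤n+m _ 5))

    variable-token : ∀ w → w₀ ≡ false ∷ false ∷ true ∷ true ∷ w → Outcome w₀ o h φs
    variable-token []          refl = fixed 5 (_ , by 5) (parseBits-var ms [] φs)
    variable-token (false ∷ w) refl = fixed 5 (_ , by 5) (parseBits-var ms (false ∷ w) φs)
    variable-token (true ∷ w)  refl with number w
    ... | bad m = reject (11 + (length w * 5 + 2)) (11 + (5 + 2))
      (_⊕_ {11} {7} (constant 11) (linear 5 2 (≤-trans (m≤n+m _ 5) w₀≤N))) (≤ᵇ⇒≤ 18 60 _)
      (by 11 ▸ᶠ index-bad zero m)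
      (trans (parseBits-var ms (true ∷ w) φs) (numberFrom-bad 0 m _))
    ... | good is w′ = var-index is w′ refl

  -- A variable consumes a number of bits that is not visible in the pattern, so the recursion is on
  -- a bound for the length. The height stack is as long as the stack of the parser, hence both run
  -- empty at the same tokens.
  tokens : ∀ fuel w o h φs → length w ≤ fuel → length w ≤ N → length h ≡ length φs → Outcome w o h φs
  tokens fuel [] o []          []           _ _ _ = fixed 2 (_ , by 2) refl
  tokens fuel [] o (_ ∷ [])    (φ ∷ [])     _ _ _ = accepted [] φ
    (within (≤-trans (≤-trans (≤60 4) (m≤m*n 60 (suc N))) (m≤m*n A 1)) (by 4)) refl z≤n
        (λ fit χs rest → refl)
  tokens fuel [] o (_ ∷ _ ∷ _) (_ ∷ _ ∷ _)  _ _ _ = fixed 3 (_ , by 3) refl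
  tokens (suc fuel) (true ∷ w) o h φs _ _ _ = fixed 1 (_ , by 1) (parseBits-num ms w φs)
  tokens (suc fuel) (false ∷ []) o h φs _ _ _ = fixed 2 (_ , by 2) refl
  tokens (suc fuel) (false ∷ true ∷ []) o h φs _ _ _ = fixed 3 (_ , by 3) refl
  tokens (suc fuel) (false ∷ true ∷ b ∷ w) o [] [] _ _ _ = fixed 4 (_ , by 4)
      (parseBits-binary-[] ms w b)
  tokens (suc fuel) (false ∷ true ∷ b ∷ w) o (_ ∷ []) (φ ∷ []) _ _ _ = fixed 5 (_ , by 5)
      (parseBits-binary-single ms w b φ)
  tokens (suc fuel) (false ∷ true ∷ false ∷ w) o (_ ∷ _ ∷ h) (ψ ∷ φ ∷ φs) w≤ w≤N eq =
    copied (false ∷ true ∷ false ∷ []) 10 (by 10) (s≤s z≤n) (parseBits-and ms w φ ψ φs)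
      (λ {ns} fit χs r → parseBits-and ns r _ _ _)
      (tokens fuel w _ _ (conj φ ψ ∷ φs) (≤-trans (m≤n+m _ 2) (s≤s⁻¹ w≤)) (≤-trans (m≤n+m _ 3) w≤N)
          (cong pred eq))
  tokens (suc fuel) (false ∷ true ∷ true ∷ w) o (_ ∷ _ ∷ h) (ψ ∷ φ ∷ φs) w≤ w≤N eq =
    copied (false ∷ true ∷ true ∷ []) 10 (by 10) (s≤s z≤n) (parseBits-or ms w φ ψ φs)
      (λ {ns} fit χs r → parseBits-or ns r _ _ _)
      (tokens fuel w _ _ (disj φ ψ ∷ φs) (≤-trans (m≤n+m _ 2) (s≤s⁻¹ w≤)) (≤-trans (m≤n+m _ 3) w≤N)
          (cong pred eq))
  tokens (suc fuel) (false ∷ false ∷ []) o h φs _ _ _ = fixed 3 (_ , by 3) refl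
  tokens (suc fuel) (false ∷ false ∷ false ∷ []) o h φs _ _ _ = fixed 4 (_ , by 4) refl
  tokens (suc fuel) (false ∷ false ∷ true ∷ []) o h φs _ _ _ = fixed 4 (_ , by 4) refl
  tokens (suc fuel) (false ∷ false ∷ false ∷ b ∷ w) o h φs w≤ w≤N eq =
    copied (false ∷ false ∷ false ∷ b ∷ []) 10 (by 10) (s≤s z≤n) (parseBits-const ms w b φs)
      (λ {ns} fit χs r → parseBits-const ns r _ _)
      (tokens fuel w _ _ (const b ∷ φs) (≤-trans (m≤n+m _ 3) (s≤s⁻¹ w≤)) (≤-trans (m≤n+m _ 4) w≤N)
          (cong suc eq))
  tokens (suc fuel) (false ∷ false ∷ true ∷ false ∷ w) o [] [] _ _ _ = fixed 5 (_ , by 5)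
      (parseBits-neg-[] ms w)
  tokens (suc fuel) (false ∷ false ∷ true ∷ false ∷ w) o (_ ∷ h) (φ ∷ φs) w≤ w≤N eq =
    copied (false ∷ false ∷ true ∷ false ∷ []) 11 (by 11) (s≤s z≤n) (parseBits-neg ms w φ φs)
      (λ {ns} fit χs r → parseBits-neg ns r _ _)
      (tokens fuel w _ _ (neg φ ∷ φs) (≤-trans (m≤n+m _ 3) (s≤s⁻¹ w≤)) (≤-trans (m≤n+m _ 4) w≤N) eq)
  tokens (suc fuel) (false ∷ false ∷ true ∷ true ∷ w) o h φs w≤ w≤N eq =
    Variable.variable-token (false ∷ false ∷ true ∷ true ∷ w) o h φs w≤N
      (λ w′ o′ i j shorter → tokens fuel w′ o′ (true ∷ h) (var i j ∷ φs)
        (s≤s⁻¹ (≤-trans shorter w≤)) (<⇒≤ (≤-trans shorter w≤N)) (cong suc eq))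
      w refl

-- The pass over the dimensions

header-cons : ∀ m d (x : Maybe (List Token)) →
  (x >>= λ ts → header (suc m) (NUM d ∷ ts)) ≡ Maybe.map (λ (ms , ts) → d ∷ ms , ts) (x >>= header m)
header-cons m d (just _) = refl
header-cons m d nothing  = refl

header-number : ∀ m w → (lex w >>= header (suc m)) ≡
  expectNumber w (λ d w′ → lex w′ >>= λ ts → header (suc m) (NUM d ∷ ts))
header-number m w = lex-number w (header (suc m)) refl λ
  { (CONST _) _ _ → refl ; VAR _ _ → refl ; NEG _ _ → refl ; AND _ _ → refl ; OR _ _ → refl
  ; (NUM d) _ ne → contradiction refl (ne d) }

module Headers (n : ℕ) (start : Fin n) (v : List Bool) where

  open Normaliser n start v

  first : ∀ m → (Fin m → Fin n) → Label n
  first zero    κ = token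
  first (suc m) κ = dim (κ zero)

  -- `κ` lists the stacks of the dimensions still to be read. The control advances by `fin-next`
  -- among all `n` dimensions, whereas `header` recurs on how many are left; this condition keeps
  -- the two in step, including at the last one.
  Consecutive : ∀ {m} → (Fin m → Fin n) → Set
  Consecutive κ = ∀ j → fin-next (κ j) ≡ Maybe.map κ (fin-next j)

  consecutive-tail : ∀ {m} {κ : Fin (suc m) → Fin n} → Consecutive κ → Consecutive (κ ∘ suc)
  consecutive-tail {suc m} consecutive j = trans (consecutive (suc j)) (sym (map-∘ (fin-next j)))

  next-label : ∀ m {κ : Fin (suc m) → Fin n} → Consecutive κ → maybe′ dim token (fin-next (κ zero)) ≡
      first m (κ ∘ suc)
  next-label zero    consecutive rewrite consecutive zero = refl
  next-label (suc m) consecutive rewrite consecutive zero = refl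

  -- The stack `t` collects one bit for every digit of every dimension. Its final length bounds the
  -- number of digits of each of them, so the machine never has to form a maximum.
  data Outcome m (κ : Fin m → Fin n) (w t : List Bool) (D : Dims) : Set where
    rejected : Fails (conf (first m κ) w [] [] [] [] t D) (length w * 6 + 6) → (lex w >>= header m) ≡
        nothing →
      Outcome m κ w t D
    accepted : ∀ ms w′ t′ D′ →
      conf (first m κ) w [] [] [] [] t D ⇒⟨ length w * 6 + 6 ⟩ conf token w′ [] [] [] [] t′ D′ →
      (lex w >>= header m) ≡ Maybe.map (ms ,_) (lex w′) →
      length t′ + length w′ ≤ length t + length w →
      length t ≤ length t′ →
      (∀ j → value (lookup D′ (κ j)) ≡ lookup ms j) →
      (∀ j → length (lookup D′ (κ j)) ≤ length t′) →
      (∀ i → (∀ j → i ≢ κ j) → lookup D′ i ≡ lookup D i) →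
      Outcome m κ w t D

  headers : ∀ m (κ : Fin m → Fin n) → Consecutive κ → (∀ {i j} → κ i ≡ κ j → i ≡ j) →
    ∀ w t D → (∀ j → lookup D (κ j) ≡ []) → Outcome m κ w t D
  headers zero κ _ _ w t D _ = accepted [] w t D (within z≤n (by 0)) (>>=-just (lex w)) ≤-refl ≤-refl
    (λ ()) (λ ()) (λ _ _ → refl)
  headers (suc m) κ consecutive injective [] t D _ = rejected (_ , within (s≤s z≤n) (by 1)) refl
  headers (suc m) κ consecutive injective (false ∷ w) t D _ =
    rejected (_ , within (s≤s z≤n) (by 1)) (header-number m (false ∷ w))
  headers (suc m) κ consecutive injective (true ∷ w) t D cleared with number w
  ... | bad {w} malformed = rejected
    (fails-within (bound (length w))
        (by 2 ▸ᶠ subst (λ D′ → Fails (conf (dimDigits i) w [] [] [] [] t D′) (length w * 5 + 2))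
      ([]≔-lookup D i) (dimDigits-bad i malformed)))
    (trans (header-number m (true ∷ w)) (numberFrom-bad 0 malformed _))
    where
    i : Fin n
    i = κ zero
    bound : ∀ x → 2 + (x * 5 + 2) ≤ suc x * 6 + 6
    bound x = ≤-trans (m≤m+n (2 + (x * 5 + 2)) (x + 8)) (≤-reflexive (arithmetic x))
      where
      arithmetic : ∀ x → 2 + (x * 5 + 2) + (x + 8) ≡ suc x * 6 + 6
      arithmetic = solve-∀
  ... | good ds w′ = continue
      (headers m (κ ∘ suc) (consecutive-tail consecutive) (Fin-suc-injective ∘ injective) w′
      (truesOnto ds t)
      (D [ i ]≔ (ds ʳ++ []))
          (λ j → trans
          (lookup∘update′ (λ eq → contradiction (injective eq) λ ()) D _) (cleared (suc j))))
    where
    i : Fin n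
    i = κ zero

    fresh-i : ∀ j → i ≢ κ (suc j)
    fresh-i j eq = contradiction (injective eq) λ ()

    read : conf (dim i) (true ∷ (ds then w′)) [] [] [] [] t D ⇒⟨ 2 + (length ds * 5 + 2) ⟩
      conf (first m (κ ∘ suc)) w′ [] [] [] [] (truesOnto ds t) (D [ i ]≔ (ds ʳ++ []))
    read = subst (λ l → conf (dim i) (true ∷ (ds then w′)) [] [] [] [] t D ⇒⟨ cost ⟩ conf l w′ [] [] []
        [] (truesOnto ds t) (D [ i ]≔ (ds ʳ++ [])))
      (next-label m consecutive)
      (by 2 ▸ subst (λ D′ → conf (dimDigits i) (ds then w′) [] [] [] [] t D′ ⇒⟨ length ds * 5 + 2 ⟩ conf
          (maybe′ dim token (fin-next i)) w′ [] [] [] [] (truesOnto ds t) (D [ i ]≔ (ds ʳ++ [])))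
        (trans (cong (D [ i ]≔_) (sym (cleared zero))) ([]≔-lookup D i)) (dimDigits-good i ds))
      where
      cost : ℕ
      cost = 2 + (length ds * 5 + 2)

    time : (2 + (length ds * 5 + 2)) + (length w′ * 6 + 6) ≤ length (true ∷ (ds then w′)) * 6 + 6
    time rewrite length-then ds w′ = ≤-trans (m≤m+n _ (length ds * 7 + 8))
        (≤-reflexive (arithmetic (length ds) (length w′)))
      where
      arithmetic : ∀ d w → (2 + (d * 5 + 2)) + (w * 6 + 6) + (d * 7 + 8) ≡ suc (suc (d * 2 + w)) * 6 + 6
      arithmetic = solve-∀

    parsed : (lex (true ∷ (ds then w′)) >>= header (suc m)) ≡
      Maybe.map (λ (ms , ts) → horner 0 ds ∷ ms , ts) (lex w′ >>= header m)
    parsed = trans (header-number m (true ∷ (ds then w′)))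
      (trans (numberFrom-good 0 ds w′ _) (header-cons m (horner 0 ds) (lex w′)))

    continue : Outcome m (κ ∘ suc) w′ (truesOnto ds t) (D [ i ]≔ (ds ʳ++ [])) → Outcome (suc m) κ
        (true ∷ (ds then w′)) t D
    continue (rejected fails none) = rejected (fails-within time (read ▸ᶠ fails))
      (trans parsed (cong (Maybe.map _) none))
    continue (accepted ms w″ t″ D″ run eq total grows values lengths frame) =
      accepted (horner 0 ds ∷ ms) w″ t″ D″ (within time (read ▸ run))
        (trans parsed (trans (cong (Maybe.map _) eq) (sym (map-∘ (lex w″)))))
        (≤-trans total total′) (≤-trans t≤ grows) values′ lengths′ frame′
      where
      total′ : length (truesOnto ds t) + length w′ ≤ length t + length (true ∷ (ds then w′))
      total′ rewrite length-truesOnto ds t | length-then ds w′ =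
        ≤-trans (m≤m+n _ (2 + length ds)) (≤-reflexive (arithmetic (length ds) (length t) (length w′)))
        where
        arithmetic : ∀ d t w → d + t + w + (2 + d) ≡ t + suc (suc (d * 2 + w))
        arithmetic = solve-∀

      t≤ : length t ≤ length (truesOnto ds t)
      t≤ = ≤-trans (m≤n+m _ (length ds)) (≤-reflexive (sym (length-truesOnto ds t)))

      at-i : lookup D″ i ≡ ds ʳ++ []
      at-i = trans (frame i fresh-i) (lookup∘update i D (ds ʳ++ []))

      values′ : ∀ j → value (lookup D″ (κ j)) ≡ lookup (horner 0 ds ∷ ms) j
      values′ zero    = trans (cong value at-i) (value-ʳ++ ds [])
      values′ (suc j) = values j

      lengths′ : ∀ j → length (lookup D″ (κ j)) ≤ length t″
      lengths′ zero    = ≤-trans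
          (≤-reflexive (trans (cong length at-i) (trans (length-ʳ++ ds) (+-identityʳ _))))
        (≤-trans (m≤m+n (length ds) (length t))
            (≤-trans (≤-reflexive (sym (length-truesOnto ds t))) grows))
      lengths′ (suc j) = lengths j

      frame′ : ∀ i′ → (∀ j → i′ ≢ κ j) → lookup D″ i′ ≡ lookup D i′
      frame′ i′ outside = trans (frame i′ (outside ∘ suc)) (lookup∘update′ (outside zero) D (ds ʳ++ []))

-- The normal form of an instance

ones : ℕ → List Bool → List Bool
ones zero    w = w
ones (suc L) w = true ∷ ones L w

truesOnto-ones : ∀ t o → truesOnto t o ≡ ones (length t) o
truesOnto-ones []      o = refl
truesOnto-ones (_ ∷ t) o = trans (truesOnto-ones t (true ∷ o)) (ones-true (length t))
  where
  ones-true : ∀ L → ones L (true ∷ o) ≡ true ∷ ones L o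
  ones-true zero    = refl
  ones-true (suc L) = cong (true ∷_) (ones-true L)

-- 2 ^ L bounds the dimensions of the spread formula, and the code of that
-- formula does not depend on them.
Normalised : ∀ {n} → Instance n → List Bool → Set
Normalised (ms , φ) z = ∃[ L ] ∃[ body ] z ≡ ones L (false ∷ body) ×
  (∀ i → suc (lookup ms i) * 2 ≤ 2 ^ L) ×
  (∀ {ns} (fit : Fits ms ns) χs rest → parseBits ns (body ++ rest) χs ≡ parseBits ns rest
      (spread fit φ ∷ χs))

instanceOfBits : ∀ n → List Bool → Instance n
instanceOfBits n w = fromMaybe (Vec.replicate n 0 , const false) (decode n w)

decode-header : ∀ n w {x : Maybe (Vec ℕ n × List Token)} → (lex w >>= header n) ≡ x →
  decode n w ≡ (x >>= λ (ms , us) → parse us [] >>= λ φ → just (ms , φ))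
decode-header n w refl with lex w
... | nothing = refl
... | just ts with header n ts
...   | nothing = refl
...   | just _  = refl

decode-parse : ∀ n w {ms w′} → (lex w >>= header n) ≡ Maybe.map (ms ,_) (lex w′) →
  decode n w ≡ Maybe.map (ms ,_) (parseBits ms w′ [])
decode-parse n w {ms} {w′} eq = trans (decode-header n w eq) (collect (lex w′))
  where
  collect : ∀ x → (Maybe.map (ms ,_) x >>= λ (ms , us) → parse us [] >>= λ φ → just (ms , φ)) ≡
    Maybe.map (ms ,_) (x >>= λ us → parse us [])
  collect nothing   = refl
  collect (just us) = >>=-just (parse us [])

module Normalising (n : ℕ) (u v : List Bool) where

  open Headers (suc n) zero v
  open Normaliser (suc n) zero v

  N K : ℕ
  N = length u
  K = length u + length v

  open Budget N

  -- The constant 100 is a round number above the sums of coefficients that occur: 19 and 79 for a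
  -- rejected string, 86 for an accepted one.
  quadratic : ∀ {T} a b → T ≤ a * suc N + b * suc N * suc N → a + b ≤ 100 → T ≤ 100 * (suc K * suc K)
  quadratic {T} a b T≤ small = ≤-trans T≤ (≤-trans (+-monoˡ-≤ _ (m≤m*n (a * suc N) (suc N)))
    (≤-trans (≤-reflexive (factor a b (suc N))) (*-mono-≤ small (*-mono-≤ N≤K N≤K))))
    where
    N≤K : suc N ≤ suc K
    N≤K = s≤s (m≤m+n N (length v))
    factor : ∀ a b m → a * m * m + b * m * m ≡ (a + b) * (m * m)
    factor = solve-∀

  initialConf : Conf
  initialConf = conf (dim zero) u [] [] [] [] [] (Vec.replicate (suc n) [])

  fallback : ∀ {T} a b → T + 7 ≤ a * suc N + b * suc N * suc N → a + b ≤ 100 → Fails initialConf T →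
    decode (suc n) u ≡ nothing →
    ∃[ z ] Runs (normaliser (suc n) zero) 100 u v z × Normalised (instanceOfBits (suc n) u) z
  fallback a b T≤ small (σ , r) none =
    -- The jump to `fail` and its six pushes take 7 steps.
    true ∷ false ∷ false ∷ false ∷ false ∷ false ∷ [] , (σ , within (quadratic a b T≤ small) (r ▸ by 7))
        ,
    subst (λ x → Normalised (fromMaybe (Vec.replicate (suc n) 0 , const false) x) _) (sym none)
      (1 , false ∷ false ∷ false ∷ false ∷ [] , refl ,
       (λ i → ≤-reflexive (cong (λ m → suc m * 2) (lookup-replicate i 0))) ,
       (λ {ns} fit χs rest → parseBits-const ns rest false χs))

  finish-up : ∀ body t D {w h j x : List Bool} →
    conf finish w (body ʳ++ []) h j x t D ⇒⟨ length (body ʳ++ []) * 3 + 3 + (length t * 3 + 2) ⟩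
    (halt , ones (suc (length t)) (false ∷ body) ∷ w ∷ v ∷ [] ∷ h ∷ j ∷ x ∷ [] ∷ D)
  finish-up body t D {w} {h} {j} {x} =
    subst (λ o → conf finish w (body ʳ++ []) h j x t D
        ⇒⟨ cost ⟩ (halt , (true ∷ o) ∷ w ∷ v ∷ [] ∷ h ∷ j ∷ x ∷ [] ∷ D))
      (trans (truesOnto-ones t _)
          (cong (λ b → ones (length t) (false ∷ b)) (trans (ʳ++-ʳ++ body) (++-identityʳ body))))
      (finish-all (body ʳ++ []) ▸ count-all t)
    where
    cost : ℕ
    cost = length (body ʳ++ []) * 3 + 3 + (length t * 3 + 2)

  result : ∃[ z ] Runs (normaliser (suc n) zero) 100 u v z × Normalised (instanceOfBits (suc n) u) z
  result with headers (suc n) id (λ j → sym (map-id (fin-next j))) id u [] (Vec.replicate (suc n) [])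
      (λ j → lookup-replicate j [])
  ... | rejected fails none = fallback 19 0
    (≤-trans (_⊕_ {12} {7} (linear 6 6 ≤-refl) (constant 7)) (m≤m+n _ 0)) (≤ᵇ⇒≤ 19 100 _) fails
    (decode-header (suc n) u none)
  ... | accepted ms w t D r header-eq total _ values lengths _ =
    continue (tokens (length w) w [] [] [] ≤-refl w≤N refl)
    where
    t≤N : length t ≤ N
    t≤N = ≤-trans (m≤m+n _ _) total

    w≤N : length w ≤ N
    w≤N = ≤-trans (m≤n+m _ _) total

    open Tokens (suc n) zero v ms D t N values (λ i → ≤-trans (lengths i) t≤N)
      using (tokens; A) renaming
          (Outcome to TokensOutcome; rejected to tokens-rejected; accepted to tokens-accepted)

    tokens-time : A * suc (length w) ≤ 60 * suc N * suc N
    tokens-time = *-monoʳ-≤ A (s≤s w≤N)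

    start-time : N * 6 + 6 ≤ 12 * suc N
    start-time = linear 6 6 ≤-refl

    decoded : decode (suc n) u ≡ Maybe.map (ms ,_) (parseBits ms w [])
    decoded = decode-parse (suc n) u {ms} {w} header-eq

    continue : TokensOutcome w [] [] [] →
      ∃[ z ] Runs (normaliser (suc n) zero) 100 u v z × Normalised (instanceOfBits (suc n) u) z
    continue (tokens-rejected fails none) = fallback 19 60
      (≤-trans (+-monoˡ-≤ 7 (+-mono-≤ start-time tokens-time))
        (≤-trans (≤-reflexive (swap (12 * suc N) (60 * suc N * suc N) 7))
            (+-monoˡ-≤ (60 * suc N * suc N) (_⊕_ {12} {7} ≤-refl (constant 7)))))
      (≤ᵇ⇒≤ 79 100 _) (r ▸ᶠ fails) (trans decoded (cong (Maybe.map (ms ,_)) none))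
      where
      swap : ∀ a b c → a + b + c ≡ a + c + b
      swap = solve-∀
    continue (tokens-accepted body φ r′ parsed small correct) =
      ones (suc (length t)) (false ∷ body) , (_ , within time (r ▸ r′ ▸ finish-up body t D)) ,
      subst (λ x → Normalised (fromMaybe (Vec.replicate (suc n) 0 , const false) x) _)
        (sym (trans decoded (cong (Maybe.map (ms ,_)) parsed)))
        (suc (length t) , body , refl , dimension , λ fit χs rest → correct fit χs rest)
      where
      body≤ : length (body ʳ++ []) ≤ 2 * N
      body≤ = ≤-trans (≤-reflexive (trans (length-ʳ++ body) (+-identityʳ _)))
          (≤-trans small (*-monoʳ-≤ 2 w≤N))

      body-time : length (body ʳ++ []) * 3 + 3 ≤ 9 * suc N
      body-time = ≤-trans (+-monoˡ-≤ 3 (≤-trans (*-monoˡ-≤ 3 body≤) (≤-reflexive (rearrange N))))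
          (linear 6 3 ≤-refl)
        where
        rearrange : ∀ m → 2 * m * 3 ≡ m * 6
        rearrange = solve-∀

      time : N * 6 + 6 + (A * suc (length w) + (length (body ʳ++ []) * 3 + 3 + (length t * 3 + 2))) ≤
          100 * (suc K * suc K)
      time = quadratic 26 60
        (≤-trans (+-mono-≤ start-time (+-mono-≤ tokens-time (_⊕_ {9} {5} body-time (linear 3 2 t≤N))))
          (≤-reflexive (rearrange (suc N))))
        (≤ᵇ⇒≤ 86 100 _)
        where
        rearrange : ∀ m → 12 * m + (60 * m * m + 14 * m) ≡ 26 * m + 60 * m * m
        rearrange = solve-∀

      dimension : ∀ i → suc (lookup ms i) * 2 ≤ 2 ^ suc (length t)
      dimension i = ≤-trans (*-monoˡ-≤ 2 (≤-trans (≤-reflexive (cong suc (sym (values i))))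
          (≤-trans (value<2^ (lookup D i)) (^-monoʳ-≤ 2 (lengths i)))))
        (≤-reflexive (*-comm (2 ^ length t) 2))

-- The choice between two instances

data MergeLabel (n : ℕ) : Set where
  size₁ body₁ size₂ body₂ assemble : MergeLabel n
  dims      : Fin (suc n) → MergeLabel n
  copy back : Fin n → MergeLabel n

MergeLabel-finite : ∀ n → Finite (MergeLabel n)
MergeLabel-finite n = retract to from from-to
  (⊎-finite (Fin-finite 5) (⊎-finite (Fin-finite (suc n)) (⊎-finite (Fin-finite n) (Fin-finite n))))
  where
  to : MergeLabel n → Fin 5 ⊎ Fin (suc n) ⊎ Fin n ⊎ Fin n
  to size₁    = inj₁ zero
  to body₁    = inj₁ (suc zero)
  to size₂    = inj₁ (suc (suc zero))
  to body₂    = inj₁ (suc (suc (suc zero)))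
  to assemble = inj₁ (suc (suc (suc (suc zero))))
  to (dims m) = inj₂ (inj₁ m)
  to (copy m) = inj₂ (inj₂ (inj₁ m))
  to (back m) = inj₂ (inj₂ (inj₂ m))

  from : Fin 5 ⊎ Fin (suc n) ⊎ Fin n ⊎ Fin n → MergeLabel n
  from (inj₁ zero)                         = size₁
  from (inj₁ (suc zero))                   = body₁
  from (inj₁ (suc (suc zero)))             = size₂
  from (inj₁ (suc (suc (suc zero))))       = body₂
  from (inj₁ (suc (suc (suc (suc zero))))) = assemble
  from (inj₂ (inj₁ m))                     = dims m
  from (inj₂ (inj₂ (inj₁ m)))              = copy m
  from (inj₂ (inj₂ (inj₂ m)))              = back m

  from-to : ∀ l → from (to l) ≡ l
  from-to size₁    = refl
  from-to body₁    = refl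
  from-to size₂    = refl
  from-to body₂    = refl
  from-to assemble = refl
  from-to (dims m) = refl
  from-to (copy m) = refl
  from-to (back m) = refl

-- These turn φ into conj φ firstVar, and then ψ into the second disjunct of choice φ ψ.
middleBits finalBits : List Bool
middleBits = 𝟎 ∷ 𝟎 ∷ 𝟏 ∷ 𝟏 ∷ 𝟏 ∷ 𝟎 ∷ 𝟏 ∷ 𝟎 ∷ 𝟎 ∷ 𝟏 ∷ 𝟎 ∷ []
finalBits  = 𝟎 ∷ 𝟎 ∷ 𝟏 ∷ 𝟎 ∷ 𝟎 ∷ 𝟎 ∷ 𝟏 ∷ 𝟏 ∷ 𝟏 ∷ 𝟎 ∷ 𝟏 ∷ 𝟎 ∷ 𝟎 ∷ 𝟎 ∷ 𝟏 ∷ 𝟎 ∷ 𝟎 ∷ 𝟏 ∷ 𝟎 ∷ 𝟎 ∷ 𝟏 ∷ 𝟏 ∷ []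

pattern firstₛ   = suc zero
pattern secondₛ  = suc (suc zero)
pattern formulaₛ = suc (suc (suc zero))
pattern lengthₛ  = suc (suc (suc (suc zero)))
pattern spareₛ   = suc (suc (suc (suc (suc zero))))

-- Both unary exponents are counted on the same stack, and their sum serves as common exponent. The
-- output is written back to front: the formula, then for each dimension the terminator, L digits 1
-- and the tag of a number. Writing the digits uses up the counter, so `copy` keeps it on the spare
-- stack and `back` restores it.
merger : ℕ → Flowchart 6
merger n = record
  { Label        = MergeLabel n
  ; Label-finite = MergeLabel-finite n
  ; block        = block
  ; entry        = size₁
  }
  where
  block : MergeLabel n → Code 6 (MergeLabel n)
  block size₁    = pop firstₛ halt λ b → if b then push lengthₛ true (goto size₁) else goto body₁
  block body₁    = pop firstₛ (pushes formulaₛ middleBits (goto size₂)) λ b →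
      push formulaₛ b (goto body₁)
  block size₂    = pop secondₛ halt λ b → if b then push lengthₛ true (goto size₂) else goto body₂
  block body₂    = pop secondₛ (pushes formulaₛ finalBits (goto assemble)) λ b →
      push formulaₛ b (goto body₂)
  block assemble = pop formulaₛ (goto (dims (fromℕ n))) λ b → push zero b (goto assemble)
  block (dims zero)    = halt
  block (dims (suc m)) = push zero false (goto (copy m))
  block (copy m) = pop lengthₛ (goto (back m)) λ _ →
      push zero true (push zero true (push spareₛ true (goto (copy m))))
  block (back m) = pop spareₛ (push zero true (goto (dims (inject₁ m)))) λ _ → push lengthₛ true
      (goto (back m))

-- Correctness and running time of the merger

length-ones : ∀ L → length (ones L []) ≡ L
length-ones zero    = refl
length-ones (suc L) = cong suc (length-ones L)

length-ones-++ : ∀ L w → length (ones L w) ≡ L + length w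
length-ones-++ zero    w = refl
length-ones-++ (suc L) w = cong suc (length-ones-++ L w)

-- With `a = 0`: the numeral of L ones is 2 ^ L - 1. Codes contain predecessors, so it stands for
-- the dimension 2 ^ L.
horner-ones : ∀ a L → suc (horner a (ones L [])) ≡ suc a * 2 ^ L
horner-ones a zero    = sym (*-identityʳ (suc a))
horner-ones a (suc L) = trans (horner-ones (1 + a * 2) L) (*-assoc (suc a) 2 (2 ^ L))

numbers : ℕ → ℕ → List Bool → List Bool
numbers zero    L w = w
numbers (suc m) L w = true ∷ (ones L [] then numbers m L w)

numbers-snoc : ∀ m L w → numbers m L (true ∷ (ones L [] then w)) ≡ numbers (suc m) L w
numbers-snoc zero    L w = refl
numbers-snoc (suc m) L w = cong (λ r → true ∷ (ones L [] then r)) (numbers-snoc m L w)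

header-numbers : ∀ m L w → (lex (numbers m L w) >>= header m) ≡
  Maybe.map (Vec.replicate m (horner 0 (ones L [])) ,_) (lex w)
header-numbers zero    L w = >>=-just (lex w)
header-numbers (suc m) L w = trans (header-number m (numbers (suc m) L w))
  (trans (numberFrom-good 0 (ones L []) (numbers m L w) _)
    (trans (header-cons m _ (lex (numbers m L w)))
      (trans (cong (Maybe.map _) (header-numbers m L w)) (sym (map-∘ (lex w))))))

module Merger (n : ℕ) where

  open Flowchart (merger n) using (block)
  open Run (merger n)

  trues : ℕ → List Bool
  trues L = ones L []

  size₁-all : ∀ L {k o w v f s} → (block size₁ , o ∷ ones L (false ∷ w) ∷ v ∷ f ∷ trues k ∷ s ∷ [])
      ⇒⟨ L * 3 + 2 ⟩
    (block body₁ , o ∷ w ∷ v ∷ f ∷ trues (L + k) ∷ s ∷ [])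
  size₁-all zero    = by 2
  size₁-all (suc L) {k} {o} {w} {v} {f} {s} = by 3 ▸
      subst (λ l → (block size₁ , o ∷ ones L (false ∷ w) ∷ v ∷ f ∷ trues (suc k) ∷ s ∷ [])
      ⇒⟨ L * 3 + 2 ⟩ (block body₁ , o ∷ w ∷ v ∷ f ∷ trues l ∷ s ∷ []))
    (+-suc L k) (size₁-all L {suc k})

  size₂-all : ∀ L {k o w v f s} → (block size₂ , o ∷ v ∷ ones L (false ∷ w) ∷ f ∷ trues k ∷ s ∷ [])
      ⇒⟨ L * 3 + 2 ⟩
    (block body₂ , o ∷ v ∷ w ∷ f ∷ trues (L + k) ∷ s ∷ [])
  size₂-all zero    = by 2
  size₂-all (suc L) {k} {o} {w} {v} {f} {s} = by 3 ▸
      subst (λ l → (block size₂ , o ∷ v ∷ ones L (false ∷ w) ∷ f ∷ trues (suc k) ∷ s ∷ [])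
      ⇒⟨ L * 3 + 2 ⟩ (block body₂ , o ∷ v ∷ w ∷ f ∷ trues l ∷ s ∷ []))
    (+-suc L k) (size₂-all L {suc k})

  body₁-all : ∀ w {o v f t s} → (block body₁ , o ∷ w ∷ v ∷ f ∷ t ∷ s ∷ []) ⇒⟨ length w * 3 + 13 ⟩
    (block size₂ , o ∷ [] ∷ v ∷ (middleBits ʳ++ (w ʳ++ f)) ∷ t ∷ s ∷ [])
  body₁-all []      = by 13
  body₁-all (b ∷ w) = by 3 ▸ body₁-all w

  body₂-all : ∀ w {o u f t s} → (block body₂ , o ∷ u ∷ w ∷ f ∷ t ∷ s ∷ []) ⇒⟨ length w * 3 + 24 ⟩
    (block assemble , o ∷ u ∷ [] ∷ (finalBits ʳ++ (w ʳ++ f)) ∷ t ∷ s ∷ [])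
  body₂-all []      = by 24
  body₂-all (b ∷ w) = by 3 ▸ body₂-all w

  assemble-all : ∀ f {o u v t s} → (block assemble , o ∷ u ∷ v ∷ f ∷ t ∷ s ∷ []) ⇒⟨ length f * 3 + 2 ⟩
    (block (dims (fromℕ n)) , (f ʳ++ o) ∷ u ∷ v ∷ [] ∷ t ∷ s ∷ [])
  assemble-all []      = by 2
  assemble-all (b ∷ f) = by 3 ▸ assemble-all f

  copy-all : ∀ m L {k ds w u v f} →
      (block (copy m) , (trues ds then w) ∷ u ∷ v ∷ f ∷ trues L ∷ trues k ∷ []) ⇒⟨ L * 5 + 2 ⟩
    (block (back m) , (trues (L + ds) then w) ∷ u ∷ v ∷ f ∷ [] ∷ trues (L + k) ∷ [])
  copy-all m zero    = by 2
  copy-all m (suc L) {k} {ds} {w} {u} {v} {f} = by 5 ▸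
    subst₂ (λ d l → (block (copy m) , (trues (suc ds) then w) ∷ u ∷ v ∷ f ∷ trues L ∷ trues (suc k) ∷ [])
        ⇒⟨ L * 5 + 2 ⟩ (block (back m) , (trues d then w) ∷ u ∷ v ∷ f ∷ [] ∷ trues l ∷ []))
      (+-suc L ds) (+-suc L k) (copy-all m L {suc k} {suc ds})

  back-all : ∀ m L {k o u v f} → (block (back m) , o ∷ u ∷ v ∷ f ∷ trues k ∷ trues L ∷ []) ⇒⟨ L * 3 + 3 ⟩
    (block (dims (inject₁ m)) , (true ∷ o) ∷ u ∷ v ∷ f ∷ trues (L + k) ∷ [] ∷ [])
  back-all m zero    = by 3
  back-all m (suc L) {k} {o} {u} {v} {f} = by 3 ▸
    subst (λ l → (block (back m) , o ∷ u ∷ v ∷ f ∷ trues (suc k) ∷ trues L ∷ [])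
        ⇒⟨ L * 3 + 3 ⟩ (block (dims (inject₁ m)) , (true ∷ o) ∷ u ∷ v ∷ f ∷ trues l ∷ [] ∷ []))
      (+-suc L k) (back-all m L {suc k})

  dims-all : ∀ i (m : Fin (suc n)) → toℕ m ≡ i → ∀ L {w u v f} →
    (block (dims m) , w ∷ u ∷ v ∷ f ∷ trues L ∷ [] ∷ []) ⇒⟨ i * (L * 8 + 7) ⟩
    (halt , numbers i L w ∷ u ∷ v ∷ f ∷ trues L ∷ [] ∷ [])
  dims-all zero    zero    refl L = by 0
  dims-all (suc i) (suc m) eq   L {w} {u} {v} {f} =
    within (≤-reflexive (arithmetic i L))
      (by 2 ▸ copy-back ▸
       subst (λ z →
           (block (dims (inject₁ m)) , (true ∷ (trues L then w)) ∷ u ∷ v ∷ f ∷ trues L ∷ [] ∷ [])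
           ⇒⟨ i * (L * 8 + 7) ⟩ (halt , z ∷ u ∷ v ∷ f ∷ trues L ∷ [] ∷ [])) (numbers-snoc i L w)
         (dims-all i (inject₁ m) (trans (toℕ-inject₁ m) (suc-injective eq)) L))
    where
    arithmetic : ∀ i L → 2 + ((L * 5 + 2) + (L * 3 + 3) + i * (L * 8 + 7)) ≡ suc i * (L * 8 + 7)
    arithmetic = solve-∀

    copy-back : (block (copy m) , ([] then w) ∷ u ∷ v ∷ f ∷ trues L ∷ [] ∷ [])
        ⇒⟨ (L * 5 + 2) + (L * 3 + 3) ⟩
      (block (dims (inject₁ m)) , (true ∷ (trues L then w)) ∷ u ∷ v ∷ f ∷ trues L ∷ [] ∷ [])
    copy-back = subst (λ l → (block (copy m) , ([] then w) ∷ u ∷ v ∷ f ∷ trues L ∷ [] ∷ [])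
        ⇒⟨ (L * 5 + 2) + (L * 3 + 3) ⟩
        (block (dims (inject₁ m)) , (true ∷ (trues l then w)) ∷ u ∷ v ∷ f ∷ trues l ∷ [] ∷ []))
      (+-identityʳ L) (copy-all m L {0} {0} ▸ backed)
      where
      backed : (block (back m) , (trues (L + 0) then w) ∷ u ∷ v ∷ f ∷ trues 0 ∷ trues (L + 0) ∷ [])
          ⇒⟨ L * 3 + 3 ⟩
        (block (dims (inject₁ m)) , (true ∷ (trues (L + 0) then w)) ∷ u ∷ v ∷ f ∷ trues
            (L + 0) ∷ [] ∷ [])
      backed = subst (λ l →
          (block (back m) , (trues (L + 0) then w) ∷ u ∷ v ∷ f ∷ trues 0 ∷ trues l ∷ [])
          ⇒⟨ L * 3 + 3 ⟩ (block (dims (inject₁ m)) , (true ∷ (trues (L + 0) then w)) ∷ u ∷ v ∷ f ∷ trues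
          (L + 0) ∷ [] ∷ []))
        (sym (+-identityʳ L)) (back-all m L {0})

Merged : ∀ {n} → Instance (suc n) → Instance (suc n) → List Bool → Set
Merged {n} (ms₁ , φ) (ms₂ , ψ) z = ∃[ ms ] Σ (Fits ms₁ ms) λ fit₁ → Σ (Fits ms₂ ms) λ fit₂ →
  decode (suc n) z ≡ just (ms , choice (spread fit₁ φ) (spread fit₂ ψ))

runtime : (n l₁ b₁ l₂ b₂ r : ℕ) → ℕ
runtime n l₁ b₁ l₂ b₂ r =
  (l₁ * 3 + 2)
      + ((b₁ * 3 + 13)
      + ((l₂ * 3 + 2) + ((b₂ * 3 + 24) + ((r * 3 + 2) + suc n * ((l₂ + (l₁ + 0)) * 8 + 7)))))

abstract
  mergerBudget : ℕ → ℕ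
  -- 160 = 5 + 16 + 5 + 27 + 107 for the phases up to the reversal of the formula, and 15 for each
  -- dimension.
  mergerBudget n = 160 + suc n * 15

  -- 33 = 11 + 22 is the joint length of `middleBits` and `finalBits`, the part of the formula that
  -- does not come from the two bodies.
  runtime≤ : ∀ n l₁ b₁ l₂ b₂ r → r ≡ b₂ + b₁ + 33 → let N = (l₁ + suc b₁) + (l₂ + suc b₂) in
    runtime n l₁ b₁ l₂ b₂ r ≤ mergerBudget n * (suc N * suc N)
  runtime≤ n l₁ b₁ l₂ b₂ r refl = ≤-trans
    (+-mono-≤ (linear 3 2 l₁≤N)
        (+-mono-≤ (linear 3 13 b₁≤N) (+-mono-≤ (linear 3 2 l₂≤N) (+-mono-≤ (linear 3 24 b₂≤N)
      (+-mono-≤ reversed-time (*-monoʳ-≤ (suc n) (linear 8 7 L≤N)))))))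
    (≤-trans (≤-reflexive (total (suc N) (suc n)))
        (*-monoʳ-≤ (160 + suc n * 15) (m≤m*n (suc N) (suc N))))
    where
    N : ℕ
    N = (l₁ + suc b₁) + (l₂ + suc b₂)

    open Budget N

    total : ∀ m k → 5 * m + (16 * m + (5 * m + (27 * m + (107 * m + k * (15 * m))))) ≡ (160 + k * 15) * m
    total = solve-∀

    part : ∀ x y → x + y ≡ N → x ≤ N
    part x y eq = ≤-trans (m≤m+n x y) (≤-reflexive eq)

    l₁≤N : l₁ ≤ N
    l₁≤N = part l₁ (suc b₁ + (l₂ + suc b₂)) (sym (+-assoc l₁ _ _))

    b₁≤N : b₁ ≤ N
    b₁≤N = part b₁ (l₁ + suc (l₂ + suc b₂)) (arithmetic b₁ l₁ (l₂ + suc b₂))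
      where
      arithmetic : ∀ b l r → b + (l + suc r) ≡ l + suc b + r
      arithmetic = solve-∀

    l₂≤N : l₂ ≤ N
    l₂≤N = part l₂ (l₁ + suc b₁ + suc b₂) (arithmetic l₂ (l₁ + suc b₁) (suc b₂))
      where
      arithmetic : ∀ l a b → l + (a + b) ≡ a + (l + b)
      arithmetic = solve-∀

    b₂≤N : b₂ ≤ N
    b₂≤N = part b₂ (l₁ + suc b₁ + suc l₂) (arithmetic l₂ (l₁ + suc b₁) b₂)
      where
      arithmetic : ∀ l a b → b + (a + suc l) ≡ a + (l + suc b)
      arithmetic = solve-∀

    L≤N : l₂ + (l₁ + 0) ≤ N
    L≤N = part (l₂ + (l₁ + 0)) (suc b₁ + suc b₂) (arithmetic l₁ b₁ l₂ b₂)
      where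
      arithmetic : ∀ l₁ b₁ l₂ b₂ → l₂ + (l₁ + 0) + (suc b₁ + suc b₂) ≡ l₁ + suc b₁ + (l₂ + suc b₂)
      arithmetic = solve-∀

    reversed-time : (b₂ + b₁ + 33) * 3 + 2 ≤ 107 * suc N
    reversed-time = ≤-trans (≤-reflexive (arithmetic b₂ b₁))
        (≤-trans (+-mono-≤ (proportional 3 b₂≤N) (linear 3 101 b₁≤N))
      (≤-reflexive (sym (*-distribʳ-+ (suc N) 3 104))))
      where
      arithmetic : ∀ x y → (x + y + 33) * 3 + 2 ≡ x * 3 + (y * 3 + 101)
      arithmetic = solve-∀

merger-runs : ∀ n {I J : Instance (suc n)} u v → Normalised I u → Normalised J v →
  ∃[ z ] Runs (merger (suc n)) (mergerBudget n) u v z × Merged I J z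
merger-runs n {ms₁ , φ} {ms₂ , ψ} u v (L₁ , b₁ , refl , big₁ , correct₁)
    (L₂ , b₂ , refl , big₂ , correct₂) =
  numbers (suc n) L formula , (_ , within time run) , ms , fit₁ , fit₂ , decoded
  where
  open Merger (suc n)
  open Flowchart (merger (suc n)) using (block)
  open Run (merger (suc n))

  L N : ℕ
  L = L₂ + (L₁ + 0)
  N = length (ones L₁ (false ∷ b₁)) + length (ones L₂ (false ∷ b₂))

  formula reversed : List Bool
  formula = b₁ ++ middleBits ++ b₂ ++ finalBits
  reversed = finalBits ʳ++ (b₂ ʳ++ (middleBits ʳ++ (b₁ ʳ++ [])))

  reversed-formula : reversed ʳ++ [] ≡ formula
  reversed-formula = trans (ʳ++-ʳ++ finalBits {b₂ ʳ++ (middleBits ʳ++ (b₁ ʳ++ []))})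
      (trans (ʳ++-ʳ++ b₂ {middleBits ʳ++ (b₁ ʳ++ [])})
      (trans (ʳ++-ʳ++ middleBits {b₁ ʳ++ []}) (ʳ++-ʳ++ b₁ {[]})))

  run : (block size₁ , [] ∷ ones L₁ (false ∷ b₁) ∷ ones L₂ (false ∷ b₂) ∷ [] ∷ [] ∷ [] ∷ [])
    ⇒⟨ runtime n L₁ (length b₁) L₂ (length b₂) (length reversed) ⟩
    (halt , numbers (suc n) L formula ∷ [] ∷ [] ∷ [] ∷ trues L ∷ [] ∷ [])
  run = size₁-all L₁ ▸ body₁-all b₁ ▸ size₂-all L₂ ▸ body₂-all b₂ ▸ assemble-all reversed ▸
    subst (λ w → (block (dims (fromℕ (suc n))) , w ∷ [] ∷ [] ∷ [] ∷ trues L ∷ [] ∷ [])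
        ⇒⟨ suc n * (L * 8 + 7) ⟩
                 (halt , numbers (suc n) L formula ∷ [] ∷ [] ∷ [] ∷ trues L ∷ [] ∷ []))
      (sym reversed-formula) (dims-all (suc n) (fromℕ (suc n)) (toℕ-fromℕ (suc n)) L)

  ms : Vec ℕ (suc n)
  ms = Vec.replicate (suc n) (horner 0 (ones L []))

  -- Subtracting 1 from 2 (m + 1) ≤ 2 ^ L gives 2m + 1 ≤ 2 ^ L - 1, and the right side is the entry
  -- of `ms`.
  fit : ∀ {ms′ : Vec ℕ (suc n)} L′ → L′ ≤ L → (∀ i → suc (lookup ms′ i) * 2 ≤ 2 ^ L′) → Fits ms′ ms
  fit {ms′} L′ L′≤L big = fits ms′ ms λ i → s≤s⁻¹ (≤-trans
    (≤-reflexive (cong (λ m → suc (suc m)) (*-comm 2 (lookup ms′ i))))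
    (≤-trans (big i) (≤-trans (^-monoʳ-≤ 2 L′≤L) (≤-reflexive (trans (sym (+-identityʳ (2 ^ L)))
      (trans (sym (horner-ones 0 L)) (cong suc (sym (lookup-replicate i (horner 0 (ones L []))))))))))) 

  fit₁ : Fits ms₁ ms
  fit₁ = fit L₁ (≤-trans (m≤m+n L₁ 0) (m≤n+m _ L₂)) big₁

  fit₂ : Fits ms₂ ms
  fit₂ = fit L₂ (m≤m+n L₂ _) big₂

  decoded : decode (suc n) (numbers (suc n) L formula) ≡
      just (ms , choice (spread fit₁ φ) (spread fit₂ ψ))
  decoded = trans (decode-parse (suc n) (numbers (suc n) L formula) {ms} {formula}
      (header-numbers (suc n) L formula))
    (cong (Maybe.map (ms ,_)) parsed)
    where
    φ′ ψ′ : Formula ms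
    φ′ = spread fit₁ φ
    ψ′ = spread fit₂ ψ

    parsed : parseBits ms formula [] ≡ just (choice φ′ ψ′)
    parsed = trans (correct₁ fit₁ [] (middleBits ++ b₂ ++ finalBits))
      -- The digit lists are empty: both numbers of `firstVar` are 0, written without any digit,
      -- which the lexer reads as 0.
      (trans (parse-var ms [] [] (𝟎 ∷ 𝟏 ∷ 𝟎 ∷ b₂ ++ finalBits) (φ′ ∷ []))
        (trans (parseBits-and ms (b₂ ++ finalBits) φ′ firstVar [])
          -- What remains is the closed string `finalBits`, and parsing it is a matter of
          -- evaluation.
          (correct₂ fit₂ (conj φ′ firstVar ∷ []) finalBits)))

  length-reversed : length reversed ≡ length b₂ + length b₁ + 33
  length-reversed = trans (length-ʳ++ finalBits {b₂ ʳ++ (middleBits ʳ++ (b₁ ʳ++ []))})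
    (trans (cong (22 +_)
        (trans (length-ʳ++ b₂)
        (cong (length b₂ +_)
        (trans (length-ʳ++ middleBits {b₁ ʳ++ []}) (cong (11 +_) (length-ʳ++ b₁))))))
      (arithmetic (length b₂) (length b₁)))
    where
    arithmetic : ∀ x y → 22 + (x + (11 + (y + 0))) ≡ x + y + 33
    arithmetic = solve-∀

  time : runtime n L₁ (length b₁) L₂ (length b₂) (length reversed) ≤ mergerBudget n * (suc N * suc N)
  time = subst (λ m → runtime n L₁ (length b₁) L₂ (length b₂) (length reversed) ≤ mergerBudget
      n * (suc m * suc m))
    (sym (cong₂ _+_ (length-ones-++ L₁ (false ∷ b₁)) (length-ones-++ L₂ (false ∷ b₂))))
    (runtime≤ n L₁ (length b₁) L₂ (length b₂) (length reversed) length-reversed)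

-- Reductions between VAL, SAT and SAT‾

-- A stack grows only at its front, so the word is set aside in reverse, `s` is pushed from its last
-- bit on, and the word is put back before it.
appender : List Bool → Flowchart 4
appender s = record
  { Label        = Bool
  ; Label-finite = Bool-finite
  ; block        = λ
      { false → pop (suc zero) (pushes zero (reverse s) (goto true)) λ b → push (suc (suc (suc zero))) b
          (goto false)
      ; true  → pop (suc (suc (suc zero))) halt λ b → push zero b (goto true) }
  ; entry        = false
  }

appender-runs : ∀ s u v → Runs (appender s) (9 + length s) u v (u ++ s)
appender-runs s u v = _ , within time (unload u ▸ pushing (reverse s) ▸
  subst (λ o → (block true , (reverse s ʳ++ []) ∷ [] ∷ v ∷ (u ʳ++ []) ∷ [])
      ⇒⟨ length (u ʳ++ []) * 3 + 1 ⟩ (halt , o ∷ [] ∷ v ∷ [] ∷ []))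
    (trans (ʳ++-ʳ++ u) (cong (u ++_) (reverse-involutive s))) (load (u ʳ++ [])))
  where
  open Flowchart (appender s) using (block)
  open Run (appender s)
  open Budget (length u + length v)

  unload : ∀ w {o a} → (block false , o ∷ w ∷ v ∷ a ∷ []) ⇒⟨ length w * 3 + 1 ⟩
    (pushes zero (reverse s) (goto true) , o ∷ [] ∷ v ∷ (w ʳ++ a) ∷ [])
  unload []      = by 1
  unload (b ∷ w) = by 3 ▸ unload w

  pushing : ∀ r {o u v a} → (pushes zero r (goto true) , o ∷ u ∷ v ∷ a ∷ []) ⇒⟨ length r + 1 ⟩
    (block true , (r ʳ++ o) ∷ u ∷ v ∷ a ∷ [])
  pushing []      = by 1
  pushing (b ∷ r) = by 1 ▸ pushing r

  load : ∀ a {o} → (block true , o ∷ [] ∷ v ∷ a ∷ []) ⇒⟨ length a * 3 + 1 ⟩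
      (halt , (a ʳ++ o) ∷ [] ∷ v ∷ [] ∷ [])
  load []      = by 1
  load (b ∷ a) = by 3 ▸ load a

  u≤ : length u ≤ length u + length v
  u≤ = m≤m+n _ _

  time : (length u * 3 + 1) + ((length (reverse s) + 1) + (length (u ʳ++ []) * 3 + 1)) ≤
    (9 + length s) * (suc (length u + length v) * suc (length u + length v))
  time = ≤-trans
    (≤-trans (_⊕_ {4} {length (reverse s) + 1 + 4} (linear 3 1 u≤)
        (_⊕_ {length (reverse s) + 1} {4} (constant (length (reverse s) + 1))
          (linear 3 1 (≤-trans (≤-reflexive (trans (length-ʳ++ u) (+-identityʳ _))) u≤))))
      (≤-reflexive
          (cong (_* suc (length u + length v))
          (trans (cong (λ l → 4 + (l + 1 + 4)) (length-reverse s)) (arithmetic (length s))))))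
    (*-monoʳ-≤ (9 + length s) (m≤m*n (suc (length u + length v)) (suc (length u + length v))))
    where
    arithmetic : ∀ l → 4 + (l + 1 + 4) ≡ 9 + l
    arithmetic = solve-∀

append-polyTime : ∀ {μ} s → PolyTime μ →
  -- The combination takes two machines; the one for `μ` is supplied for both.
  ∃[ ν ] PolyTime ν × (∀ x → List⁺.toList (ν x) ≡ List⁺.toList (μ x) ++ s)
append-polyTime {μ} s μ-poly = polyTime-combine μ-poly μ-poly (appender s) (9 + length s)
  (λ x w → w ≡ List⁺.toList (μ x) ++ s) (λ _ ())
  (λ x → _ , appender-runs s (List⁺.toList (μ x)) (List⁺.toList (μ x)) , refl)

-- Decoding a code with bits appended

lex-++ : ∀ w {s ts ss} → lex w ≡ just ts → lex s ≡ just ss → lex (w ++ s) ≡ just (ts ++ ss)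
lexNum-++ : ∀ a w {s ts ss} → lexNum a w ≡ just ts → lex s ≡ just ss → lexNum a (w ++ s) ≡
    just (ts ++ ss)

map-just : ∀ {A : Set} {x : A} {xs : List A} (m : Maybe (List A)) → Maybe.map (x ∷_) m ≡ just xs →
    ∃[ ys ] m ≡ just ys × xs ≡ x ∷ ys
map-just (just ys) refl = ys , refl , refl

prepend : ∀ {t ts ss} w {s} → (∀ {ts} → lex w ≡ just ts → lex (w ++ s) ≡ just (ts ++ ss)) →
  Maybe.map (t ∷_) (lex w) ≡ just ts → Maybe.map (t ∷_) (lex (w ++ s)) ≡ just (ts ++ ss)
prepend {t} {ts} {ss} w ih eq =
  let ys , eq′ , shape = map-just (lex w) eq
  in trans (cong (Maybe.map (t ∷_)) (ih eq′)) (cong (λ us → just (us ++ ss)) (sym shape))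

lex-++ [] refl eq′ = eq′
lex-++ (𝟎 ∷ 𝟎 ∷ 𝟎 ∷ b ∷ w) eq eq′ = prepend w (λ e → lex-++ w e eq′) eq
lex-++ (𝟎 ∷ 𝟎 ∷ 𝟏 ∷ 𝟎 ∷ w) eq eq′ = prepend w (λ e → lex-++ w e eq′) eq
lex-++ (𝟎 ∷ 𝟎 ∷ 𝟏 ∷ 𝟏 ∷ w) eq eq′ = prepend w (λ e → lex-++ w e eq′) eq
lex-++ (𝟎 ∷ 𝟏 ∷ 𝟎 ∷ w)     eq eq′ = prepend w (λ e → lex-++ w e eq′) eq
lex-++ (𝟎 ∷ 𝟏 ∷ 𝟏 ∷ w)     eq eq′ = prepend w (λ e → lex-++ w e eq′) eq
lex-++ (𝟏 ∷ w)             eq eq′ = lexNum-++ 0 w eq eq′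

lexNum-++ a (𝟎 ∷ w)     eq eq′ = prepend w (λ e → lex-++ w e eq′) eq
lexNum-++ a (𝟏 ∷ b ∷ w) eq eq′ = lexNum-++ _ w eq eq′

header-++ : ∀ n ts {ss ms us} → header n ts ≡ just (ms , us) → header n (ts ++ ss) ≡ just (ms , us ++ ss)
header-++ zero    ts           refl = refl
header-++ (suc n) (NUM m ∷ ts) eq with header n ts in eq′
header-++ (suc n) (NUM m ∷ ts) {ss} refl | just (ms , us) rewrite header-++ n ts {ss} eq′ = refl

module _ {n} {ms : Vec ℕ n} {φ : Formula ms} (ss : List Token) where

  -- A successful parse ends with its result alone on the stack, and the appended tokens carry on
  -- from there.
  parse-++ : ∀ ts φs → parse ts φs ≡ just φ → parse (ts ++ ss) φs ≡ parse ss (φ ∷ [])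
  parse-++ []             (φ ∷ [])     refl = refl
  parse-++ (CONST b ∷ ts) φs           eq   = parse-++ ts (const b ∷ φs) eq
  parse-++ (VAR ∷ NUM i ∷ NUM j ∷ ts) φs eq with var? ms i j
  ... | just v = parse-++ ts (v ∷ φs) eq
  parse-++ (NEG ∷ ts)     (φ ∷ φs)     eq   = parse-++ ts (neg φ ∷ φs) eq
  parse-++ (AND ∷ ts)     (ψ ∷ φ ∷ φs) eq   = parse-++ ts (conj φ ψ ∷ φs) eq
  parse-++ (OR ∷ ts)      (ψ ∷ φ ∷ φs) eq   = parse-++ ts (disj φ ψ ∷ φs) eq

decode-just : ∀ n w {ms} {φ : Formula {n} ms} → decode n w ≡ just (ms , φ) →
  ∃[ ts ] ∃[ us ] lex w ≡ just ts × header n ts ≡ just (ms , us) × parse us [] ≡ just φ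
decode-just n w eq with lex w
... | just ts with header n ts in eq-h
...   | just (ms , us) with parse {ms = ms} us [] in eq-p
decode-just n w refl | just ts | just (ms , us) | just φ = ts , us , refl , eq-h , eq-p

decode-++ : ∀ n w {s ms ss} {φ : Formula {n} ms} → decode n w ≡ just (ms , φ) → lex s ≡ just ss →
  decode n (w ++ s) ≡ Maybe.map (ms ,_) (parse ss (φ ∷ []))
decode-++ n w {s} {ms} {ss} {φ} eq eq-s with decode-just n w eq
... | ts , us , eq-w , eq-h , eq-p = trans
  (decode-header n (w ++ s)
      (trans (cong (_>>= header n) (lex-++ w {s} eq-w eq-s)) (header-++ n ts {ss} eq-h)))
  (trans (cong (_>>= λ φ → just (ms , φ)) (parse-++ ss us [] eq-p)) (>>=-just (parse ss (φ ∷ []))))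

-- These turn φ into conj φ firstVar and into neg (conj φ (neg firstVar)).
satBits sat‾Bits : List Bool
satBits  = 𝟎 ∷ 𝟎 ∷ 𝟏 ∷ 𝟏 ∷ 𝟏 ∷ 𝟎 ∷ 𝟏 ∷ 𝟎 ∷ 𝟎 ∷ 𝟏 ∷ 𝟎 ∷ []
sat‾Bits = 𝟎 ∷ 𝟎 ∷ 𝟏 ∷ 𝟏 ∷ 𝟏 ∷ 𝟎 ∷ 𝟏 ∷ 𝟎 ∷ 𝟎 ∷ 𝟎 ∷ 𝟏 ∷ 𝟎 ∷ 𝟎 ∷ 𝟏 ∷ 𝟎 ∷ 𝟎 ∷ 𝟎 ∷ 𝟏 ∷ 𝟎 ∷ []

VAL-SAT : ∀ n w w′ → List⁺.toList w′ ≡ List⁺.toList w ++ satBits → ⟦ VAL (suc n) w ⟧ (SAT (suc n) w′)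
VAL-SAT n w w′ eq with decode (suc n) (List⁺.toList w) in eq-w
-- Appending bits may make a malformed code well-formed, so nothing is claimed about how `w′`
-- decodes: the constant 0 has no witness, and any answer is admissible.
... | nothing = val-unsat {m = 0} {Vec.replicate n 0} (eval (const false)) {SAT (suc n) w′}
    (sat-const (Vec.replicate (suc n) 0) false)
... | just (m ∷ ms , φ) rewrite eq | decode-++ (suc n) (List⁺.toList w) {satBits} {m ∷ ms} {φ = φ} eq-w
    refl = val-sat m φ

VAL-SAT‾ : ∀ n w w′ → List⁺.toList w′ ≡ List⁺.toList w ++ sat‾Bits → ⟦ VAL (suc n) w ⟧ (SAT‾ (suc n) w′)
VAL-SAT‾ n w w′ eq with decode (suc n) (List⁺.toList w) in eq-w
... | nothing = val-unsat {m = 0} {Vec.replicate n 0} (eval (const false)) {SAT‾ (suc n) w′}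
    (sat-const (Vec.replicate (suc n) 0) false)
... | just (m ∷ ms , φ) rewrite eq | decode-++ (suc n) (List⁺.toList w) {sat‾Bits} {m ∷ ms} {φ = φ} eq-w
    refl = val-sat‾ m φ

singleton-member : ∀ a → ⟦ singleton a ⟧ a
singleton-member a = T-does (a ≟ a) refl

singleton-unique : ∀ {a b} → ⟦ singleton a ⟧ b → a ≡ b
singleton-unique {a} {b} t = does-elim (a ≟ b) (T-true t)

theorem9 : ∀ (n : ℕ) .{{_ : NonZero n}} →
  [ VAL n ] ≐ [ problem (SAT n) ] ∩ [ problem (SAT‾ n) ]
theorem9 (suc n) = (λ {φ} → forward {φ}) , (λ {φ} → backward {φ})
  where
  forward : ∀ {φ} → [ VAL (suc n) ] φ → [ problem (SAT (suc n)) ] φ × [ problem (SAT‾ (suc n)) ] φ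
  forward {φ} (μ , μ-poly , sound) =
    let ν , ν-poly , ν-eq = append-polyTime satBits μ-poly
        ξ , ξ-poly , ξ-eq = append-polyTime sat‾Bits μ-poly
    in (ν , ν-poly , λ x t →
        sound x (subst ⟦ VAL (suc n) (μ x) ⟧ (singleton-unique t) (VAL-SAT n (μ x) (ν x) (ν-eq x)))) ,
       (ξ , ξ-poly , λ x t →
           sound x (subst ⟦ VAL (suc n) (μ x) ⟧ (singleton-unique t) (VAL-SAT‾ n (μ x) (ξ x) (ξ-eq x))))

  normalise : ∀ {μ} → PolyTime μ →
    ∃[ ν ] PolyTime ν × (∀ x → Normalised (instanceOf (suc n) (μ x)) (List⁺.toList (ν x)))
  normalise {μ} μ-poly = polyTime-combine μ-poly μ-poly (normaliser (suc n) zero) 100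
    (λ x z → Normalised (instanceOf (suc n) (μ x)) z)
    (λ { x (zero , _ , () , _) ; x (suc _ , _ , () , _) })
    (λ x → Normalising.result n (List⁺.toList (μ x)) (List⁺.toList (μ x)))

  backward : ∀ {φ} → [ problem (SAT (suc n)) ] φ × [ problem (SAT‾ (suc n)) ] φ → [ VAL (suc n) ] φ
  backward {φ} ((μ₁ , poly₁ , sound₁) , (μ₂ , poly₂ , sound₂)) =
    let ν₁ , ν₁-poly , normal₁ = normalise poly₁
        ν₂ , ν₂-poly , normal₂ = normalise poly₂
        ν , ν-poly , merged = polyTime-combine ν₁-poly ν₂-poly (merger (suc n)) (mergerBudget n)
          (λ x z → Merged (instanceOf (suc n) (μ₁ x)) (instanceOf (suc n) (μ₂ x)) z)
          -- The empty word lacks a first dimension and so does not decode.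
          (λ { x (_ , _ , _ , ()) })
          (λ x → merger-runs n (List⁺.toList (ν₁ x)) (List⁺.toList (ν₂ x)) (normal₁ x) (normal₂ x))
    in ν , ν-poly , λ x t → sound-at x (ν x) (merged x) t
    where
    sound-at : ∀ x w → Merged (instanceOf (suc n) (μ₁ x)) (instanceOf (suc n) (μ₂ x)) (List⁺.toList w) →
      ∀ {b} → ⟦ VAL (suc n) w ⟧ b → ⟦ φ x ⟧ b
    sound-at x w (ms , fit₁ , fit₂ , eq) t rewrite eq =
      val-choice fit₁ fit₂ (proj₂ (instanceOf (suc n) (μ₁ x))) (proj₂ (instanceOf (suc n) (μ₂ x))) (φ x)
        (sound₁ x (singleton-member (SAT (suc n) (μ₁ x))))
            (sound₂ x (singleton-member (SAT‾ (suc n) (μ₂ x)))) t
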